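{- There is an absolute constant $c>0$ such that the following holds. Let $\delta\in(0,1]$ and let $N$ be a positive integer with $N\ge \exp\exp\exp(\delta^{ -c})$. Let $A\subseteq\{1,\dots,N\}^2$ with $|A|\ge\delta N^2$. Then there exist integers $k,m$ and $d>0$ such that $(k,m),(k+d,m),(k,m+d)$ all belong to $A$. -}

module Defs where

open import Data.Nat using (ℕ; zero; suc; _≤_)
open import Data.Bool using (Bool; true; false)
open import Data.Integer using (+_)
open import Data.Product using (∃; _×_)
open import Data.Rational.Unnormalised
  using (ℚᵘ; 0ℚᵘ; 1ℚᵘ; _/_) renaming (_+_ to _+ᵘ_; _*_ to _*ᵘ_; _≤_ to _≤ᵘ_; _<_ to _<ᵘ_)
open import Relation.Binary.PropositionalEquality using (_≡_)

-- Finite sets A ⊆ {1,…,N}² are given by a Boolean predicate P on ℕ²: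
-- A = {(x,y) : 1 ≤ x ≤ N, 1 ≤ y ≤ N, P x y ≡ true}.

countRow : (ℕ → ℕ → Bool) → ℕ → ℕ → ℕ
countRow P x zero    = 0
countRow P x (suc n) with P x (suc n)
... | true  = suc (countRow P x n)
... | false = countRow P x n

countRect : (ℕ → ℕ → Bool) → ℕ → ℕ → ℕ
countRect P N zero    = 0
countRect P N (suc n) = countRow P (suc n) N Data.Nat.+ countRect P N n
  where import Data.Nat

card : (ℕ → ℕ → Bool) → ℕ → ℕ
card P N = countRect P N N

InA : (ℕ → ℕ → Bool) → ℕ → ℕ → ℕ → Set
InA P N x y = (1 ≤ x) × (x ≤ N) × (1 ≤ y) × (y ≤ N) × (P x y ≡ true)

-- Exact rational encoding of the real condition  exp(exp(exp x)) ≤ N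
-- for a rational x ≥ 0.

-- a / b as an unnormalised rational (b = 0 never used)
frac : ℕ → ℕ → ℚᵘ
frac a zero    = 0ℚᵘ
frac a (suc b) = (+ a) / suc b

expTerm : ℚᵘ → ℕ → ℚᵘ
expTerm x zero    = 1ℚᵘ
expTerm x (suc k) = (expTerm x k *ᵘ x) *ᵘ ((+ 1) / suc k)

expPartial : ℚᵘ → ℕ → ℚᵘ
expPartial x zero    = 1ℚᵘ
expPartial x (suc n) = expPartial x n +ᵘ expTerm x (suc n)

-- For s ≥ 0 the partial sums increase to e^s, hence:
-- r < e^s   iff   r < S_n(s) for some n
LtExp : ℚᵘ → ℚᵘ → Set
LtExp r s = ∃ λ n → r <ᵘ expPartial s n

-- e^r ≤ y   iff   S_n(r) ≤ y for all n      (r ≥ 0)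
ExpLe : ℚᵘ → ℚᵘ → Set
ExpLe r y = ∀ n → expPartial r n ≤ᵘ y

-- exp(exp(exp x)) ≤ N  (x ≥ 0), written out:
-- for all rationals r, t ≥ 0 with t < e^x and r < e^t, e^r ≤ N.
-- (The set of such r is exactly [0, e^{e^x}) ∩ ℚ, and e^{e^{e^x}} ≤ N
--  iff e^r ≤ N for all those r, by continuity and monotonicity of exp.)
Tower3Le : ℚᵘ → ℕ → Set
Tower3Le x N = ∀ r t → 0ℚᵘ ≤ᵘ r → 0ℚᵘ ≤ᵘ t → LtExp t x → LtExp r t →
               ExpLe r (frac N 1)

{-# OPTIONS --safe #-}
module Submission where

-- Shkredov's density increment argument, with arithmetic progressions as ambient
-- structures. Let A ⊆ E × F ⊆ [0,n)² be corner-free of density δ in E × F. A corner is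
-- a triangle on the vertices x, y, z = x + y + d, so if E and F are uniform, two
-- applications of Cauchy–Schwarz to the triangle count give A a density increment
-- δ^O(1) on a product subset of E × F. If E or F is not uniform, it has a large Fourier
-- coefficient at some θ on the unit circle; by Dirichlet a power θᵈ is close to 1, and the
-- energy of E and F grows on progressions of difference d and length about n^(1/4).
-- A potential combining surplus density and energy selects one good progression each
-- time. There are δ^-O(1) increments, E × F has density at least exp(-δ^-O(1)), and so
-- the length suffers exp(δ^-O(1)) fourth roots: this is where the three exponentials
-- come from.
open import Defs

-- Density relative to E × F does not pass well to progressions, since E × F may be thin on some of
-- them. What averages exactly is the additive surplus |A| - δ|E||F|, so the potential is built on
-- it, with a weight κ on the energy too small for energy to pass for surplus. E and F need to be
-- uniform only relative to the whole interval, but the error must then lie below the fourth power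
-- of the guaranteed surplus, which is why the Fourier threshold is as small as exp(-δ^-O(1)).
--
-- A triangle x, y, z has a difference d of either sign, while A avoids only d > 0. Hence A is first
-- replaced by A ∩ (c - A), which costs density: the iteration starts at δ²/16.
--
-- All arithmetic is exact in ℚ. Most roots of unity being irrational, powers of one rational point
-- of the circle serve as characters; they are orthogonal on average up to an error ε. The existence
-- of a corner is decidable, so every step can be phrased as a refutation of corner-freeness. For δ
-- near 1 no power of 1/δ is large, and that range is treated separately.

module Development where

  open import Data.Nat as ℕ using (ℕ; zero; suc; z≤n; s≤s)
  import Data.Nat.Properties as ℕP
  open import Data.Nat.Tactic.RingSolver using () renaming (solve-∀ to ℕ-solve-∀)
  open import Data.Integer as ℤ using (+_; -[1+_])
  import Data.Integer.Properties as ℤP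
  open import Data.Integer.Tactic.RingSolver using () renaming (solve-∀ to ℤ-solve-∀)
  import Data.Nat.Coprimality as Coprimality
  open import Data.Rational as ℚ using (ℚ; 0ℚ; 1ℚ; mkℚ; *≤*; _+_; _*_; _-_; -_; _≤_; _<_; _≟_)
  import Data.Rational.Properties as ℚP
  import Data.Rational.Unnormalised as ℚᵘ
  import Data.Rational.Unnormalised.Properties as ℚᵘP
  open import Data.Bool as Bool using (Bool; true; false)
  open import Data.Fin as Fin using (Fin)
  import Data.Fin.Properties as FinP
  open import Data.Maybe using (Maybe; just; nothing)
  open import Data.List using ([]; _∷_)
  open import Data.Product using (∃; Σ-syntax; _×_; _,_; proj₁; proj₂)
  open import Data.Sum using (_⊎_; inj₁; inj₂)
  open import Data.Empty using (⊥; ⊥-elim)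
  open import Function using (_∘_)
  open import Relation.Nullary using (Dec; yes; no)
  open import Relation.Nullary.Decidable using (_×-dec_; toWitness)
  open import Relation.Binary.Definitions using (tri<; tri≈; tri>)
  open import Relation.Binary.PropositionalEquality hiding (J)
  open import Tactic.RingSolver.Core.AlmostCommutativeRing using (AlmostCommutativeRing; fromCommutativeRing)
  open import Tactic.RingSolver using (solve; solve-∀)
  open import Level using (0ℓ)

  -- Linear and quadratic inequalities over ℚ.

  ℚring : AlmostCommutativeRing 0ℓ 0ℓ
  ℚring = fromCommutativeRing ℚP.+-*-commutativeRing zero?
    where
    zero? : ∀ x → Maybe (0ℚ ≡ x)
    zero? x with 0ℚ ≟ x
    ... | yes p = just p
    ... | no  _ = nothing

  ι : ℕ → ℚ
  ι n = mkℚ (+ n) 0 (Coprimality.sym (Coprimality.1-coprimeTo n))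

  ι-suc : ∀ n → ι (suc n) ≡ 1ℚ + ι n
  ι-suc n = ℚP.toℚᵘ-injective (ℚᵘP.≃-trans (ℚᵘ.*≡* (eq (+ n))) (ℚᵘP.≃-sym (ℚP.toℚᵘ-homo-+ 1ℚ (ι n))))
    where
    eq : ∀ m → (+ 1 ℤ.+ m) ℤ.* (+ 1) ≡ (+ 1 ℤ.* + 1 ℤ.+ m ℤ.* + 1) ℤ.* + 1
    eq = ℤ-solve-∀

  2ℚ : ℚ
  2ℚ = ι 2

  -- Linear arithmetic: a ≤ b follows from a combination l ≤ r of the hypotheses
  -- once the ring solver checks b + l ≡ a + r.
  lin : ∀ {a b l r} → l ≤ r → b + l ≡ a + r → a ≤ b
  lin {a} {b} {l} {r} l≤r eq = subst₂ _≤_ (cancel a r) (cancel b r)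
    (ℚP.+-monoˡ-≤ (- r) (ℚP.≤-trans (ℚP.≤-reflexive (sym eq)) (ℚP.+-monoʳ-≤ b l≤r)))
    where
    cancel : ∀ x y → x + y + - y ≡ x
    cancel = solve-∀ ℚring

  lin< : ∀ {a b l r} → l < r → b + l ≡ a + r → a < b
  lin< {a} {b} {l} {r} l<r eq = subst₂ _<_ (cancel a r) (cancel b r)
    (ℚP.+-monoˡ-< (- r) (ℚP.≤-<-trans (ℚP.≤-reflexive (sym eq)) (ℚP.+-monoʳ-< b l<r)))
    where
    cancel : ∀ x y → x + y + - y ≡ x
    cancel = solve-∀ ℚring

  -- Notation for the certificates passed to `lin`: `⊙` multiplies a hypothesis by a nonnegative
  -- factor, `⊕` adds hypotheses.
  infixr 5 _⊕_ _⊕<_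
  infixr 6 _⊙_

  _⊕_ : ∀ {a b c d} → a ≤ b → c ≤ d → a + c ≤ b + d
  _⊕_ = ℚP.+-mono-≤

  _⊕<_ : ∀ {a b c d} → a < b → c ≤ d → a + c < b + d
  _⊕<_ = ℚP.+-mono-<-≤

  _⊙_ : ∀ {a b c} → 0ℚ ≤ c → a ≤ b → c * a ≤ c * b
  _⊙_ {c = c} 0≤c a≤b = ℚP.*-monoˡ-≤-nonNeg c {{ℚ.nonNegative 0≤c}} a≤b

  ≤-*-nonneg : ∀ {a b} → 0ℚ ≤ a → 0ℚ ≤ b → 0ℚ ≤ a * b
  ≤-*-nonneg {a} {b} 0≤a 0≤b = lin (0≤a ⊙ 0≤b) (solve (a ∷ b ∷ []) ℚring)

  ≤-+-nonneg : ∀ {a b} → 0ℚ ≤ a → 0ℚ ≤ b → 0ℚ ≤ a + b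
  ≤-+-nonneg {a} {b} p q = lin (p ⊕ q) (solve (a ∷ b ∷ []) ℚring)

  *-pos : ∀ {a b} → 0ℚ < a → 0ℚ < b → 0ℚ < a * b
  *-pos {a} {b} p q = ℚP.positive⁻¹ (a * b) {{ℚP.pos*pos⇒pos a {{ℚ.positive p}} b {{ℚ.positive q}}}}

  sq≥0 : ∀ a → 0ℚ ≤ a * a
  sq≥0 a with ℚP.≤-total 0ℚ a
  ... | inj₁ p = ≤-*-nonneg p p
  ... | inj₂ p = lin (≤-*-nonneg q q) (solve (a ∷ []) ℚring)
    where
    q : 0ℚ ≤ - a
    q = lin p (solve (a ∷ []) ℚring)

  -- By bd - ac = a(d - c) + d(b - a).
  *-mono-nonneg : ∀ {a b c d} → 0ℚ ≤ a → 0ℚ ≤ d → a ≤ b → c ≤ d → a * c ≤ b * d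
  *-mono-nonneg {a} {b} {c} {d} 0≤a 0≤d a≤b c≤d =
    lin (0≤a ⊙ c≤d ⊕ 0≤d ⊙ a≤b) (solve (a ∷ b ∷ c ∷ d ∷ []) ℚring)

  sq-mono : ∀ {a b} → 0ℚ ≤ a → a ≤ b → a * a ≤ b * b
  sq-mono 0≤a a≤b = *-mono-nonneg 0≤a (ℚP.≤-trans 0≤a a≤b) a≤b a≤b

  *-cancel-≤ : ∀ {a b} c → 0ℚ < c → c * a ≤ c * b → a ≤ b
  *-cancel-≤ c 0<c = ℚP.*-cancelˡ-≤-pos c {{ℚ.positive 0<c}}

  ≤-or-> : ∀ a b → a ≤ b ⊎ b < a
  ≤-or-> a b with a ℚP.≤? b
  ... | yes p = inj₁ p
  ... | no ¬p = inj₂ (ℚP.≰⇒> ¬p)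

  <⇒≱ : ∀ {a b} → a < b → b ≤ a → ⊥
  <⇒≱ a<b b≤a = ℚP.<-irrefl refl (ℚP.<-≤-trans a<b b≤a)

  inverse : ∀ p → 0ℚ < p → Σ[ q ∈ ℚ ] (0ℚ < q × p * q ≡ 1ℚ)
  inverse p 0<p = ℚ.1/_ p {{nz}} , ℚP.positive⁻¹ _ {{ℚP.1/pos⇒pos p {{ℚ.positive 0<p}}}} , ℚP.*-inverseʳ p {{nz}}
    where nz = ℚP.pos⇒nonZero p {{ℚ.positive 0<p}}

  0≤1 : 0ℚ ≤ 1ℚ
  0≤1 = ℚP.nonNegative⁻¹ 1ℚ

  0≤ι : ∀ n → 0ℚ ≤ ι n
  0≤ι n = ℚP.nonNegative⁻¹ (ι n)

  0<ι : ∀ n → 0ℚ < ι (suc n)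
  0<ι n = ℚP.positive⁻¹ (ι (suc n))

  ι-+ : ∀ m n → ι (m ℕ.+ n) ≡ ι m + ι n
  ι-+ zero n = sym (ℚP.+-identityˡ (ι n))
  ι-+ (suc m) n = begin
    ι (suc (m ℕ.+ n))   ≡⟨ ι-suc (m ℕ.+ n) ⟩
    1ℚ + ι (m ℕ.+ n)    ≡⟨ cong (λ t → 1ℚ + t) (ι-+ m n) ⟩
    1ℚ + (ι m + ι n)    ≡⟨ sym (ℚP.+-assoc 1ℚ (ι m) (ι n)) ⟩
    1ℚ + ι m + ι n      ≡⟨ cong (_+ ι n) (sym (ι-suc m)) ⟩
    ι (suc m) + ι n     ∎
    where open ≡-Reasoning

  ι-* : ∀ m n → ι (m ℕ.* n) ≡ ι m * ι n
  ι-* zero n = sym (ℚP.*-zeroˡ (ι n))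
  ι-* (suc m) n = begin
    ι (n ℕ.+ m ℕ.* n)     ≡⟨ ι-+ n (m ℕ.* n) ⟩
    ι n + ι (m ℕ.* n)     ≡⟨ cong (λ t → ι n + t) (ι-* m n) ⟩
    ι n + ι m * ι n       ≡⟨ eq (ι m) (ι n) ⟩
    (1ℚ + ι m) * ι n      ≡⟨ cong (_* ι n) (sym (ι-suc m)) ⟩
    ι (suc m) * ι n       ∎
    where
    open ≡-Reasoning
    eq : ∀ a b → b + a * b ≡ (1ℚ + a) * b
    eq = solve-∀ ℚring

  ι-mono : ∀ {m n} → m ℕ.≤ n → ι m ≤ ι n
  ι-mono {m} {n} m≤n = subst (λ t → ι m ≤ ι t) (ℕP.m+[n∸m]≡n m≤n)
    (subst (ι m ≤_) (sym (ι-+ m (n ℕ.∸ m)))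
      (lin (0≤ι (n ℕ.∸ m)) (eq (ι m) (ι (n ℕ.∸ m)))))
    where
    eq : ∀ a b → a + b + 0ℚ ≡ a + b
    eq = solve-∀ ℚring

  archimedean : ∀ q → Σ[ n ∈ ℕ ] q ≤ ι n
  archimedean (mkℚ (+ n) d _) = n , *≤* (ℤP.*-monoˡ-≤-nonNeg (+ n) (ℤ.+≤+ (s≤s z≤n)))
  archimedean q@(mkℚ -[1+ n ] d _) = 0 , ℚP.<⇒≤ (ℚP.negative⁻¹ q)

  -- Finite sums and the Cauchy-Schwarz inequality.

  Σ : ℕ → (ℕ → ℚ) → ℚ
  Σ zero    f = 0ℚ
  Σ (suc n) f = f 0 + Σ n (f ∘ suc)

  Σ-cong< : ∀ n {f g} → (∀ i → i ℕ.< n → f i ≡ g i) → Σ n f ≡ Σ n g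
  Σ-cong< zero    h = refl
  Σ-cong< (suc n) h = cong₂ _+_ (h 0 (s≤s z≤n)) (Σ-cong< n (λ i i<n → h (suc i) (s≤s i<n)))

  Σ-cong : ∀ n {f g} → (∀ i → f i ≡ g i) → Σ n f ≡ Σ n g
  Σ-cong n h = Σ-cong< n (λ i _ → h i)

  Σ-mono< : ∀ n {f g} → (∀ i → i ℕ.< n → f i ≤ g i) → Σ n f ≤ Σ n g
  Σ-mono< zero    h = ℚP.≤-refl
  Σ-mono< (suc n) h = h 0 (s≤s z≤n) ⊕ Σ-mono< n (λ i i<n → h (suc i) (s≤s i<n))

  Σ-mono : ∀ n {f g} → (∀ i → f i ≤ g i) → Σ n f ≤ Σ n g
  Σ-mono n h = Σ-mono< n (λ i _ → h i)

  Σ-+ : ∀ n f g → Σ n (λ i → f i + g i) ≡ Σ n f + Σ n g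
  Σ-+ zero    f g = refl
  Σ-+ (suc n) f g = trans (cong (λ t → f 0 + g 0 + t) (Σ-+ n (f ∘ suc) (g ∘ suc)))
    (eq (f 0) (g 0) (Σ n (f ∘ suc)) (Σ n (g ∘ suc)))
    where
    eq : ∀ a b c d → a + b + (c + d) ≡ a + c + (b + d)
    eq = solve-∀ ℚring

  Σ-* : ∀ n c f → Σ n (λ i → c * f i) ≡ c * Σ n f
  Σ-* zero    c f = sym (ℚP.*-zeroʳ c)
  Σ-* (suc n) c f = trans (cong (λ t → c * f 0 + t) (Σ-* n c (f ∘ suc)))
    (sym (ℚP.*-distribˡ-+ c (f 0) (Σ n (f ∘ suc))))

  Σ-*ʳ : ∀ n c f → Σ n (λ i → f i * c) ≡ Σ n f * c
  Σ-*ʳ n c f = trans (Σ-cong n (λ i → ℚP.*-comm (f i) c)) (trans (Σ-* n c f) (ℚP.*-comm c _))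

  Σ-- : ∀ n f g → Σ n (λ i → f i - g i) ≡ Σ n f - Σ n g
  Σ-- zero    f g = refl
  Σ-- (suc n) f g = trans (cong (λ t → f 0 - g 0 + t) (Σ-- n (f ∘ suc) (g ∘ suc)))
    (eq (f 0) (g 0) (Σ n (f ∘ suc)) (Σ n (g ∘ suc)))
    where
    eq : ∀ a b c d → a - b + (c - d) ≡ a + c - (b + d)
    eq = solve-∀ ℚring

  Σ-const : ∀ n c → Σ n (λ _ → c) ≡ ι n * c
  Σ-const zero    c = sym (ℚP.*-zeroˡ c)
  Σ-const (suc n) c = begin
    c + Σ n (λ _ → c)   ≡⟨ cong (λ t → c + t) (Σ-const n c) ⟩
    c + ι n * c         ≡⟨ eq (ι n) c ⟩
    (1ℚ + ι n) * c      ≡⟨ cong (_* c) (sym (ι-suc n)) ⟩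
    ι (suc n) * c       ∎
    where
    open ≡-Reasoning
    eq : ∀ a b → b + a * b ≡ (1ℚ + a) * b
    eq = solve-∀ ℚring

  Σ-0 : ∀ n → Σ n (λ _ → 0ℚ) ≡ 0ℚ
  Σ-0 n = trans (Σ-const n 0ℚ) (ℚP.*-zeroʳ (ι n))

  Σ-nonneg< : ∀ n {f} → (∀ i → i ℕ.< n → 0ℚ ≤ f i) → 0ℚ ≤ Σ n f
  Σ-nonneg< n {f} h = subst (_≤ Σ n f) (Σ-0 n) (Σ-mono< n h)

  Σ-nonneg : ∀ n {f} → (∀ i → 0ℚ ≤ f i) → 0ℚ ≤ Σ n f
  Σ-nonneg n h = Σ-nonneg< n (λ i _ → h i)

  Σ-≤-const : ∀ n {f c} → (∀ i → i ℕ.< n → f i ≤ c) → Σ n f ≤ ι n * c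
  Σ-≤-const n {f} {c} h = subst (Σ n f ≤_) (Σ-const n c) (Σ-mono< n h)

  Σ-swap : ∀ m n (f : ℕ → ℕ → ℚ) → Σ m (λ i → Σ n (f i)) ≡ Σ n (λ j → Σ m (λ i → f i j))
  Σ-swap zero    n f = sym (Σ-0 n)
  Σ-swap (suc m) n f = trans (cong (λ t → Σ n (f 0) + t) (Σ-swap m n (f ∘ suc)))
    (sym (Σ-+ n (f 0) (λ j → Σ m (λ i → f (suc i) j))))

  Σ-product : ∀ m n f g → Σ m (λ i → Σ n (λ j → f i * g j)) ≡ Σ m f * Σ n g
  Σ-product m n f g = trans (Σ-cong m (λ i → Σ-* n (f i) g)) (Σ-*ʳ m (Σ n g) f)

  -- Finite sums over arbitrary (product) index sets, seen as positive linear
  -- functionals, so that Cauchy–Schwarz is proved once.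
  record Functional (X : Set) : Set where
    field
      ∫        : (X → ℚ) → ℚ
      ∫-cong   : ∀ {f g} → (∀ x → f x ≡ g x) → ∫ f ≡ ∫ g
      ∫-+      : ∀ f g → ∫ (λ x → f x + g x) ≡ ∫ f + ∫ g
      ∫-*      : ∀ c f → ∫ (λ x → c * f x) ≡ c * ∫ f
      ∫-nonneg : ∀ {f} → (∀ x → 0ℚ ≤ f x) → 0ℚ ≤ ∫ f

  range : ℕ → Functional ℕ
  range n = record
    { ∫ = Σ n ; ∫-cong = Σ-cong n ; ∫-+ = Σ-+ n ; ∫-* = Σ-* n ; ∫-nonneg = Σ-nonneg n }

  infixr 4 _⊗_
  _⊗_ : ∀ {X Y} → Functional X → Functional Y → Functional (X × Y)
  I ⊗ J = record
    { ∫ = λ f → I.∫ (λ x → J.∫ (λ y → f (x , y)))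
    ; ∫-cong = λ h → I.∫-cong (λ x → J.∫-cong (λ y → h (x , y)))
    ; ∫-+ = λ f g → trans (I.∫-cong (λ x → J.∫-+ _ _)) (I.∫-+ _ _)
    ; ∫-* = λ c f → trans (I.∫-cong (λ x → J.∫-* c _)) (I.∫-* c _)
    ; ∫-nonneg = λ h → I.∫-nonneg (λ x → J.∫-nonneg (λ y → h (x , y)))
    }
    where
    module I = Functional I
    module J = Functional J

  module _ {X : Set} (I : Functional X) where
    open Functional I

    private
      ∫-*ʳ : ∀ c (f : X → ℚ) → ∫ (λ x → c * f x) ≡ ∫ f * c
      ∫-*ʳ c f = trans (∫-* c f) (ℚP.*-comm c (∫ f))

      ∫-combination : ∀ p q r (f g h : X → ℚ) →
        ∫ (λ x → p * f x + (q * g x + r * h x)) ≡ ∫ f * p + (∫ g * q + ∫ h * r)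
      ∫-combination p q r f g h =
        trans (∫-+ (λ x → p * f x) (λ x → q * g x + r * h x)) (cong₂ _+_ (∫-*ʳ p f)
          (trans (∫-+ (λ x → q * g x) (λ x → r * h x)) (cong₂ _+_ (∫-*ʳ q g) (∫-*ʳ r h))))

      expand : ∀ a b c d → (a * d - c * b) * (a * d - c * b)
             ≡ (a * a) * (d * d) + ((b * b) * (c * c) + (- 2ℚ * (a * b)) * (c * d))
      expand = solve-∀ ℚring

      regroup : ∀ A B P u v w → B * u + (A * v + P * (- 2ℚ * w)) ≡ B * u + (A * v + (- 2ℚ * P) * w)
      regroup = solve-∀ ℚring

      collect : ∀ A B P → A * B + (B * A + P * (- 2ℚ * P)) ≡ 2ℚ * (A * B - P * P)
      collect = solve-∀ ℚring

      -- Lagrange's identity. Its left side is an integral of squares, so Cauchy-Schwarz follows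
      -- from positivity alone, without square roots.
      lagrange : ∀ (a b : X → ℚ) → ∫ (λ x → ∫ (λ y → (a x * b y - a y * b x) * (a x * b y - a y * b x)))
               ≡ 2ℚ * (∫ (λ x → a x * a x) * ∫ (λ x → b x * b x)
                       - ∫ (λ x → a x * b x) * ∫ (λ x → a x * b x))
      lagrange a b = trans (∫-cong inner) (trans (∫-combination B A (- 2ℚ * P) a² b² ab) (collect A B P))
        where
        a² b² ab : X → ℚ
        a² x = a x * a x
        b² x = b x * b x
        ab x = a x * b x
        A = ∫ a²
        B = ∫ b²
        P = ∫ ab
        inner : ∀ x → ∫ (λ y → (a x * b y - a y * b x) * (a x * b y - a y * b x))
                    ≡ B * a² x + (A * b² x + (- 2ℚ * P) * ab x)
        inner x = trans (∫-cong (λ y → expand (a x) (b x) (a y) (b y)))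
          (trans (∫-combination (a² x) (b² x) (- 2ℚ * ab x) b² a² ab) (regroup A B P (a² x) (b² x) (ab x)))

    cauchy-schwarz : ∀ (a b : X → ℚ) → ∫ (λ x → a x * b x) * ∫ (λ x → a x * b x)
                           ≤ ∫ (λ x → a x * a x) * ∫ (λ x → b x * b x)
    cauchy-schwarz a b = *-cancel-≤ 2ℚ (0<ι 1)
      (lin (subst (0ℚ ≤_) (lagrange a b) (∫-nonneg (λ x → ∫-nonneg (λ y → sq≥0 (a x * b y - a y * b x)))))
           (eq (∫ (λ x → a x * a x) * ∫ (λ x → b x * b x)) (∫ (λ x → a x * b x) * ∫ (λ x → a x * b x))))
      where
      eq : ∀ u v → 2ℚ * u + 0ℚ ≡ 2ℚ * v + 2ℚ * (u - v)
      eq = solve-∀ ℚring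

    ∫-mono : ∀ {f g : X → ℚ} → (∀ x → f x ≤ g x) → ∫ f ≤ ∫ g
    ∫-mono {f} {g} f≤g = ℚP.≤-trans
      (lin (∫-nonneg gap) (eq (∫ f) (∫ (λ x → g x - f x))))
      (ℚP.≤-reflexive (sym (trans (∫-cong (λ x → split (f x) (g x))) (∫-+ f (λ x → g x - f x)))))
      where
      eq : ∀ a b → a + b + 0ℚ ≡ a + b
      eq = solve-∀ ℚring
      split : ∀ a b → b ≡ a + (b - a)
      split = solve-∀ ℚring
      gap : ∀ x → 0ℚ ≤ g x - f x
      gap x = lin (f≤g x) (eq₀ (g x) (f x))
        where
        eq₀ : ∀ a b → a - b + b ≡ 0ℚ + a
        eq₀ = solve-∀ ℚring

    -- As `w` is idempotent, w q = w (w q). Cauchy-Schwarz leaves `∫ w`, which still sees how sparse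
    -- the set is, and a weight `w` on q², which is then enlarged to the simpler `u`.
    cauchy-schwarz-indicator : ∀ (w u q : X → ℚ) → (∀ x → w x * w x ≡ w x) → (∀ x → w x ≤ u x) →
      ∫ (λ x → w x * q x) * ∫ (λ x → w x * q x) ≤ ∫ w * ∫ (λ x → u x * (q x * q x))
    cauchy-schwarz-indicator w u q idem w≤u =
      ℚP.≤-trans (ℚP.≤-reflexive (cong₂ _*_ (∫-cong pt) (∫-cong pt)))
     (ℚP.≤-trans (cauchy-schwarz w (λ x → w x * q x))
     (ℚP.≤-trans (ℚP.≤-reflexive (cong₂ _*_ (∫-cong idem) (∫-cong pt₂)))
       (0≤W ⊙ ∫-mono mono)))
      where
      pt : ∀ x → w x * q x ≡ w x * (w x * q x)
      pt x = trans (cong (_* q x) (sym (idem x))) (ℚP.*-assoc (w x) (w x) (q x))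
      rearr : ∀ a b → a * b * (a * b) ≡ (a * a) * (b * b)
      rearr = solve-∀ ℚring
      pt₂ : ∀ x → w x * q x * (w x * q x) ≡ w x * (q x * q x)
      pt₂ x = trans (rearr (w x) (q x)) (cong (_* (q x * q x)) (idem x))
      0≤W : 0ℚ ≤ ∫ w
      0≤W = ∫-nonneg (λ x → subst (0ℚ ≤_) (idem x) (sq≥0 (w x)))
      mono : ∀ x → w x * (q x * q x) ≤ u x * (q x * q x)
      mono x = subst₂ _≤_ (ℚP.*-comm _ (w x)) (ℚP.*-comm _ (u x)) (sq≥0 (q x) ⊙ w≤u x)

  -- Truncated translates and indicator functions.

  cut : ℕ → (ℕ → ℚ) → ℕ → ℚ
  cut zero    φ z       = 0ℚ
  cut (suc n) φ zero    = φ zero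
  cut (suc n) φ (suc z) = cut n (φ ∘ suc) z

  -- shift n s φ z is φ (z - s) for s ≤ z < s + n, and 0 elsewhere.
  shift : ℕ → ℕ → (ℕ → ℚ) → ℕ → ℚ
  shift n zero    φ z       = cut n φ z
  shift n (suc s) φ zero    = 0ℚ
  shift n (suc s) φ (suc z) = shift n s φ z

  -- Whether `z` is outside depends on `n` and `s` only; the universal `ψ` lets one case split serve
  -- all functions translated by the same `s`.
  data ShiftView (n s : ℕ) (φ : ℕ → ℚ) (z : ℕ) : Set where
    inside  : ∀ y → y ℕ.< n → z ≡ s ℕ.+ y → shift n s φ z ≡ φ y → ShiftView n s φ z
    outside : (∀ ψ → shift n s ψ z ≡ 0ℚ) → ShiftView n s φ z

  shift-view : ∀ n s φ z → ShiftView n s φ z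
  shift-view zero    zero    φ z       = outside (λ _ → refl)
  shift-view (suc n) zero    φ zero    = inside 0 (s≤s z≤n) refl refl
  shift-view (suc n) zero    φ (suc z) with shift-view n zero (φ ∘ suc) z
  ... | inside y y<n eq val = inside (suc y) (s≤s y<n) (cong suc eq) val
  ... | outside h           = outside (λ ψ → h (ψ ∘ suc))
  shift-view n (suc s) φ zero    = outside (λ _ → refl)
  shift-view n (suc s) φ (suc z) with shift-view n s φ z
  ... | inside y y<n eq val = inside y y<n (cong suc eq) val
  ... | outside h           = outside h

  shift-inside : ∀ n s φ y → y ℕ.< n → shift n s φ (s ℕ.+ y) ≡ φ y
  shift-inside (suc n) zero    φ zero    _         = refl
  shift-inside (suc n) zero    φ (suc y) (s≤s y<n) = shift-inside n zero (φ ∘ suc) y y<n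
  shift-inside n       (suc s) φ y       y<n       = shift-inside n s φ y y<n

  Σ-shift : ∀ m n s (φ ψ : ℕ → ℚ) → s ℕ.+ n ℕ.≤ m →
    Σ m (λ z → shift n s φ z * ψ z) ≡ Σ n (λ y → φ y * ψ (s ℕ.+ y))
  Σ-shift m       zero    zero    φ ψ _         = trans (Σ-cong m (λ z → ℚP.*-zeroˡ (ψ z))) (Σ-0 m)
  Σ-shift (suc m) (suc n) zero    φ ψ (s≤s n≤m) = cong (λ t → φ 0 * ψ 0 + t) (Σ-shift m n zero (φ ∘ suc) (ψ ∘ suc) n≤m)
  Σ-shift (suc m) n       (suc s) φ ψ (s≤s s+n≤m) =
    trans (cong₂ _+_ (ℚP.*-zeroˡ (ψ 0)) (Σ-shift m n s φ (ψ ∘ suc) s+n≤m)) (ℚP.+-identityˡ (Σ n (λ y → φ y * ψ (suc s ℕ.+ y))))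

  Σ-shift₁ : ∀ m n s (φ : ℕ → ℚ) → s ℕ.+ n ℕ.≤ m → Σ m (shift n s φ) ≡ Σ n φ
  Σ-shift₁ m n s φ s+n≤m = trans (Σ-cong m (λ z → sym (ℚP.*-identityʳ (shift n s φ z))))
    (trans (Σ-shift m n s φ (λ _ → 1ℚ) s+n≤m) (Σ-cong n (λ y → ℚP.*-identityʳ (φ y))))

  kronecker : ℕ → ℕ → ℚ
  kronecker zero    zero    = 1ℚ
  kronecker zero    (suc _) = 0ℚ
  kronecker (suc _) zero    = 0ℚ
  kronecker (suc m) (suc n) = kronecker m n

  kronecker-refl : ∀ n → kronecker n n ≡ 1ℚ
  kronecker-refl zero    = refl
  kronecker-refl (suc n) = kronecker-refl n

  kronecker-≢ : ∀ m n → m ≢ n → kronecker m n ≡ 0ℚ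
  kronecker-≢ zero    zero    m≢n = ⊥-elim (m≢n refl)
  kronecker-≢ zero    (suc n) m≢n = refl
  kronecker-≢ (suc m) zero    m≢n = refl
  kronecker-≢ (suc m) (suc n) m≢n = kronecker-≢ m n (m≢n ∘ cong suc)

  0≤kronecker : ∀ m n → 0ℚ ≤ kronecker m n
  0≤kronecker zero    zero    = 0≤1
  0≤kronecker zero    (suc n) = ℚP.≤-refl
  0≤kronecker (suc m) zero    = ℚP.≤-refl
  0≤kronecker (suc m) (suc n) = 0≤kronecker m n

  Σ-kronecker : ∀ n y (ψ : ℕ → ℚ) → y ℕ.< n → Σ n (λ z → kronecker y z * ψ z) ≡ ψ y
  Σ-kronecker (suc n) zero    ψ _ = trans
    (cong₂ _+_ (ℚP.*-identityˡ (ψ 0)) (trans (Σ-cong n (λ z → ℚP.*-zeroˡ (ψ (suc z)))) (Σ-0 n)))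
    (ℚP.+-identityʳ (ψ 0))
  Σ-kronecker (suc n) (suc y) ψ (s≤s y<n) = trans
    (cong₂ _+_ (ℚP.*-zeroˡ (ψ 0)) (Σ-kronecker n y (ψ ∘ suc) y<n)) (ℚP.+-identityˡ (ψ (suc y)))

  -- A translate as a convolution with a delta. In this form it can be reflected along
  -- antidiagonals, and the delta can be replaced by an average of characters.
  shift-as-sum : ∀ n s (φ : ℕ → ℚ) z → shift n s φ z ≡ Σ n (λ y → kronecker (s ℕ.+ y) z * φ y)
  shift-as-sum zero    zero    φ z       = refl
  shift-as-sum (suc n) zero    φ zero    = sym (trans
    (cong₂ _+_ (ℚP.*-identityˡ (φ 0)) (trans (Σ-cong n (λ y → ℚP.*-zeroˡ (φ (suc y)))) (Σ-0 n)))
    (ℚP.+-identityʳ (φ 0)))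
  shift-as-sum (suc n) zero    φ (suc z) = trans (shift-as-sum n zero (φ ∘ suc) z)
    (sym (trans (cong (_+ Σ n (λ y → kronecker y z * φ (suc y))) (ℚP.*-zeroˡ (φ 0)))
                (ℚP.+-identityˡ (Σ n (λ y → kronecker y z * φ (suc y))))))
  shift-as-sum n       (suc s) φ zero    = sym (trans (Σ-cong n (λ y → ℚP.*-zeroˡ (φ y))) (Σ-0 n))
  shift-as-sum n       (suc s) φ (suc z) = shift-as-sum n s φ z

  -- Both sides are the sum of a over the antidiagonal x + y = z.
  antidiagonal : ∀ n (a : ℕ → ℕ → ℚ) z →
    Σ n (λ x → shift n x (a x) z) ≡ Σ n (λ y → shift n y (λ x → a x y) z)
  antidiagonal n a z = trans (Σ-cong n (λ x → shift-as-sum n x (a x) z))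
    (trans (Σ-swap n n (λ x y → kronecker (x ℕ.+ y) z * a x y)) (Σ-cong n (λ y → trans
      (Σ-cong n (λ x → cong (λ t → kronecker t z * a x y) (ℕP.+-comm x y)))
      (sym (shift-as-sum n y (λ x → a x y) z)))))

  -- Sets are represented by their 0/1-valued, i.e. idempotent, indicator functions.
  Idempotent : (ℕ → ℚ) → Set
  Idempotent φ = ∀ x → φ x * φ x ≡ φ x

  0≤idem : ∀ {a} → a * a ≡ a → 0ℚ ≤ a
  0≤idem {a} h = subst (0ℚ ≤_) h (sq≥0 a)

  idem-* : ∀ {a b} → a * a ≡ a → b * b ≡ b → (a * b) * (a * b) ≡ a * b
  idem-* {a} {b} p q = trans (eq a b) (cong₂ _*_ p q)
    where
    eq : ∀ a b → (a * b) * (a * b) ≡ (a * a) * (b * b)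
    eq = solve-∀ ℚring

  idem-complement : ∀ {a} → a * a ≡ a → (1ℚ - a) * (1ℚ - a) ≡ 1ℚ - a
  idem-complement {a} p = trans (eq a) (cong (λ t → 1ℚ - (1ℚ + 1ℚ) * a + t) p ∙ eq′ a)
    where
    _∙_ = trans
    eq : ∀ a → (1ℚ - a) * (1ℚ - a) ≡ 1ℚ - (1ℚ + 1ℚ) * a + a * a
    eq = solve-∀ ℚring
    eq′ : ∀ a → 1ℚ - (1ℚ + 1ℚ) * a + a ≡ 1ℚ - a
    eq′ = solve-∀ ℚring

  idem≤1 : ∀ {a} → a * a ≡ a → a ≤ 1ℚ
  idem≤1 {a} h = lin (subst (0ℚ ≤_) (idem-complement h) (sq≥0 (1ℚ - a))) (eq a)
    where
    eq : ∀ a → 1ℚ + 0ℚ ≡ a + (1ℚ - a)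
    eq = solve-∀ ℚring

  idem-shift : ∀ n s {φ} → Idempotent φ → Idempotent (shift n s φ)
  idem-shift n s {φ} h z with shift-view n s φ z
  ... | inside y _ _ eq = trans (cong₂ _*_ eq eq) (trans (h y) (sym eq))
  ... | outside eq      = trans (cong₂ _*_ (eq φ) (eq φ)) (sym (eq φ))

  -- Triangle sums and their control by a fourfold box form.

  Σ-rotate : ∀ l m n (h : ℕ → ℕ → ℕ → ℚ) →
    Σ l (λ a → Σ m (λ b → Σ n (λ c → h a b c))) ≡ Σ n (λ c → Σ l (λ a → Σ m (λ b → h a b c)))
  Σ-rotate l m n h = trans (Σ-cong l (λ a → Σ-swap m n (h a))) (Σ-swap l n (λ a c → Σ m (λ b → h a b c)))

  Σ-swap-pairs : ∀ k l m n (h : ℕ → ℕ → ℕ → ℕ → ℚ) →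
    Σ k (λ a → Σ l (λ b → Σ m (λ c → Σ n (λ d → h a b c d))))
      ≡ Σ m (λ c → Σ n (λ d → Σ k (λ a → Σ l (λ b → h a b c d))))
  Σ-swap-pairs k l m n h = trans (Σ-rotate k l m (λ a b c → Σ n (h a b c)))
    (Σ-cong m (λ c → Σ-rotate k l n (λ a b d → h a b c d)))

  Bounded : ℚ → Set
  Bounded t = - 1ℚ ≤ t × t ≤ 1ℚ

  -- By 2(1 + ab) = (1 + a)(1 + b) + (1 - a)(1 - b) and its companion 2(1 - ab) = (1 + a)(1 - b) +
  -- (1 - a)(1 + b).
  bounded-* : ∀ {a b} → Bounded a → Bounded b → Bounded (a * b)
  bounded-* {a} {b} (la , ua) (lb , ub) =
    *-cancel-≤ 2ℚ (0<ι 1) (lin (≤-*-nonneg a+ b+ ⊕ ≤-*-nonneg a- b-) (solve (a ∷ b ∷ []) ℚring)) ,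
    *-cancel-≤ 2ℚ (0<ι 1) (lin (≤-*-nonneg a+ b- ⊕ ≤-*-nonneg a- b+) (solve (a ∷ b ∷ []) ℚring))
    where
    a+ : 0ℚ ≤ 1ℚ + a
    a+ = lin la (solve (a ∷ []) ℚring)
    a- : 0ℚ ≤ 1ℚ - a
    a- = lin ua (solve (a ∷ []) ℚring)
    b+ : 0ℚ ≤ 1ℚ + b
    b+ = lin lb (solve (b ∷ []) ℚring)
    b- : 0ℚ ≤ 1ℚ - b
    b- = lin ub (solve (b ∷ []) ℚring)

  -- For a triangle sum T = Σ f(x,y) B(y,z) C(x,z), two applications of Cauchy–Schwarz
  -- replace C and then B by majorants U and V that do not depend on the set itself.
  module Triangles (n m : ℕ) (f : ℕ → ℕ → ℚ) (B C U V : ℕ → ℕ → ℚ)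
    (B² : ∀ y → Idempotent (B y)) (C² : ∀ x → Idempotent (C x))
    (B≤V : ∀ y z → B y z ≤ V y z) (C≤U : ∀ x z → C x z ≤ U x z) where

    Q : ℕ → ℕ → ℚ
    Q x z = Σ n (λ y → f x y * B y z)

    T : ℚ
    T = Σ n (λ x → Σ m (λ z → C x z * Q x z))

    a : ℚ
    a = Σ n (λ x → Σ m (λ z → C x z))

    P : ℚ
    P = Σ m (λ z → Σ n (λ y → B y z) * Σ n (λ y → B y z))

    ψ : ℕ → ℕ → ℕ → ℕ → ℚ
    ψ x x′ y y′ = (f x y * f x y′) * (f x′ y * f x′ y′)

    Θ : ℚ
    Θ = Σ n (λ x → Σ n (λ x′ → Σ n (λ y → Σ n (λ y′ → Σ m (λ z →
          ψ x x′ y y′ * (U x z * (U x′ z * (V y z * V y′ z))))))))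

    private
      S : ℚ
      S = Σ n (λ x → Σ m (λ z → U x z * (Q x z * Q x z)))

      R : ℕ → ℕ → ℕ → ℚ
      R y y′ z = Σ n (λ x → U x z * (f x y * f x y′))

      -- First Cauchy-Schwarz, over the pairs (x, z), with `C` as the indicator.
      T²≤aS : T * T ≤ a * S
      T²≤aS = cauchy-schwarz-indicator (range n ⊗ range m)
        (λ (x , z) → C x z) (λ (x , z) → U x z) (λ (x , z) → Q x z)
        (λ (x , z) → C² x z) (λ (x , z) → C≤U x z)

      S-expand : S ≡ Σ n (λ y → Σ n (λ y′ → Σ m (λ z → (B y z * B y′ z) * R y y′ z)))
      S-expand = trans (Σ-cong n (λ x → Σ-cong m (λ z → pt x z)))
        (trans (Σ-rotate n m n (λ x z y → Σ n (λ y′ → h x z y y′)))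
          (Σ-cong n (λ y → trans (Σ-rotate n m n (λ x z y′ → h x z y y′))
            (Σ-cong n (λ y′ → trans (Σ-swap n m (λ x z → h x z y y′))
              (Σ-cong m (λ z → Σ-* n (B y z * B y′ z) (λ x → U x z * (f x y * f x y′)))))))))
        where
        h : ℕ → ℕ → ℕ → ℕ → ℚ
        h x z y y′ = (B y z * B y′ z) * (U x z * (f x y * f x y′))
        rearr : ∀ u p q b c → u * ((p * b) * (q * c)) ≡ (b * c) * (u * (p * q))
        rearr = solve-∀ ℚring
        pt : ∀ x z → U x z * (Q x z * Q x z) ≡ Σ n (λ y → Σ n (λ y′ → h x z y y′))
        pt x z = trans (cong (U x z *_) (sym (Σ-product n n (λ y → f x y * B y z) (λ y → f x y * B y z))))
          (trans (sym (Σ-* n (U x z) (λ y → Σ n (λ y′ → (f x y * B y z) * (f x y′ * B y′ z)))))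
            (Σ-cong n (λ y → trans (sym (Σ-* n (U x z) (λ y′ → (f x y * B y z) * (f x y′ * B y′ z))))
              (Σ-cong n (λ y′ → rearr (U x z) (f x y) (f x y′) (B y z) (B y′ z))))))

      P-expand : Σ n (λ y → Σ n (λ y′ → Σ m (λ z → B y z * B y′ z))) ≡ P
      P-expand = trans (Σ-rotate n n m (λ y y′ z → B y z * B y′ z))
        (Σ-cong m (λ z → Σ-product n n (λ y → B y z) (λ y → B y z)))

      Θ-expand : Σ n (λ y → Σ n (λ y′ → Σ m (λ z → (V y z * V y′ z) * (R y y′ z * R y y′ z)))) ≡ Θ
      Θ-expand = trans
        (Σ-cong n (λ y → Σ-cong n (λ y′ → trans (Σ-cong m (λ z → pt y y′ z)) (sym (Σ-rotate n n m (λ x x′ z → h x x′ y y′ z))))))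
        (Σ-swap-pairs n n n n (λ y y′ x x′ → Σ m (λ z → h x x′ y y′ z)))
        where
        h : ℕ → ℕ → ℕ → ℕ → ℕ → ℚ
        h x x′ y y′ z = ψ x x′ y y′ * (U x z * (U x′ z * (V y z * V y′ z)))
        rearr : ∀ v w u p u′ p′ → (v * w) * ((u * p) * (u′ * p′)) ≡ (p * p′) * (u * (u′ * (v * w)))
        rearr = solve-∀ ℚring
        pt : ∀ y y′ z → (V y z * V y′ z) * (R y y′ z * R y y′ z) ≡ Σ n (λ x → Σ n (λ x′ → h x x′ y y′ z))
        pt y y′ z = trans (cong (V y z * V y′ z *_) (sym (Σ-product n n r r)))
          (trans (sym (Σ-* n (V y z * V y′ z) (λ x → Σ n (λ x′ → r x * r x′))))
            (Σ-cong n (λ x → trans (sym (Σ-* n (V y z * V y′ z) (λ x′ → r x * r x′)))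
              (Σ-cong n (λ x′ → rearr (V y z) (V y′ z) (U x z) (f x y * f x y′) (U x′ z) (f x′ y * f x′ y′))))))
          where
          r : ℕ → ℚ
          r x = U x z * (f x y * f x y′)

      0≤B : ∀ y z → 0ℚ ≤ B y z
      0≤B y z = 0≤idem (B² y z)

      -- Second Cauchy-Schwarz, over (y, y′, z): after the first square is expanded, the indicator
      -- is B y z · B y′ z.
      S²≤PΘ : S * S ≤ P * Θ
      S²≤PΘ = subst₂ _≤_ (cong₂ _*_ (sym S-expand) (sym S-expand)) (cong₂ _*_ P-expand Θ-expand)
        (cauchy-schwarz-indicator (range n ⊗ range n ⊗ range m)
          (λ (y , y′ , z) → B y z * B y′ z) (λ (y , y′ , z) → V y z * V y′ z) (λ (y , y′ , z) → R y y′ z)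
          (λ (y , y′ , z) → idem-* (B² y z) (B² y′ z))
          (λ (y , y′ , z) → *-mono-nonneg (0≤B y z) (ℚP.≤-trans (0≤B y′ z) (B≤V y′ z)) (B≤V y z) (B≤V y′ z)))

      0≤a : 0ℚ ≤ a
      0≤a = Σ-nonneg n (λ x → Σ-nonneg m (λ z → 0≤idem (C² x z)))

    T⁴≤a²PΘ : (T * T) * (T * T) ≤ (a * a) * (P * Θ)
    T⁴≤a²PΘ = ℚP.≤-trans (sq-mono (sq≥0 T) T²≤aS)
      (ℚP.≤-trans (ℚP.≤-reflexive (rearr a S)) (sq≥0 a ⊙ S²≤PΘ))
      where
      rearr : ∀ a S → (a * S) * (a * S) ≡ (a * a) * (S * S)
      rearr = solve-∀ ℚring

  module FourFold (n m : ℕ) where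

    Kernel : Set
    Kernel = ℕ → ℕ → ℚ

    -- A box-norm form: `ψ` will be the product of `f` over the corners of the rectangle {x, x′} ×
    -- {y, y′}, and each kernel ties one of the four coordinates to `z`.
    Θ : (ℕ → ℕ → ℕ → ℕ → ℚ) → Kernel → Kernel → Kernel → Kernel → ℚ
    Θ ψ a b c d = Σ n (λ x → Σ n (λ x′ → Σ n (λ y → Σ n (λ y′ → Σ m (λ z →
      ψ x x′ y y′ * (a x z * (b x′ z * (c y z * d y′ z))))))))

    -- Uniformity in dual form. A one-sided bound is enough because `φ` may be negated.
    Small : ℚ → Kernel → Set
    Small r a = ∀ (φ k : ℕ → ℚ) → (∀ x → Bounded (φ x)) → (∀ z → Bounded (k z)) →
      Σ n (λ x → Σ m (λ z → φ x * (a x z * k z))) ≤ r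

    BoundedKernel : Kernel → Set
    BoundedKernel a = ∀ x z → Bounded (a x z)

    Bounded₄ : (ℕ → ℕ → ℕ → ℕ → ℚ) → Set
    Bounded₄ ψ = ∀ x x′ y y′ → Bounded (ψ x x′ y y′)

    -- With x′, y, y′ fixed, `ψ` is a bounded function of x and the other three kernels multiply to
    -- a bounded function of z, so `Small` applies to each of the n³ slices.
    Θ-small₁ : ∀ {r} ψ a b c d → Bounded₄ ψ → Small r a → BoundedKernel b → BoundedKernel c → BoundedKernel d →
      Θ ψ a b c d ≤ ι n * (ι n * (ι n * r))
    Θ-small₁ {r} ψ a b c d ψ≤1 sm b≤1 c≤1 d≤1 = ℚP.≤-trans
      (ℚP.≤-reflexive (trans (Σ-swap n n (λ x x′ → Σ n (λ y → Σ n (λ y′ → Σ m (λ z → h x x′ y y′ z)))))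
        (Σ-cong n (λ x′ → sym (Σ-rotate n n n (λ y y′ x → Σ m (λ z → h x x′ y y′ z)))))))
      (Σ-≤-const n (λ x′ _ → Σ-≤-const n (λ y _ → Σ-≤-const n (λ y′ _ →
        sm (λ x → ψ x x′ y y′) (λ z → b x′ z * (c y z * d y′ z))
           (λ x → ψ≤1 x x′ y y′) (λ z → bounded-* (b≤1 x′ z) (bounded-* (c≤1 y z) (d≤1 y′ z)))))))
      where
      h : ℕ → ℕ → ℕ → ℕ → ℕ → ℚ
      h x x′ y y′ z = ψ x x′ y y′ * (a x z * (b x′ z * (c y z * d y′ z)))

    Θ-swap : ∀ ψ a b c d → Θ ψ a b c d ≡ Θ (λ x x′ → ψ x′ x) b a c d
    Θ-swap ψ a b c d = trans
      (Σ-swap n n (λ x x′ → Σ n (λ y → Σ n (λ y′ → Σ m (λ z → ψ x x′ y y′ * (a x z * (b x′ z * (c y z * d y′ z))))))))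
      (Σ-cong n (λ x′ → Σ-cong n (λ x → Σ-cong n (λ y → Σ-cong n (λ y′ → Σ-cong m (λ z →
        cong (ψ x x′ y y′ *_) (rearr (a x z) (b x′ z) (c y z * d y′ z))))))))
      where
      rearr : ∀ p q r → p * (q * r) ≡ q * (p * r)
      rearr = solve-∀ ℚring

    Θ-transpose : ∀ ψ a b c d → Θ ψ a b c d ≡ Θ (λ y y′ x x′ → ψ x x′ y y′) c d a b
    Θ-transpose ψ a b c d = trans
      (Σ-swap-pairs n n n n (λ x x′ y y′ → Σ m (λ z → ψ x x′ y y′ * (a x z * (b x′ z * (c y z * d y′ z))))))
      (Σ-cong n (λ y → Σ-cong n (λ y′ → Σ-cong n (λ x → Σ-cong n (λ x′ → Σ-cong m (λ z →
        cong (ψ x x′ y y′ *_) (rearr (a x z) (b x′ z) (c y z) (d y′ z))))))))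
      where
      rearr : ∀ p q r s → p * (q * (r * s)) ≡ r * (s * (p * q))
      rearr = solve-∀ ℚring

    Θ-small₂ : ∀ {r} ψ a b c d → Bounded₄ ψ → BoundedKernel a → Small r b → BoundedKernel c → BoundedKernel d →
      Θ ψ a b c d ≤ ι n * (ι n * (ι n * r))
    Θ-small₂ ψ a b c d hψ ha hb hc hd = ℚP.≤-trans (ℚP.≤-reflexive (Θ-swap ψ a b c d))
      (Θ-small₁ (λ x x′ → ψ x′ x) b a c d (λ x x′ → hψ x′ x) hb ha hc hd)

    Θ-small₃ : ∀ {r} ψ a b c d → Bounded₄ ψ → BoundedKernel a → BoundedKernel b → Small r c → BoundedKernel d →
      Θ ψ a b c d ≤ ι n * (ι n * (ι n * r))
    Θ-small₃ ψ a b c d hψ ha hb hc hd = ℚP.≤-trans (ℚP.≤-reflexive (Θ-transpose ψ a b c d))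
      (Θ-small₁ (λ y y′ x x′ → ψ x x′ y y′) c d a b (λ y y′ x x′ → hψ x x′ y y′) hc hd ha hb)

    Θ-small₄ : ∀ {r} ψ a b c d → Bounded₄ ψ → BoundedKernel a → BoundedKernel b → BoundedKernel c → Small r d →
      Θ ψ a b c d ≤ ι n * (ι n * (ι n * r))
    Θ-small₄ ψ a b c d hψ ha hb hc hd = ℚP.≤-trans (ℚP.≤-reflexive (Θ-transpose ψ a b c d))
      (Θ-small₂ (λ y y′ x x′ → ψ x x′ y y′) c d a b (λ y y′ x x′ → hψ x x′ y y′) hc hd ha hb)

    _[_]+_ : Kernel → ℚ → Kernel → Kernel
    (u [ α ]+ e) x z = u x z + α * e x z

    Θ-linear₁ : ∀ ψ u α e b c d → Θ ψ (u [ α ]+ e) b c d ≡ Θ ψ u b c d + α * Θ ψ e b c d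
    Θ-linear₁ ψ u α e b c d = trans
      (I.∫-cong (λ (x , x′ , y , y′ , z) → rearr (ψ x x′ y y′) (u x z) α (e x z) (b x′ z * (c y z * d y′ z))))
      (trans (I.∫-+ (g u) (λ i → α * g e i)) (cong (λ t → I.∫ (g u) + t) (I.∫-* α (g e))))
      where
      module I = Functional (range n ⊗ range n ⊗ range n ⊗ range n ⊗ range m)
      g : Kernel → ℕ × ℕ × ℕ × ℕ × ℕ → ℚ
      g a (x , x′ , y , y′ , z) = ψ x x′ y y′ * (a x z * (b x′ z * (c y z * d y′ z)))
      rearr : ∀ p u α e q → p * ((u + α * e) * q) ≡ p * (u * q) + α * (p * (e * q))
      rearr = solve-∀ ℚring

    Θ-linear₂ : ∀ ψ a u α e c d → Θ ψ a (u [ α ]+ e) c d ≡ Θ ψ a u c d + α * Θ ψ a e c d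
    Θ-linear₂ ψ a u α e c d = trans (Θ-swap ψ a (u [ α ]+ e) c d)
      (trans (Θ-linear₁ (λ x x′ → ψ x′ x) u α e a c d)
        (cong₂ (λ s t → s + α * t) (sym (Θ-swap ψ a u c d)) (sym (Θ-swap ψ a e c d))))

    Θ-linear₃ : ∀ ψ a b u α e d → Θ ψ a b (u [ α ]+ e) d ≡ Θ ψ a b u d + α * Θ ψ a b e d
    Θ-linear₃ ψ a b u α e d = trans (Θ-transpose ψ a b (u [ α ]+ e) d)
      (trans (Θ-linear₁ (λ y y′ x x′ → ψ x x′ y y′) u α e d a b)
        (cong₂ (λ s t → s + α * t) (sym (Θ-transpose ψ a b u d)) (sym (Θ-transpose ψ a b e d))))

    Θ-linear₄ : ∀ ψ a b c u α e → Θ ψ a b c (u [ α ]+ e) ≡ Θ ψ a b c u + α * Θ ψ a b c e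
    Θ-linear₄ ψ a b c u α e = trans (Θ-transpose ψ a b c (u [ α ]+ e))
      (trans (Θ-linear₂ (λ y y′ x x′ → ψ x x′ y y′) c u α e a b)
        (cong₂ (λ s t → s + α * t) (sym (Θ-transpose ψ a b c u)) (sym (Θ-transpose ψ a b c e))))

    -- The kernels are replaced by their mean parts one at a time. Each replacement leaves a term
    -- containing one small kernel, and the factors α, β ≤ 1 collected on the way do not enlarge it.
    Θ-telescope : ∀ {r ψ u v e α β} → 0ℚ ≤ α → α ≤ 1ℚ → 0ℚ ≤ β → β ≤ 1ℚ →
      Bounded₄ ψ → Small r u → Small r v → BoundedKernel e →
      BoundedKernel (u [ α ]+ e) → BoundedKernel (v [ β ]+ e) →
      Θ ψ (u [ α ]+ e) (u [ α ]+ e) (v [ β ]+ e) (v [ β ]+ e)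
        ≤ ι 4 * (ι n * (ι n * (ι n * r))) + (α * α) * ((β * β) * Θ ψ e e e e)
    Θ-telescope {r} {ψ} {u} {v} {e} {α} {β} 0≤α α≤1 0≤β β≤1 hψ hu hv he hU hV =
      ℚP.≤-trans (ℚP.≤-reflexive expand) (final α β _ _ _ _ _ _ 0≤α α≤1 0≤β β≤1 0≤r t₁ t₂ t₃ t₄)
      where
      U V : Kernel
      U = u [ α ]+ e
      V = v [ β ]+ e
      expand : Θ ψ U U V V ≡ Θ ψ u U V V + α * (Θ ψ e u V V + α * (Θ ψ e e v V + β * (Θ ψ e e e v + β * Θ ψ e e e e)))
      expand = trans (Θ-linear₁ ψ u α e U V V) (cong (λ t → Θ ψ u U V V + α * t)
        (trans (Θ-linear₂ ψ e u α e V V) (cong (λ t → Θ ψ e u V V + α * t)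
        (trans (Θ-linear₃ ψ e e v β e V) (cong (λ t → Θ ψ e e v V + β * t)
        (Θ-linear₄ ψ e e e v β e))))))
      bound = ι n * (ι n * (ι n * r))
      0≤r : 0ℚ ≤ bound
      0≤r = ≤-*-nonneg (0≤ι n) (≤-*-nonneg (0≤ι n) (≤-*-nonneg (0≤ι n)
        (subst (_≤ r) zeroSum (hu (λ _ → 0ℚ) (λ _ → 0ℚ) (λ _ → b0) (λ _ → b0)))))
        where
        b0 : Bounded 0ℚ
        b0 = ℚP.nonPositive⁻¹ (- 1ℚ) , 0≤1
        zeroSum : Σ n (λ x → Σ m (λ z → 0ℚ * (u x z * 0ℚ))) ≡ 0ℚ
        zeroSum = trans (Σ-cong n (λ x → trans (Σ-cong m (λ z → ℚP.*-zeroˡ (u x z * 0ℚ))) (Σ-0 m))) (Σ-0 n)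
      t₁ : Θ ψ u U V V ≤ bound
      t₁ = Θ-small₁ ψ u U V V hψ hu hU hV hV
      t₂ : Θ ψ e u V V ≤ bound
      t₂ = Θ-small₂ ψ e u V V hψ he hu hV hV
      t₃ : Θ ψ e e v V ≤ bound
      t₃ = Θ-small₃ ψ e e v V hψ he he hv hV
      t₄ : Θ ψ e e e v ≤ bound
      t₄ = Θ-small₄ ψ e e e v hψ he he he hv
      final : ∀ α β s t₁ t₂ t₃ t₄ w → 0ℚ ≤ α → α ≤ 1ℚ → 0ℚ ≤ β → β ≤ 1ℚ → 0ℚ ≤ s →
        t₁ ≤ s → t₂ ≤ s → t₃ ≤ s → t₄ ≤ s →
        t₁ + α * (t₂ + α * (t₃ + β * (t₄ + β * w))) ≤ ι 4 * s + (α * α) * ((β * β) * w)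
      final α β s t₁ t₂ t₃ t₄ w 0≤α α≤1 0≤β β≤1 0≤s h₁ h₂ h₃ h₄ =
        lin (h₁ ⊕ 0≤α ⊙ h₂ ⊕ α²≥0 ⊙ h₃ ⊕ ≤-*-nonneg α²≥0 0≤β ⊙ h₄
             ⊕ 0≤s ⊙ α≤1 ⊕ 0≤s ⊙ α²≤1 ⊕ 0≤s ⊙ α²β≤1)
          (solve (α ∷ β ∷ s ∷ t₁ ∷ t₂ ∷ t₃ ∷ t₄ ∷ w ∷ []) ℚring)
        where
        α²≥0 : 0ℚ ≤ α * α
        α²≥0 = sq≥0 α
        α²≤1 : α * α ≤ 1ℚ * 1ℚ
        α²≤1 = *-mono-nonneg 0≤α 0≤1 α≤1 α≤1
        α²β≤1 : (α * α) * β ≤ (1ℚ * 1ℚ) * 1ℚ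
        α²β≤1 = *-mono-nonneg α²≥0 0≤1 α²≤1 β≤1

  fourth : ℚ → ℚ
  fourth x = (x * x) * (x * x)

  fourth-mono : ∀ {a b} → 0ℚ ≤ a → a ≤ b → fourth a ≤ fourth b
  fourth-mono {a} {b} 0≤a a≤b = sq-mono {a * a} {b * b} (sq≥0 a) (sq-mono 0≤a a≤b)

  -- The clash that forces an increment. The lack of triangles makes T at most -δP/2 and hence `Θ`
  -- large; uniformity of E and F (`ρ`) and the absence of dense rectangles (`η`) make `Θ` small.
  -- The two are compatible only if `ρ` is at least δ⁸s⁴/1024.
  module CountArithmetic
    (n a P T Θ W E δ s ρ η α β : ℚ)
    (0<n : 0ℚ < n) (0<δ : 0ℚ < δ) (0<s : 0ℚ < s) (0≤ρ : 0ℚ ≤ ρ) (0≤P : 0ℚ ≤ P)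
    (few : T ≤ a - δ * P) (cs : a * a ≤ (ι 2 * n) * P)
    (tri : (T * T) * (T * T) ≤ (a * a) * (P * Θ))
    (four : Θ ≤ ι 4 * (n * (n * (n * (ρ * (n * n))))) + (α * α) * ((β * β) * W))
    (box : W ≤ (ι 2 * n) * (ι 8 * (η * E) * E))
    (density : (α * n) * (β * n) ≡ E)
    (δE≤a : δ * E ≤ a) (sn²≤a : s * (n * n) ≤ a) (a≤E : a ≤ E) (big : ι 4 ≤ δ * s * n)
    (η-small : ι 4096 * η ≤ fourth δ * fourth δ) where

    private
      0≤n : 0ℚ ≤ n
      0≤n = ℚP.<⇒≤ 0<n
      0≤δ : 0ℚ ≤ δ
      0≤δ = ℚP.<⇒≤ 0<δ
      0<a : 0ℚ < a
      0<a = ℚP.<-≤-trans (*-pos 0<s (*-pos 0<n 0<n)) sn²≤a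
      0≤a : 0ℚ ≤ a
      0≤a = ℚP.<⇒≤ 0<a
      0≤E : 0ℚ ≤ E
      0≤E = ℚP.≤-trans 0≤a a≤E

      -- P ≥ a²/(2n) and a ≥ sn² give δP ≥ (δsn/2) a ≥ 2a: degenerate triangles account for at most
      -- half of δP.
      2a≤δP : ι 2 * a ≤ δ * P
      2a≤δP = *-cancel-≤ (ι 2 * n) (*-pos (0<ι 1) 0<n)
        (lin (0≤δ ⊙ cs ⊕ (≤-*-nonneg 0≤a 0≤n) ⊙ big ⊕ ≤-*-nonneg 0≤a 0≤δ ⊙ sn²≤a)
             (solve (n ∷ a ∷ P ∷ δ ∷ s ∷ []) ℚring))

      0<P : 0ℚ < P
      0<P with ≤-or-> P 0ℚ
      ... | inj₂ p = p
      ... | inj₁ p = ⊥-elim (<⇒≱ (*-pos (0<ι 1) 0<a) (ℚP.≤-trans 2a≤δP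
                       (lin (0≤δ ⊙ p) (solve (δ ∷ P ∷ []) ℚring))))

      T-large : δ * P ≤ ι 2 * (- T)
      T-large = lin (2a≤δP ⊕ (0≤ι 2) ⊙ few) (solve (δ ∷ P ∷ T ∷ a ∷ []) ℚring)

      δ⁴P³ : fourth δ * (P * P * P) ≤ ι 16 * ((a * a) * Θ)
      δ⁴P³ = *-cancel-≤ P 0<P (lin (fourth-mono (≤-*-nonneg 0≤δ 0≤P) T-large ⊕ 0≤ι 16 ⊙ tri)
        (eq δ P T a Θ))
        where
        eq : ∀ δ P T a Θ → P * (ι 16 * ((a * a) * Θ))
               + (((δ * P) * (δ * P)) * ((δ * P) * (δ * P)) + ι 16 * ((T * T) * (T * T)))
             ≡ P * (((δ * δ) * (δ * δ)) * (P * P * P))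
               + (((ι 2 * (- T)) * (ι 2 * (- T))) * ((ι 2 * (- T)) * (ι 2 * (- T))) + ι 16 * ((a * a) * (P * Θ)))
        eq = solve-∀ ℚring

      a⁶ : (a * a) * fourth a ≤ ι 8 * ((n * n * n) * (P * P * P))
      a⁶ = ℚP.≤-trans (*-mono-nonneg (sq≥0 a) (sq≥0 ((ι 2 * n) * P)) cs (sq-mono (sq≥0 a) cs))
        (ℚP.≤-reflexive (eq n P))
        where
        eq : ∀ n P → (ι 2 * n) * P * (((ι 2 * n) * P) * ((ι 2 * n) * P)) ≡ ι 8 * ((n * n * n) * (P * P * P))
        eq = solve-∀ ℚring

      δ⁴a⁴ : fourth δ * fourth a ≤ ι 128 * ((n * n * n) * Θ)
      δ⁴a⁴ = *-cancel-≤ (a * a) (*-pos 0<a 0<a)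
        (lin (sq≥0 (δ * δ) ⊙ a⁶ ⊕ (≤-*-nonneg (0≤ι 8) (≤-*-nonneg (sq≥0 n) 0≤n)) ⊙ δ⁴P³)
          (eq (fourth δ) a n P Θ))
        where
        eq : ∀ d a n P Θ → (a * a) * (ι 128 * ((n * n * n) * Θ))
               + (d * ((a * a) * ((a * a) * (a * a))) + (ι 8 * (n * n * n)) * (d * (P * P * P)))
             ≡ (a * a) * (d * ((a * a) * (a * a)))
               + (d * (ι 8 * ((n * n * n) * (P * P * P))) + (ι 8 * (n * n * n)) * (ι 16 * ((a * a) * Θ)))
        eq = solve-∀ ℚring

      δ⁸E⁴ : (fourth δ * fourth δ) * fourth E ≤ ι 128 * ((n * n * n) * Θ)
      δ⁸E⁴ = ℚP.≤-trans (ℚP.≤-reflexive (eq δ E))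
        (ℚP.≤-trans (sq≥0 (δ * δ) ⊙ fourth-mono (≤-*-nonneg 0≤δ 0≤E) δE≤a) δ⁴a⁴)
        where
        eq : ∀ δ E → ((δ * δ) * (δ * δ) * ((δ * δ) * (δ * δ))) * ((E * E) * (E * E))
           ≡ ((δ * δ) * (δ * δ)) * (((δ * E) * (δ * E)) * ((δ * E) * (δ * E)))
        eq = solve-∀ ℚring

      n³ : ℚ
      n³ = n * n * n
      0≤n³ : 0ℚ ≤ n³
      0≤n³ = ≤-*-nonneg (sq≥0 n) 0≤n

      n³Θ : n³ * Θ ≤ ι 4 * (ρ * (fourth n * fourth n)) + ι 16 * (η * fourth E)
      n³Θ = subst (λ t → n³ * Θ ≤ ι 4 * (ρ * (fourth n * fourth n)) + ι 16 * (η * ((t * t) * (E * E)))) density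
        (lin (0≤n³ ⊙ four ⊕ ≤-*-nonneg (≤-*-nonneg 0≤n³ (sq≥0 α)) (sq≥0 β) ⊙ box)
          (eq n ρ α β W η E (n³ * Θ)))
        where
        eq : ∀ n ρ α β W η E X →
          ι 4 * (ρ * (((n * n) * (n * n)) * ((n * n) * (n * n))))
            + ι 16 * (η * ((((α * n) * (β * n)) * ((α * n) * (β * n))) * (E * E)))
            + (X + n * n * n * (α * α) * (β * β) * W)
          ≡ X + (n * n * n * (ι 4 * (n * (n * (n * (ρ * (n * n))))) + (α * α) * ((β * β) * W))
            + n * n * n * (α * α) * (β * β) * ((ι 2 * n) * (ι 8 * (η * E) * E)))
        eq = solve-∀ ℚring

      -- Here 4096 = 2 · 128 · 16 matters: the contribution 2048 η E⁴ of the main term is at most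
      -- half the left side and is absorbed.
      δ⁸E⁴≤ : (fourth δ * fourth δ) * fourth E ≤ ι 1024 * (ρ * (fourth n * fourth n))
      δ⁸E⁴≤ = lin (0≤ι 2 ⊙ δ⁸E⁴ ⊕ 0≤ι 256 ⊙ n³Θ ⊕ sq≥0 (E * E) ⊙ η-small)
        (eq (fourth δ * fourth δ) (fourth E) (ρ * (fourth n * fourth n)) (n³ * Θ) η)
        where
        eq : ∀ d e r t η → ι 1024 * r + (ι 2 * (d * e) + (ι 256 * t + e * (ι 4096 * η)))
           ≡ d * e + (ι 2 * (ι 128 * t) + (ι 256 * (ι 4 * r + ι 16 * (η * e)) + e * d))
        eq = solve-∀ ℚring

    conclusion : (fourth δ * fourth δ) * fourth s ≤ ι 1024 * ρ
    conclusion = *-cancel-≤ (fourth n * fourth n) n⁸>0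
      (lin (δ⁸E⁴≤ ⊕ ≤-*-nonneg (sq≥0 (δ * δ)) (sq≥0 (δ * δ)) ⊙ fourth-mono (≤-*-nonneg (ℚP.<⇒≤ 0<s) (sq≥0 n)) (ℚP.≤-trans sn²≤a a≤E))
        (eq n s (fourth δ * fourth δ) ρ (fourth E)))
      where
      n⁸>0 : 0ℚ < fourth n * fourth n
      n⁸>0 = *-pos n⁴>0 n⁴>0
        where
        n⁴>0 = *-pos (*-pos 0<n 0<n) (*-pos 0<n 0<n)
      eq : ∀ n s d ρ e → (n * n * (n * n)) * (n * n * (n * n)) * (ι 1024 * ρ)
             + (d * e + d * (((s * (n * n)) * (s * (n * n))) * ((s * (n * n)) * (s * (n * n)))))
         ≡ (n * n * (n * n)) * (n * n * (n * n)) * (d * ((s * s) * (s * s)))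
             + (ι 1024 * (ρ * ((n * n * (n * n)) * (n * n * (n * n)))) + d * e)
      eq = solve-∀ ℚring

  -- Corner-free sets inside uniform products E × F.

  record State (n : ℕ) (A : ℕ → ℕ → ℚ) (E F : ℕ → ℚ) : Set where
    field
      A-idem   : ∀ x → Idempotent (A x)
      E-idem   : Idempotent E
      F-idem   : Idempotent F
      A⊆E×F    : ∀ x y → A x y * (E x * F y) ≡ A x y
      -- (x, y), (x′, y), (x, y′) is a corner with d = x′ - x of either sign.
      no-corner : ∀ {x y x′ y′} → x ℕ.< n → y ℕ.< n → x′ ℕ.< n → y′ ℕ.< n →
        x ≢ x′ → x′ ℕ.+ y ≡ x ℕ.+ y′ → A x y * (A x′ y * A x y′) ≡ 0ℚ

  shift-mono : ∀ n s {φ ψ : ℕ → ℚ} → (∀ x → φ x ≤ ψ x) → ∀ z → shift n s φ z ≤ shift n s ψ z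
  shift-mono n s {φ} {ψ} h z with shift-view n s φ z
  ... | outside eq      = ℚP.≤-reflexive (trans (eq φ) (sym (eq ψ)))
  ... | inside y y<n refl eq = subst₂ _≤_ (sym eq) (sym (shift-inside n s ψ y y<n)) (h y)

  shift-offset : ∀ n s (φ : ℕ → ℚ) α z →
    shift n s (λ x → φ x - α) z + α * shift n s (λ _ → 1ℚ) z ≡ shift n s φ z
  shift-offset n s φ α z with shift-view n s φ z
  ... | outside eq = trans (cong₂ (λ p q → p + α * q) (eq (λ x → φ x - α)) (eq (λ _ → 1ℚ)))
                       (trans (e α) (sym (eq φ)))
    where
    e : ∀ α → 0ℚ + α * 0ℚ ≡ 0ℚ
    e = solve-∀ ℚring
  ... | inside y y<n refl eq = trans (cong₂ (λ p q → p + α * q) (shift-inside n s _ y y<n) (shift-inside n s _ y y<n))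
                       (trans (e (φ y) α) (sym eq))
    where
    e : ∀ p α → p - α + α * 1ℚ ≡ p
    e = solve-∀ ℚring

  idem⇒bounded : ∀ {a} → a * a ≡ a → Bounded a
  idem⇒bounded h = ℚP.≤-trans (ℚP.nonPositive⁻¹ (- 1ℚ)) (0≤idem h) , idem≤1 h

  module Balanced (n : ℕ) (A : ℕ → ℕ → ℚ) (E F : ℕ → ℚ) (st : State n A E F) (δ : ℚ) where
    open State st

    size : ℚ
    size = Σ n (λ x → Σ n (A x))

    e₁ e₂ : ℚ
    e₁ = Σ n E
    e₂ = Σ n F

    f : ℕ → ℕ → ℚ
    f x y = A x y - δ * (E x * F y)

    A≤E×F : ∀ x y → A x y ≤ E x * F y
    A≤E×F x y = subst₂ _≤_ (A⊆E×F x y) (ℚP.*-identityˡ (E x * F y))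
      (*-mono-nonneg (0≤idem (A-idem x y)) (≤-*-nonneg (0≤idem (E-idem x)) (0≤idem (F-idem y)))
        (idem≤1 (A-idem x y)) ℚP.≤-refl)

    A≤E : ∀ x y → A x y ≤ E x
    A≤E x y = ℚP.≤-trans (A≤E×F x y) (subst (E x * F y ≤_) (ℚP.*-identityʳ (E x))
      (0≤idem (E-idem x) ⊙ idem≤1 (F-idem y)))

    A≤F : ∀ x y → A x y ≤ F y
    A≤F x y = ℚP.≤-trans (A≤E×F x y) (subst₂ _≤_ (ℚP.*-comm (F y) (E x)) (ℚP.*-identityʳ (F y))
      (0≤idem (F-idem y) ⊙ idem≤1 (E-idem x)))

    EA≡A : ∀ x y → E x * A x y ≡ A x y
    EA≡A x y = trans (cong (E x *_) (sym (A⊆E×F x y))) (trans (e (E x) (A x y) (F y))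
      (trans (cong (λ t → A x y * (t * F y)) (E-idem x)) (A⊆E×F x y)))
      where
      e : ∀ p a q → p * (a * (p * q)) ≡ a * (p * p * q)
      e = solve-∀ ℚring

    FA≡A : ∀ x y → F y * A x y ≡ A x y
    FA≡A x y = trans (cong (F y *_) (sym (A⊆E×F x y))) (trans (e (E x) (A x y) (F y))
      (trans (cong (λ t → A x y * (E x * t)) (F-idem y)) (A⊆E×F x y)))
      where
      e : ∀ p a q → q * (a * (p * q)) ≡ a * (p * (q * q))
      e = solve-∀ ℚring

    size≤e₁e₂ : size ≤ e₁ * e₂
    size≤e₁e₂ = subst (size ≤_) (Σ-product n n E F) (Σ-mono n (λ x → Σ-mono n (A≤E×F x)))

    -- `B y z` is `A (z - y) y` and `C x z` is `A x (z - x)`, truncated to the square: the edges yz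
    -- and xz of the triangle with z = x + y + d.
    B C : ℕ → ℕ → ℚ
    B y = shift n y (λ x → A x y)
    C x = shift n x (A x)

    m : ℕ
    m = n ℕ.+ n

    D : ℕ → ℚ
    D z = Σ n (λ y → B y z)

    ΣB : Σ m D ≡ size
    ΣB = trans (Σ-swap m n (λ z y → B y z))
      (trans (Σ-cong< n (λ y y<n → Σ-shift₁ m n y (λ x → A x y) (ℕP.+-monoˡ-≤ n (ℕP.<⇒≤ y<n))))
        (Σ-swap n n (λ y x → A x y)))

    ΣC : Σ n (λ x → Σ m (C x)) ≡ size
    ΣC = Σ-cong< n (λ x x<n → Σ-shift₁ m n x (A x) (ℕP.+-monoˡ-≤ n (ℕP.<⇒≤ x<n)))

    P : ℚ
    P = Σ m (λ z → D z * D z)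

    -- Cauchy-Schwarz over the 2n antidiagonals, which partition `A` into parts of size `D z`.
    size²≤2nP : size * size ≤ (ι 2 * ι n) * P
    size²≤2nP = subst₂ _≤_ (cong₂ _*_ eq eq) (cong (_* P) len)
      (cauchy-schwarz (range m) (λ _ → 1ℚ) D)
      where
      eq : Σ m (λ z → 1ℚ * D z) ≡ size
      eq = trans (Σ-cong m (λ z → ℚP.*-identityˡ (D z))) ΣB
      len : Σ m (λ _ → 1ℚ * 1ℚ) ≡ ι 2 * ι n
      len = trans (Σ-const m (1ℚ * 1ℚ)) (trans (cong (_* (1ℚ * 1ℚ)) (ι-+ n n)) (e (ι n)))
        where
        e : ∀ t → (t + t) * (1ℚ * 1ℚ) ≡ ι 2 * t
        e = solve-∀ ℚring

    EC≡C : ∀ x z → E x * C x z ≡ C x z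
    EC≡C x z with shift-view n x (A x) z
    ... | outside eq      = trans (cong (E x *_) (eq (A x))) (trans (ℚP.*-zeroʳ (E x)) (sym (eq (A x))))
    ... | inside y _ _ eq = trans (cong (E x *_) eq) (trans (EA≡A x y) (sym eq))

    FB≡B : ∀ y z → F y * B y z ≡ B y z
    FB≡B y z with shift-view n y (λ x → A x y) z
    ... | outside eq      = trans (cong (F y *_) (eq (λ x → A x y))) (trans (ℚP.*-zeroʳ (F y)) (sym (eq (λ x → A x y))))
    ... | inside x _ _ eq = trans (cong (F y *_) eq) (trans (FA≡A x y) (sym eq))

    triangles : ℚ
    triangles = Σ n (λ x → Σ m (λ z → C x z * Σ n (λ y → f x y * B y z)))

    -- A triangle of A is a corner, possibly degenerate; only the degenerate ones survive.
    private
      corner-bound : ∀ x y z → x ℕ.< n → y ℕ.< n → C x z * (A x y * B y z) ≤ kronecker (x ℕ.+ y) z * A x y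
      corner-bound x y z x<n y<n with shift-view n x (A x) z | shift-view n y (λ x → A x y) z
      ... | outside eq | _ = subst (_≤ kronecker (x ℕ.+ y) z * A x y)
          (sym (trans (cong (_* (A x y * B y z)) (eq (A x))) (ℚP.*-zeroˡ (A x y * B y z))))
          (≤-*-nonneg (0≤kronecker (x ℕ.+ y) z) (0≤idem (A-idem x y)))
      ... | inside y′ y′<n z≡ eq | outside eq′ = subst (_≤ kronecker (x ℕ.+ y) z * A x y)
          (sym (trans (cong (λ t → C x z * (A x y * t)) (eq′ (λ x → A x y))) (e (C x z) (A x y))))
          (≤-*-nonneg (0≤kronecker (x ℕ.+ y) z) (0≤idem (A-idem x y)))
        where
        e : ∀ p q → p * (q * 0ℚ) ≡ 0ℚ
        e = solve-∀ ℚring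
      ... | inside y′ y′<n z≡ eq | inside x′ x′<n z≡′ eq′ with x ℕ.≟ x′
      ...   | no x≢x′ = subst (_≤ kronecker (x ℕ.+ y) z * A x y)
          (sym (trans (cong₂ (λ p q → p * (A x y * q)) eq eq′) (trans (e (A x y′) (A x y) (A x′ y))
            (no-corner x<n y<n x′<n y′<n x≢x′ (trans (ℕP.+-comm x′ y) (trans (sym z≡′) z≡))))))
          (≤-*-nonneg (0≤kronecker (x ℕ.+ y) z) (0≤idem (A-idem x y)))
        where
        e : ∀ p q r → p * (q * r) ≡ q * (r * p)
        e = solve-∀ ℚring
      ...   | yes refl = subst₂ _≤_ (ℚP.*-comm (A x y * B y z) (C x z))
          (trans (e (A x y)) (sym (cong (_* A x y) (trans (cong (kronecker (x ℕ.+ y)) (trans z≡′ (ℕP.+-comm y x))) (kronecker-refl (x ℕ.+ y))))))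
          (*-mono-nonneg (≤-*-nonneg (0≤idem (A-idem x y)) (0≤idem (idem-shift n y (λ x → A-idem x y) z)))
            0≤1 (subst (A x y * B y z ≤_) (ℚP.*-identityʳ (A x y))
              (0≤idem (A-idem x y) ⊙ idem≤1 (idem-shift n y (λ x → A-idem x y) z)))
            (idem≤1 (idem-shift n x (A-idem x) z)))
        where
        e : ∀ a → a * 1ℚ ≡ 1ℚ * a
        e = solve-∀ ℚring

    -- The `A` part of `f` sees only degenerate triangles, one for each point of `A` at most. In the
    -- part -δ E × F the factors `E x` and `F y` are absorbed by `C` and `B`, and for fixed z the
    -- rest factors as `D z` squared.
    few-triangles : triangles ≤ size - δ * P
    few-triangles = subst (_≤ size - δ * P) (sym split) (lin corners (eq _ size (δ * P)))
      where
      corner-sum : ℚ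
      corner-sum = Σ n (λ x → Σ m (λ z → Σ n (λ y → C x z * (A x y * B y z))))
      eq : ∀ c s d → s - d + c ≡ c - d + s
      eq = solve-∀ ℚring
      corners : corner-sum ≤ size
      corners = ℚP.≤-trans
        (Σ-mono< n (λ x x<n → Σ-mono m (λ z → Σ-mono< n (λ y y<n → corner-bound x y z x<n y<n))))
        (ℚP.≤-reflexive (Σ-cong< n (λ x x<n → trans (Σ-swap m n (λ z y → kronecker (x ℕ.+ y) z * A x y))
          (Σ-cong< n (λ y y<n → Σ-kronecker m (x ℕ.+ y) (λ _ → A x y) (ℕP.+-mono-< x<n y<n))))))
      pt : ∀ x z y → C x z * (f x y * B y z) ≡ C x z * (A x y * B y z) + (- δ) * (C x z * B y z)
      pt x z y = trans (e (C x z) (A x y) δ (E x) (F y) (B y z))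
        (cong₂ (λ p q → C x z * (A x y * B y z) + (- δ) * (p * q)) (EC≡C x z) (FB≡B y z))
        where
        e : ∀ c a δ p q b → c * ((a - δ * (p * q)) * b) ≡ c * (a * b) + (- δ) * ((p * c) * (q * b))
        e = solve-∀ ℚring
      module I = Functional (range n ⊗ range m ⊗ range n)
      P-sum : Σ n (λ x → Σ m (λ z → Σ n (λ y → C x z * B y z))) ≡ P
      P-sum = trans (Σ-swap n m (λ x z → Σ n (λ y → C x z * B y z)))
        (Σ-cong m (λ z → trans (Σ-product n n (λ x → C x z) (λ y → B y z))
          (cong (_* D z) (antidiagonal n A z))))
      split : triangles ≡ corner-sum - δ * P
      split = trans (Σ-cong n (λ x → Σ-cong m (λ z → trans (sym (Σ-* n (C x z) (λ y → f x y * B y z)))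
            (Σ-cong n (λ y → pt x z y)))))
        (trans (I.∫-+ (λ (x , z , y) → C x z * (A x y * B y z)) (λ (x , z , y) → (- δ) * (C x z * B y z)))
          (trans (cong (λ t → corner-sum + t) (trans (I.∫-* (- δ) (λ (x , z , y) → C x z * B y z)) (cong ((- δ) *_) P-sum)))
            (e corner-sum δ P)))
        where
        e : ∀ c d p → c + (- d) * p ≡ c - d * p
        e = solve-∀ ℚring

  *-≤-abs : ∀ {k g G b} → - g ≤ k → k ≤ g → - b ≤ G → G ≤ b → k * G ≤ g * b
  *-≤-abs {k} {g} {G} {b} lk uk lG uG = *-cancel-≤ 2ℚ (0<ι 1)
    (lin (≤-*-nonneg {g - k} {b + G} (lin uk (solve (k ∷ g ∷ []) ℚring)) (lin lG (solve (b ∷ G ∷ []) ℚring))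
         ⊕ ≤-*-nonneg {g + k} {b - G} (lin lk (solve (k ∷ g ∷ []) ℚring)) (lin uG (solve (b ∷ G ∷ []) ℚring)))
      (solve (k ∷ g ∷ G ∷ b ∷ []) ℚring))

  -- The mass of a rectangle is bounded below through its two complementary rectangles,
  -- since the total mass is ≥ 0.
  module Rectangles (n : ℕ) (f : ℕ → ℕ → ℚ) (h : ℚ)
    (total : 0ℚ ≤ Σ n (λ x → Σ n (f x)))
    (upper : ∀ (u v : ℕ → ℚ) → Idempotent u → Idempotent v → Σ n (λ x → Σ n (λ y → f x y * (u x * v y))) ≤ h) where

    mass : (u v : ℕ → ℚ) → ℚ
    mass u v = Σ n (λ x → Σ n (λ y → f x y * (u x * v y)))

    private
      module I = Functional (range n ⊗ range n)

      one : ℕ → ℚ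
      one _ = 1ℚ

      lower : ∀ u v → Idempotent u → Idempotent v → - (ι 2 * h) ≤ mass u v
      lower u v u² v² = lin (upper u v̄ u² (λ y → idem-complement (v² y))
                            ⊕ upper ū one (λ x → idem-complement (u² x)) (λ _ → refl) ⊕ subst (0ℚ ≤_) partition total)
                        (e (mass u v) (mass u v̄) (mass ū one) h)
        where
        ū v̄ : ℕ → ℚ
        ū x = 1ℚ - u x
        v̄ y = 1ℚ - v y
        e : ∀ a b c h → a + (b + (c + 0ℚ)) ≡ - (ι 2 * h) + (h + (h + (a + (b + c))))
        e = solve-∀ ℚring
        pt : ∀ g p q → g ≡ g * (p * q) + (g * (p * (1ℚ - q)) + g * ((1ℚ - p) * 1ℚ))
        pt = solve-∀ ℚring
        partition : Σ n (λ x → Σ n (f x)) ≡ mass u v + (mass u v̄ + mass ū one)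
        partition = trans (I.∫-cong (λ (x , y) → pt (f x y) (u x) (v y)))
          (trans (I.∫-+ (λ (x , y) → f x y * (u x * v y)) (λ (x , y) → f x y * (u x * v̄ y) + f x y * (ū x * 1ℚ)))
            (cong (λ t → mass u v + t) (I.∫-+ (λ (x , y) → f x y * (u x * v̄ y)) (λ (x , y) → f x y * (ū x * 1ℚ)))))

      0≤h : 0ℚ ≤ h
      0≤h = subst (_≤ h) (trans (Σ-cong n (λ x → trans (Σ-cong n (λ y → ℚP.*-zeroʳ (f x y))) (Σ-0 n))) (Σ-0 n))
        (upper (λ _ → 0ℚ) (λ _ → 0ℚ) (λ _ → refl) (λ _ → refl))

    form : (p p′ q q′ : ℕ → ℚ) (c c′ : ℚ) → ℚ
    form p p′ q q′ c c′ = Σ n (λ x → Σ n (λ y → f x y * ((p x - c * p′ x) * (q y - c′ * q′ y))))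

    private
      arith : ∀ {h c c′ F₁ F₂ F₃ F₄} → 0ℚ ≤ h → 0ℚ ≤ c → c ≤ 1ℚ → 0ℚ ≤ c′ → c′ ≤ 1ℚ →
        - (ι 2 * h) ≤ F₁ → F₁ ≤ h → - (ι 2 * h) ≤ F₂ → F₂ ≤ h →
        - (ι 2 * h) ≤ F₃ → F₃ ≤ h → - (ι 2 * h) ≤ F₄ → F₄ ≤ h →
        - (ι 8 * h) ≤ F₁ + ((- c′) * F₂ + ((- c) * F₃ + (c * c′) * F₄)) ×
        F₁ + ((- c′) * F₂ + ((- c) * F₃ + (c * c′) * F₄)) ≤ ι 8 * h
      arith {h} {c} {c′} {F₁} {F₂} {F₃} {F₄} 0≤h 0≤c c≤1 0≤c′ c′≤1 l₁ u₁ l₂ u₂ l₃ u₃ l₄ u₄ =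
        lin (l₁ ⊕ 0≤c′ ⊙ u₂ ⊕ 0≤c ⊙ u₃ ⊕ 0≤cc′ ⊙ l₄ ⊕ 0≤h ⊙ c≤1 ⊕ 0≤h ⊙ c′≤1 ⊕ 0≤ι 2 ⊙ (0≤h ⊙ cc′≤1) ⊕ 0≤ι 2 ⊙ 0≤h)
          (solve (h ∷ c ∷ c′ ∷ F₁ ∷ F₂ ∷ F₃ ∷ F₄ ∷ []) ℚring) ,
        lin (u₁ ⊕ 0≤c′ ⊙ l₂ ⊕ 0≤c ⊙ l₃ ⊕ 0≤cc′ ⊙ u₄ ⊕ 0≤ι 2 ⊙ (0≤h ⊙ c≤1) ⊕ 0≤ι 2 ⊙ (0≤h ⊙ c′≤1) ⊕ 0≤h ⊙ cc′≤1 ⊕ 0≤ι 2 ⊙ 0≤h)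
          (solve (h ∷ c ∷ c′ ∷ F₁ ∷ F₂ ∷ F₃ ∷ F₄ ∷ []) ℚring)
        where
        0≤cc′ : 0ℚ ≤ c * c′
        0≤cc′ = ≤-*-nonneg 0≤c 0≤c′
        cc′≤1 : c * c′ ≤ 1ℚ * 1ℚ
        cc′≤1 = *-mono-nonneg 0≤c 0≤1 c≤1 c′≤1

    -- Expanding gives four rectangle masses, each between -2h and h, with coefficients of modulus
    -- at most 1; hence 4 · 2h.
    form-bound : ∀ p p′ q q′ c c′ → Idempotent p → Idempotent p′ → Idempotent q → Idempotent q′ →
      0ℚ ≤ c → c ≤ 1ℚ → 0ℚ ≤ c′ → c′ ≤ 1ℚ →
      - (ι 8 * h) ≤ form p p′ q q′ c c′ × form p p′ q q′ c c′ ≤ ι 8 * h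
    form-bound p p′ q q′ c c′ p² p′² q² q′² 0≤c c≤1 0≤c′ c′≤1 =
      subst (λ t → - (ι 8 * h) ≤ t × t ≤ ι 8 * h) (sym expand)
        (arith 0≤h 0≤c c≤1 0≤c′ c′≤1 (lower p q p² q²) (upper p q p² q²) (lower p q′ p² q′²) (upper p q′ p² q′²)
          (lower p′ q p′² q²) (upper p′ q p′² q²) (lower p′ q′ p′² q′²) (upper p′ q′ p′² q′²))
      where
      g : (u v : ℕ → ℚ) → ℕ × ℕ → ℚ
      g u v (x , y) = f x y * (u x * v y)
      pt : ∀ f c c′ a b a′ b′ → f * ((a - c * b) * (a′ - c′ * b′))
         ≡ f * (a * a′) + ((- c′) * (f * (a * b′)) + ((- c) * (f * (b * a′)) + (c * c′) * (f * (b * b′))))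
      pt = solve-∀ ℚring
      expand : form p p′ q q′ c c′
        ≡ mass p q + ((- c′) * mass p q′ + ((- c) * mass p′ q + (c * c′) * mass p′ q′))
      expand = trans (I.∫-cong (λ (x , y) → pt (f x y) c c′ (p x) (p′ x) (q y) (q′ y)))
        (trans (I.∫-+ (g p q) (λ i → (- c′) * g p q′ i + ((- c) * g p′ q i + (c * c′) * g p′ q′ i))) (cong (λ t → mass p q + t)
        (trans (I.∫-+ (λ i → (- c′) * g p q′ i) (λ i → (- c) * g p′ q i + (c * c′) * g p′ q′ i)) (cong₂ _+_ (I.∫-* (- c′) (g p q′))
        (trans (I.∫-+ (λ i → (- c) * g p′ q i) (λ i → (c * c′) * g p′ q′ i)) (cong₂ _+_ (I.∫-* (- c) (g p′ q)) (I.∫-* (c * c′) (g p′ q′))))))))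

  -- `α` is the density of `F` and `β` that of `E`: the edge xz is majorised by `F (z - x)` and the
  -- edge yz by `E (z - y)`.
  module Pseudorandom (n : ℕ) (A : ℕ → ℕ → ℚ) (E F : ℕ → ℚ) (st : State n A E F)
    (δ η ρ s α β : ℚ)
    (0<n : 0ℚ < ι n) (0<δ : 0ℚ < δ) (δ≤1 : δ ≤ 1ℚ) (0<s : 0ℚ < s) (0≤ρ : 0ℚ ≤ ρ)
    (αn : α * ι n ≡ Σ n F) (βn : β * ι n ≡ Σ n E)
    (dense : δ * (Σ n E * Σ n F) ≤ Σ n (λ x → Σ n (A x))) (sn²≤ : s * (ι n * ι n) ≤ Σ n (λ x → Σ n (A x)))
    (big : ι 4 ≤ δ * s * ι n) (η-small : ι 4096 * η ≤ fourth δ * fourth δ)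
    (no-increment : ∀ (u v : ℕ → ℚ) → Idempotent u → Idempotent v →
       Σ n (λ x → Σ n (λ y → (A x y - δ * (E x * F y)) * (u x * v y))) ≤ η * (Σ n E * Σ n F))
    (F-uniform : FourFold.Small n (n ℕ.+ n) (ρ * (ι n * ι n)) (λ x → shift n x (λ y → F y - α)))
    (E-uniform : FourFold.Small n (n ℕ.+ n) (ρ * (ι n * ι n)) (λ y → shift n y (λ x → E x - β))) where

    open State st
    open Balanced n A E F st δ
    open FourFold n m

    private
      N : ℚ
      N = ι n
      0≤δ : 0ℚ ≤ δ
      0≤δ = ℚP.<⇒≤ 0<δ

      e gF gE U V : Kernel
      e x = shift n x (λ _ → 1ℚ)
      gF x = shift n x (λ y → F y - α)
      gE y = shift n y (λ x → E x - β)
      U = gF [ α ]+ e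
      V = gE [ β ]+ e

      e-idem : ∀ x → Idempotent (e x)
      e-idem x = idem-shift n x (λ _ → refl)

      U≡ : ∀ x z → U x z ≡ shift n x F z
      U≡ x = shift-offset n x F α
      V≡ : ∀ y z → V y z ≡ shift n y E z
      V≡ y = shift-offset n y E β

      ψ : ℕ → ℕ → ℕ → ℕ → ℚ
      ψ x x′ y y′ = (f x y * f x y′) * (f x′ y * f x′ y′)

      f≤ : ∀ x y → f x y ≤ E x * F y
      f≤ x y = lin (A≤E×F x y ⊕ ≤-*-nonneg 0≤δ 0≤EF) (eq (A x y) δ (E x * F y))
        where
        0≤EF : 0ℚ ≤ E x * F y
        0≤EF = ≤-*-nonneg (0≤idem (E-idem x)) (0≤idem (F-idem y))
        eq : ∀ a d g → g + (a + 0ℚ) ≡ a - d * g + (g + d * g)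
        eq = solve-∀ ℚring

      ≤f : ∀ x y → - (E x * F y) ≤ f x y
      ≤f x y = lin (0≤idem (A-idem x y) ⊕ 0≤EF ⊙ δ≤1) (eq (A x y) δ (E x * F y))
        where
        0≤EF : 0ℚ ≤ E x * F y
        0≤EF = ≤-*-nonneg (0≤idem (E-idem x)) (0≤idem (F-idem y))
        eq : ∀ a d g → a - d * g + (0ℚ + g * d) ≡ - g + (a + g * 1ℚ)
        eq = solve-∀ ℚring

      EF-idem : ∀ x y → (E x * F y) * (E x * F y) ≡ E x * F y
      EF-idem x y = idem-* (E-idem x) (F-idem y)

      f-bounded : ∀ x y → Bounded (f x y)
      f-bounded x y = lin (≤f x y ⊕ idem≤1 (EF-idem x y)) (eq (f x y) (E x * F y)) ,
                      ℚP.≤-trans (f≤ x y) (idem≤1 (EF-idem x y))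
        where
        eq : ∀ f g → f + (- g + g) ≡ - 1ℚ + (f + 1ℚ)
        eq = solve-∀ ℚring

      ψ-bounded : Bounded₄ ψ
      ψ-bounded x x′ y y′ = bounded-* (bounded-* (f-bounded x y) (f-bounded x y′)) (bounded-* (f-bounded x′ y) (f-bounded x′ y′))

      module Tri = Triangles n m f B C U V (λ y → idem-shift n y (λ x → A-idem x y)) (λ x → idem-shift n x (A-idem x))
        (λ y z → subst (B y z ≤_) (sym (V≡ y z)) (shift-mono n y (λ x → A≤E x y) z))
        (λ x z → subst (C x z ≤_) (sym (U≡ x z)) (shift-mono n x (λ y → A≤F x y) z))

      density≤1 : ∀ {θ} (φ : ℕ → ℚ) → Idempotent φ → θ * N ≡ Σ n φ → 0ℚ ≤ θ × θ ≤ 1ℚ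
      density≤1 {θ} φ φ² eq =
        *-cancel-≤ N 0<n (subst₂ _≤_ (sym (ℚP.*-zeroʳ N)) (trans (sym eq) (ℚP.*-comm θ N)) (Σ-nonneg n (λ x → 0≤idem (φ² x)))) ,
        *-cancel-≤ N 0<n (subst (_≤ N * 1ℚ) (trans (sym eq) (ℚP.*-comm θ N)) (Σ-≤-const n (λ x _ → idem≤1 (φ² x))))

      G : ℚ
      G = e₁ * e₂

      total : 0ℚ ≤ Σ n (λ x → Σ n (f x))
      total = subst (0ℚ ≤_) (sym split) (lin dense (eq size (δ * G)))
        where
        eq : ∀ a b → a - b + b ≡ 0ℚ + a
        eq = solve-∀ ℚring
        split : Σ n (λ x → Σ n (f x)) ≡ size - δ * G
        split = trans (Σ-cong n (λ x → Σ-- n (A x) (λ y → δ * (E x * F y))))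
          (trans (Σ-- n (λ x → Σ n (A x)) (λ x → Σ n (λ y → δ * (E x * F y)))) (cong (λ t → size - t)
            (trans (Σ-cong n (λ x → Σ-* n δ (λ y → E x * F y)))
              (trans (Σ-* n δ (λ x → Σ n (λ y → E x * F y))) (cong (δ *_) (Σ-product n n E F))))))

      module R = Rectangles n f (η * G) total no-increment

      W : ℚ
      W = Θ ψ e e e e

      δ-scaled : ∀ {t} → t * t ≡ t → 0ℚ ≤ δ * t × δ * t ≤ 1ℚ
      δ-scaled {t} t² = ≤-*-nonneg 0≤δ (0≤idem t²) , *-mono-nonneg 0≤δ 0≤1 δ≤1 (idem≤1 t²)

      -- With z, x′, y′ fixed, f x′ y′ is a constant, while f x y′ and f x′ y each depend on one
      -- variable and have the form indicator minus constant times indicator. What remains is a mass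
      -- of f x y against such a product, to which the rectangle bounds apply.
      inner : ∀ z x′ y′ → Σ n (λ x → Σ n (λ y → ψ x x′ y y′ * (e x z * (e x′ z * (e y z * e y′ z)))))
            ≤ (E x′ * F y′) * (ι 8 * (η * G))
      inner z x′ y′ = subst (_≤ (E x′ * F y′) * (ι 8 * (η * G))) (sym factor)
        (*-≤-abs k≥ k≤ (proj₁ bnd) (proj₂ bnd))
        where
        k : ℚ
        k = f x′ y′ * (e x′ z * e y′ z)
        p p′ q q′ : ℕ → ℚ
        p x = A x y′ * e x z
        p′ x = E x * e x z
        q y = A x′ y * e y z
        q′ y = F y * e y z
        bnd = R.form-bound p p′ q q′ (δ * F y′) (δ * E x′)
          (λ x → idem-* (A-idem x y′) (e-idem x z)) (λ x → idem-* (E-idem x) (e-idem x z))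
          (λ y → idem-* (A-idem x′ y) (e-idem y z)) (λ y → idem-* (F-idem y) (e-idem y z))
          (proj₁ (δ-scaled (F-idem y′))) (proj₂ (δ-scaled (F-idem y′)))
          (proj₁ (δ-scaled (E-idem x′))) (proj₂ (δ-scaled (E-idem x′)))
        w = e x′ z * e y′ z
        w² = idem-* (e-idem x′ z) (e-idem y′ z)
        0≤EF : 0ℚ ≤ E x′ * F y′
        0≤EF = ≤-*-nonneg (0≤idem (E-idem x′)) (0≤idem (F-idem y′))
        k≤ : k ≤ E x′ * F y′
        k≤ = lin (0≤idem w² ⊙ f≤ x′ y′ ⊕ 0≤EF ⊙ idem≤1 w²) (eq (f x′ y′) w (E x′ * F y′))
          where
          eq : ∀ f w g → g + (w * f + g * w) ≡ f * w + (w * g + g * 1ℚ)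
          eq = solve-∀ ℚring
        k≥ : - (E x′ * F y′) ≤ k
        k≥ = lin (0≤idem w² ⊙ ≤f x′ y′ ⊕ 0≤EF ⊙ idem≤1 w²) (eq (f x′ y′) w (E x′ * F y′))
          where
          eq : ∀ f w g → f * w + (w * (- g) + g * w) ≡ - g + (w * f + g * 1ℚ)
          eq = solve-∀ ℚring
        factor : Σ n (λ x → Σ n (λ y → ψ x x′ y y′ * (e x z * (e x′ z * (e y z * e y′ z)))))
               ≡ k * R.form p p′ q q′ (δ * F y′) (δ * E x′)
        factor = trans (Σ-cong n (λ x → trans (Σ-cong n (λ y →
              pt (f x y) δ (A x y′) (E x) (F y′) (A x′ y) (E x′) (F y) (f x′ y′) (e x z) (e x′ z) (e y z) (e y′ z)))
            (Σ-* n k (λ y → f x y * ((p x - δ * F y′ * p′ x) * (q y - δ * E x′ * q′ y))))))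
          (Σ-* n k (λ x → Σ n (λ y → f x y * ((p x - δ * F y′ * p′ x) * (q y - δ * E x′ * q′ y)))))
          where
          pt : ∀ g d a E F′ a′ E′ F g′ ex ex′ ey ey′ →
            (g * (a - d * (E * F′))) * ((a′ - d * (E′ * F)) * g′) * (ex * (ex′ * (ey * ey′)))
            ≡ (g′ * (ex′ * ey′)) * (g * ((a * ex - d * F′ * (E * ex)) * (a′ * ey - d * E′ * (F * ey))))
          pt = solve-∀ ℚring

      box : W ≤ (ι 2 * N) * (ι 8 * (η * G) * G)
      box = ℚP.≤-trans (ℚP.≤-reflexive reorder)
        (ℚP.≤-trans (Σ-≤-const m (λ z _ → ℚP.≤-trans (Σ-mono n (λ x′ → Σ-mono n (λ y′ → inner z x′ y′)))
            (ℚP.≤-reflexive sumEF)))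
          (ℚP.≤-reflexive (trans (cong (_* (G * (ι 8 * (η * G)))) (ι-+ n n)) (eq N G (ι 8 * (η * G))))))
        where
        h : ℕ → ℕ → ℕ → ℕ → ℕ → ℚ
        h x x′ y y′ z = ψ x x′ y y′ * (e x z * (e x′ z * (e y z * e y′ z)))
        eq : ∀ N G t → (N + N) * (G * t) ≡ (ι 2 * N) * (t * G)
        eq = solve-∀ ℚring
        sumEF : Σ n (λ x′ → Σ n (λ y′ → (E x′ * F y′) * (ι 8 * (η * G)))) ≡ G * (ι 8 * (η * G))
        sumEF = trans (Σ-cong n (λ x′ → Σ-*ʳ n (ι 8 * (η * G)) (λ y′ → E x′ * F y′)))
          (trans (Σ-*ʳ n (ι 8 * (η * G)) (λ x′ → Σ n (λ y′ → E x′ * F y′))) (cong (_* (ι 8 * (η * G))) (Σ-product n n E F)))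
        reorder : W ≡ Σ m (λ z → Σ n (λ x′ → Σ n (λ y′ → Σ n (λ x → Σ n (λ y → h x x′ y y′ z)))))
        reorder = trans (Σ-cong n (λ x → Σ-cong n (λ x′ → Σ-rotate n n m (h x x′))))
          (trans (Σ-rotate n n m (λ x x′ z → Σ n (λ y → Σ n (λ y′ → h x x′ y y′ z))))
            (Σ-cong m (λ z → trans (Σ-swap n n (λ x x′ → Σ n (λ y → Σ n (λ y′ → h x x′ y y′ z))))
              (Σ-cong n (λ x′ → Σ-rotate n n n (λ x y y′ → h x x′ y y′ z))))))

    parameters : (fourth δ * fourth δ) * fourth s ≤ ι 1024 * ρ
    parameters = CountArithmetic.conclusion N size P triangles Tri.Θ W G δ s ρ η α β
      0<n 0<δ 0<s 0≤ρ (Σ-nonneg m (λ z → sq≥0 (D z))) few-triangles size²≤2nP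
      (subst (λ t → (triangles * triangles) * (triangles * triangles) ≤ (t * t) * (P * Tri.Θ)) ΣC Tri.T⁴≤a²PΘ)
      (Θ-telescope {ψ = ψ} {u = gF} {v = gE} {e = e} {α = α} {β = β} (proj₁ α01) (proj₂ α01) (proj₁ β01) (proj₂ β01) ψ-bounded F-uniform E-uniform
        (λ x z → idem⇒bounded (e-idem x z))
        (λ x z → subst Bounded (sym (U≡ x z)) (idem⇒bounded (idem-shift n x F-idem z)))
        (λ y z → subst Bounded (sym (V≡ y z)) (idem⇒bounded (idem-shift n y E-idem z))))
      box (trans (cong₂ _*_ αn βn) (ℚP.*-comm e₂ e₁)) dense sn²≤ size≤e₁e₂ big η-small
      where
      α01 = density≤1 {α} F F-idem αn
      β01 = density≤1 {β} E E-idem βn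

  -- Powers of rational points of the unit circle as approximate characters.

  re im : ℚ → ℚ → ℕ → ℚ
  re c s zero    = 1ℚ
  re c s (suc n) = c * re c s n - s * im c s n
  im c s zero    = 0ℚ
  im c s (suc n) = c * im c s n + s * re c s n

  Unit : ℚ → ℚ → Set
  Unit c s = c * c + s * s ≡ 1ℚ

  unit-power : ∀ {c s} → Unit c s → ∀ n → Unit (re c s n) (im c s n)
  unit-power u zero = refl
  unit-power {c} {s} u (suc n) = trans (eq c s (re c s n) (im c s n)) (cong₂ _*_ u (unit-power {c} {s} u n))
    where
    eq : ∀ c s a b → (c * a - s * b) * (c * a - s * b) + (c * b + s * a) * (c * b + s * a) ≡ (c * c + s * s) * (a * a + b * b)
    eq = solve-∀ ℚring

  power-+ : ∀ c s m n → re c s (m ℕ.+ n) ≡ re c s m * re c s n - im c s m * im c s n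
                      × im c s (m ℕ.+ n) ≡ re c s m * im c s n + im c s m * re c s n
  power-+ c s zero n = eq₁ (re c s n) (im c s n) , eq₂ (re c s n) (im c s n)
    where
    eq₁ : ∀ a b → a ≡ 1ℚ * a - 0ℚ * b
    eq₁ = solve-∀ ℚring
    eq₂ : ∀ a b → b ≡ 1ℚ * b + 0ℚ * a
    eq₂ = solve-∀ ℚring
  power-+ c s (suc m) n with power-+ c s m n
  ... | h₁ , h₂ = trans (cong₂ (λ p q → c * p - s * q) h₁ h₂) (eq₁ c s (re c s m) (im c s m) (re c s n) (im c s n))
                , trans (cong₂ (λ p q → c * q + s * p) h₁ h₂) (eq₂ c s (re c s m) (im c s m) (re c s n) (im c s n))
    where
    eq₁ : ∀ c s a b p q → c * (a * p - b * q) - s * (a * q + b * p) ≡ (c * a - s * b) * p - (c * b + s * a) * q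
    eq₁ = solve-∀ ℚring
    eq₂ : ∀ c s a b p q → c * (a * q + b * p) + s * (a * p - b * q) ≡ (c * a - s * b) * q + (c * b + s * a) * p
    eq₂ = solve-∀ ℚring

  power-* : ∀ c s m n → re c s (m ℕ.* n) ≡ re (re c s n) (im c s n) m
                      × im c s (m ℕ.* n) ≡ im (re c s n) (im c s n) m
  power-* c s zero n = refl , refl
  power-* c s (suc m) n with power-* c s m n | power-+ c s n (m ℕ.* n)
  ... | h₁ , h₂ | k₁ , k₂ = trans k₁ (cong₂ (λ p q → re c s n * p - im c s n * q) h₁ h₂)
                          , trans k₂ (cong₂ (λ p q → re c s n * p + im c s n * q) h₂ h₁)

  -- Re(θᵃ⁻ᵇ) for a unit θ, written without negative exponents.
  dot : ℚ → ℚ → ℕ → ℕ → ℚ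
  dot c s a b = re c s a * re c s b + im c s a * im c s b

  dot-comm : ∀ c s a b → dot c s a b ≡ dot c s b a
  dot-comm c s a b = eq (re c s a) (re c s b) (im c s a) (im c s b)
    where
    eq : ∀ p q r t → p * q + r * t ≡ q * p + t * r
    eq = solve-∀ ℚring

  dot-difference : ∀ {c s} → Unit c s → ∀ t b → dot c s (t ℕ.+ b) b ≡ re c s t
  dot-difference {c} {s} u t b with power-+ c s t b
  ... | h₁ , h₂ = trans (cong₂ (λ p q → p * re c s b + q * im c s b) h₁ h₂)
      (trans (eq (re c s t) (im c s t) (re c s b) (im c s b))
        (trans (cong (re c s t *_) (unit-power {c} {s} u b)) (ℚP.*-identityʳ (re c s t))))
    where
    eq : ∀ a b p q → (a * p - b * q) * p + (a * q + b * p) * q ≡ a * (p * p + q * q)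
    eq = solve-∀ ℚring

  unit⇒-1≤ : ∀ {c s} → Unit c s → - 1ℚ ≤ c
  unit⇒-1≤ {c} {s} u = *-cancel-≤ 2ℚ (0<ι 1) (lin (sq≥0 (1ℚ + c) ⊕ sq≥0 s)
    (trans (eq c s) (cong (λ t → 2ℚ * (- 1ℚ) + ((1ℚ + c) * (1ℚ + c) + s * s) + 1ℚ - t) u ∙ eq′ c s)))
    where
    _∙_ = trans
    eq : ∀ c s → 2ℚ * c + (0ℚ + 0ℚ) ≡ 2ℚ * (- 1ℚ) + ((1ℚ + c) * (1ℚ + c) + s * s) + 1ℚ - (c * c + s * s)
    eq = solve-∀ ℚring
    eq′ : ∀ c s → 2ℚ * (- 1ℚ) + ((1ℚ + c) * (1ℚ + c) + s * s) + 1ℚ - 1ℚ ≡ 2ℚ * (- 1ℚ) + ((1ℚ + c) * (1ℚ + c) + s * s)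
    eq′ = solve-∀ ℚring

  unit⇒≤1 : ∀ {c s} → Unit c s → c ≤ 1ℚ
  unit⇒≤1 {c} {s} u = *-cancel-≤ 2ℚ (0<ι 1) (lin (sq≥0 (1ℚ - c) ⊕ sq≥0 s)
    (trans (eq c s) (cong (λ t → 2ℚ * c + ((1ℚ - c) * (1ℚ - c) + s * s) + 1ℚ - t) u ∙ eq′ c s)))
    where
    _∙_ = trans
    eq : ∀ c s → 2ℚ * 1ℚ + (0ℚ + 0ℚ) ≡ 2ℚ * c + ((1ℚ - c) * (1ℚ - c) + s * s) + 1ℚ - (c * c + s * s)
    eq = solve-∀ ℚring
    eq′ : ∀ c s → 2ℚ * c + ((1ℚ - c) * (1ℚ - c) + s * s) + 1ℚ - 1ℚ ≡ 2ℚ * c + ((1ℚ - c) * (1ℚ - c) + s * s)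
    eq′ = solve-∀ ℚring

  -- In terms of |θᵗ - 1|² = 2 (1 - re θᵗ) this is |θᵗ - 1| ≤ t |θ - 1|.
  power-deviation : ∀ {c s} → Unit c s → ∀ t → 1ℚ - re c s t ≤ (ι t * ι t) * (1ℚ - c)
  power-deviation {c} {s} u zero = ℚP.≤-reflexive (eq c)
    where
    eq : ∀ c → 1ℚ - 1ℚ ≡ (0ℚ * 0ℚ) * (1ℚ - c)
    eq = solve-∀ ℚring
  power-deviation {c} {s} u (suc zero) = ℚP.≤-reflexive (eq c s)
    where
    eq : ∀ c s → 1ℚ - (c * 1ℚ - s * 0ℚ) ≡ (1ℚ * 1ℚ) * (1ℚ - c)
    eq = solve-∀ ℚring
  power-deviation {c} {s} u (suc t@(suc t′)) =
    subst (λ k → 1ℚ - re c s (suc t) ≤ (k * k) * (1ℚ - c)) (sym (ι-suc t))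
      (*-cancel-≤ (ι t) (0<ι t′) (arith (c * a - s * b - a) (c * b + s * a - b) (a - 1ℚ) b (ι t) (1ℚ - c) (1ℚ - a) (1ℚ - (c * a - s * b))
        (0≤ι t) U² V² UV² (power-deviation {c} {s} u t)))
    where
    a = re c s t
    b = im c s t
    u′ : a * a + b * b ≡ 1ℚ
    u′ = unit-power {c} {s} u t
    U² : (c * a - s * b - a) * (c * a - s * b - a) + (c * b + s * a - b) * (c * b + s * a - b) ≡ 2ℚ * (1ℚ - c)
    U² = trans (eq c s a b) (trans (cong₂ (λ p q → p * (q + 1ℚ - 2ℚ * c)) u′ u) (eq′ c))
      where
      eq : ∀ c s a b → (c * a - s * b - a) * (c * a - s * b - a) + (c * b + s * a - b) * (c * b + s * a - b)
           ≡ (a * a + b * b) * (c * c + s * s + 1ℚ - 2ℚ * c)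
      eq = solve-∀ ℚring
      eq′ : ∀ c → 1ℚ * (1ℚ + 1ℚ - 2ℚ * c) ≡ 2ℚ * (1ℚ - c)
      eq′ = solve-∀ ℚring
    dev : ∀ p q → p * p + q * q ≡ 1ℚ → (p - 1ℚ) * (p - 1ℚ) + q * q ≡ 2ℚ * (1ℚ - p)
    dev p q h = trans (eq p q) (trans (cong (λ t → t + 1ℚ - 2ℚ * p) h) (eq′ p))
      where
      eq : ∀ p q → (p - 1ℚ) * (p - 1ℚ) + q * q ≡ p * p + q * q + 1ℚ - 2ℚ * p
      eq = solve-∀ ℚring
      eq′ : ∀ p → 1ℚ + 1ℚ - 2ℚ * p ≡ 2ℚ * (1ℚ - p)
      eq′ = solve-∀ ℚring
    V² : (a - 1ℚ) * (a - 1ℚ) + b * b ≡ 2ℚ * (1ℚ - a)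
    V² = dev a b u′
    UV² : (c * a - s * b - a + (a - 1ℚ)) * (c * a - s * b - a + (a - 1ℚ)) + (c * b + s * a - b + b) * (c * b + s * a - b + b)
        ≡ 2ℚ * (1ℚ - (c * a - s * b))
    UV² = trans (eq c s a b) (dev (c * a - s * b) (c * b + s * a) (unit-power {c} {s} u (suc t)))
      where
      eq : ∀ c s a b → (c * a - s * b - a + (a - 1ℚ)) * (c * a - s * b - a + (a - 1ℚ)) + (c * b + s * a - b + b) * (c * b + s * a - b + b)
         ≡ (c * a - s * b - 1ℚ) * (c * a - s * b - 1ℚ) + (c * b + s * a) * (c * b + s * a)
      eq = solve-∀ ℚring
    -- For U = θᵗ⁺¹ - θᵗ and V = θᵗ - 1, this is |U + V|² ≤ (1 + t)|U|² + (1 + 1/t)|V|² multiplied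
    -- by t; the defect is |tU - V|². It replaces the triangle inequality, which would need square
    -- roots.
    arith : ∀ Ux Uy Vx Vy t d₁ dₜ d → 0ℚ ≤ t → Ux * Ux + Uy * Uy ≡ 2ℚ * d₁ → Vx * Vx + Vy * Vy ≡ 2ℚ * dₜ →
      (Ux + Vx) * (Ux + Vx) + (Uy + Vy) * (Uy + Vy) ≡ 2ℚ * d → dₜ ≤ (t * t) * d₁ →
      t * d ≤ t * (((1ℚ + t) * (1ℚ + t)) * d₁)
    arith Ux Uy Vx Vy t d₁ dₜ d 0≤t hU hV hUV ih = *-cancel-≤ 2ℚ (0<ι 1)
      (lin (sq≥0 (t * Ux - Vx) ⊕ sq≥0 (t * Uy - Vy) ⊕ 0≤ι 2 ⊙ (0≤1+t ⊙ ih) ⊕ 0≤1+t ⊙ ℚP.≤-reflexive hV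
            ⊕ 0≤t ⊙ ℚP.≤-reflexive (sym hUV) ⊕ ≤-*-nonneg 0≤t 0≤1+t ⊙ ℚP.≤-reflexive hU)
        (solve (Ux ∷ Uy ∷ Vx ∷ Vy ∷ t ∷ d₁ ∷ dₜ ∷ d ∷ []) ℚring))
      where
      0≤1+t : 0ℚ ≤ 1ℚ + t
      0≤1+t = ≤-+-nonneg 0≤1 0≤t

  geometric : ∀ u v J →
    Σ J (re u v) * (u - 1ℚ) - Σ J (im u v) * v ≡ re u v J - 1ℚ ×
    Σ J (im u v) * (u - 1ℚ) + Σ J (re u v) * v ≡ im u v J
  geometric u v zero = eq₁ u v , eq₂ u v
    where
    eq₁ : ∀ u v → 0ℚ * (u - 1ℚ) - 0ℚ * v ≡ 1ℚ - 1ℚ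
    eq₁ = solve-∀ ℚring
    eq₂ : ∀ u v → 0ℚ * (u - 1ℚ) + 0ℚ * v ≡ 0ℚ
    eq₂ = solve-∀ ℚring
  geometric u v (suc J) with geometric u v J
  ... | h₁ , h₂ =
      trans (cong₂ (λ p q → p * (u - 1ℚ) - q * v) front-re front-im) (trans (eq₁ u v SR SI)
        (trans (cong₂ (λ p q → u - 1ℚ + u * p - v * q) h₁ h₂) (eq₁′ u v (re u v J) (im u v J)))) ,
      trans (cong₂ (λ p q → q * (u - 1ℚ) + p * v) front-re front-im) (trans (eq₂ u v SR SI)
        (trans (cong₂ (λ p q → v + u * q + v * p) h₁ h₂) (eq₂′ u v (re u v J) (im u v J))))
    where
    SR = Σ J (re u v)
    SI = Σ J (im u v)
    front-re : Σ (suc J) (re u v) ≡ 1ℚ + (u * SR - v * SI)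
    front-re = cong (λ t → 1ℚ + t) (trans (Σ-- J (λ j → u * re u v j) (λ j → v * im u v j))
      (cong₂ _-_ (Σ-* J u (re u v)) (Σ-* J v (im u v))))
    front-im : Σ (suc J) (im u v) ≡ 0ℚ + (u * SI + v * SR)
    front-im = cong (λ t → 0ℚ + t) (trans (Σ-+ J (λ j → u * im u v j) (λ j → v * re u v j))
      (cong₂ _+_ (Σ-* J u (im u v)) (Σ-* J v (re u v))))
    eq₁ : ∀ u v a b → (1ℚ + (u * a - v * b)) * (u - 1ℚ) - (0ℚ + (u * b + v * a)) * v
        ≡ u - 1ℚ + u * (a * (u - 1ℚ) - b * v) - v * (b * (u - 1ℚ) + a * v)
    eq₁ = solve-∀ ℚring
    eq₁′ : ∀ u v a b → u - 1ℚ + u * (a - 1ℚ) - v * b ≡ u * a - v * b - 1ℚ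
    eq₁′ = solve-∀ ℚring
    eq₂ : ∀ u v a b → (0ℚ + (u * b + v * a)) * (u - 1ℚ) + (1ℚ + (u * a - v * b)) * v
        ≡ v + u * (b * (u - 1ℚ) + a * v) + v * (a * (u - 1ℚ) - b * v)
    eq₂ = solve-∀ ℚring
    eq₂′ : ∀ u v a b → v + u * b + v * (a - 1ℚ) ≡ u * b + v * a
    eq₂′ = solve-∀ ℚring

  unit-deviation : ∀ {p q} → Unit p q → (p - 1ℚ) * (p - 1ℚ) + q * q ≡ 2ℚ * (1ℚ - p)
  unit-deviation {p} {q} h = trans (eq p q) (trans (cong (λ t → t + 1ℚ - 2ℚ * p) h) (eq′ p))
    where
    eq : ∀ p q → (p - 1ℚ) * (p - 1ℚ) + q * q ≡ p * p + q * q + 1ℚ - 2ℚ * p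
    eq = solve-∀ ℚring
    eq′ : ∀ p → 1ℚ + 1ℚ - 2ℚ * p ≡ 2ℚ * (1ℚ - p)
    eq′ = solve-∀ ℚring

  -- For w = u + iv and S = Σ wʲ, |S|²|w - 1|² = |wᴶ - 1|² ≤ 4, and the left side dominates (Re S)²
  -- v². The bound does not grow with `J`.
  geometric-bound : ∀ {u v} → Unit u v → ∀ J → (Σ J (re u v) * Σ J (re u v)) * (v * v) ≤ ι 4
  geometric-bound {u} {v} h J = ℚP.≤-trans
    (lin (sq≥0 (a * (u - 1ℚ)) ⊕ sq≥0 (b * v) ⊕ sq≥0 (b * (u - 1ℚ))) (eq a b u v))
    (ℚP.≤-trans (ℚP.≤-reflexive (trans (cong₂ (λ p q → p * p + q * q) (proj₁ g) (proj₂ g)) (unit-deviation {x} {im u v J} hJ)))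
      (lin (0≤ι 2 ⊙ unit⇒-1≤ {x} {im u v J} hJ) (eq′ x)))
    where
    a = Σ J (re u v)
    b = Σ J (im u v)
    x = re u v J
    g = geometric u v J
    hJ : Unit x (im u v J)
    hJ = unit-power {u} {v} h J
    eq : ∀ a b u v → (a * (u - 1ℚ) - b * v) * (a * (u - 1ℚ) - b * v) + (b * (u - 1ℚ) + a * v) * (b * (u - 1ℚ) + a * v) + (0ℚ + (0ℚ + 0ℚ))
         ≡ (a * a) * (v * v) + ((a * (u - 1ℚ)) * (a * (u - 1ℚ)) + ((b * v) * (b * v) + (b * (u - 1ℚ)) * (b * (u - 1ℚ))))
    eq = solve-∀ ℚring
    eq′ : ∀ x → ι 4 + ι 2 * (- 1ℚ) ≡ 2ℚ * (1ℚ - x) + ι 2 * x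
    eq′ = solve-∀ ℚring

  sq-cancel : ∀ {a b} → 0ℚ ≤ b → a * a ≤ b * b → a ≤ b
  sq-cancel {a} {b} 0≤b h with ≤-or-> a b
  ... | inj₁ a≤b = a≤b
  ... | inj₂ b<a = ⊥-elim (<⇒≱ (*-pos {a - b} {a + b} (lin< b<a (e₁ a b)) (lin< (ℚP.≤-<-trans 0≤b b<a ⊕< 0≤b) (e₂ a b)))
                            (lin h (e₃ a b)))
    where
    e₁ : ∀ a b → a - b + b ≡ 0ℚ + a
    e₁ = solve-∀ ℚring
    e₂ : ∀ a b → a + b + (0ℚ + 0ℚ) ≡ 0ℚ + (a + b)
    e₂ = solve-∀ ℚring
    e₃ : ∀ a b → 0ℚ + a * a ≡ (a - b) * (a + b) + b * b
    e₃ = solve-∀ ℚring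

  -- Unit vectors θ₀, …, θ_{J-1} whose powers are orthogonal on average, up to ε:
  -- a substitute for the characters of a cyclic group.
  record Frequencies (m : ℕ) (ε : ℚ) : Set where
    field
      J    : ℕ
      c s  : ℕ → ℚ
      0<J  : 0ℚ < ι J
      unit : ∀ j → Unit (c j) (s j)
      orthogonal : ∀ a b → a ℕ.< m → b ℕ.< m →
        - (ε * ι J) ≤ Σ J (λ j → dot (c j) (s j) a b) - ι J * kronecker a b ×
        Σ J (λ j → dot (c j) (s j) a b) - ι J * kronecker a b ≤ ε * ι J

  -- The powers of one rational point of the unit circle whose angle is so small
  -- that its first m powers stay in the open right half plane.
  module SmallAngle (m : ℕ) where
    private
      -- Parameter of the point ((K² - 1)/(K² + 1), 2K/(K² + 1)). Its angle is about 2/K = 1/(m +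
      -- 1), so that (m + 1)²(1 - cos) stays below 1/2.
      K : ℚ
      K = ι 2 * ι (suc m)
      L : ℚ
      L = K * K + 1ℚ
      0<K : 0ℚ < K
      0<K = *-pos (0<ι 1) (0<ι m)
      0<L : 0ℚ < L
      0<L = lin< {0ℚ} {K * K + 1ℚ} (*-pos 0<K 0<K ⊕< 0≤1) (e (K * K))
        where
        e : ∀ k → k + 1ℚ + (0ℚ + 0ℚ) ≡ 0ℚ + (k + 1ℚ)
        e = solve-∀ ℚring
      D : ℚ
      D = proj₁ (inverse L 0<L)
      0<D : 0ℚ < D
      0<D = proj₁ (proj₂ (inverse L 0<L))
      LD : L * D ≡ 1ℚ
      LD = proj₂ (proj₂ (inverse L 0<L))

    cos sin : ℚ
    cos = (K * K - 1ℚ) * D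
    sin = (2ℚ * K) * D

    cos-sin-unit : Unit cos sin
    cos-sin-unit = trans (e K D) (cong₂ _*_ LD LD)
      where
      e : ∀ k d → ((k * k - 1ℚ) * d) * ((k * k - 1ℚ) * d) + ((2ℚ * k) * d) * ((2ℚ * k) * d) ≡ ((k * k + 1ℚ) * d) * ((k * k + 1ℚ) * d)
      e = solve-∀ ℚring

    0<sin : 0ℚ < sin
    0<sin = *-pos (*-pos (0<ι 1) 0<K) 0<D

    private
      1-cos : 1ℚ - cos ≡ 2ℚ * D
      1-cos = trans (cong (_- cos) (sym LD)) (e K D)
        where
        e : ∀ k d → (k * k + 1ℚ) * d - (k * k - 1ℚ) * d ≡ 2ℚ * d
        e = solve-∀ ℚring

      K²D≤1 : (K * K) * D ≤ 1ℚ
      K²D≤1 = subst ((K * K) * D ≤_) LD (lin (ℚP.<⇒≤ 0<D) (e K D))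
        where
        e : ∀ k d → (k * k + 1ℚ) * d + 0ℚ ≡ (k * k) * d + d
        e = solve-∀ ℚring

      re≥½ : ∀ t → t ℕ.≤ suc m → 1ℚ ≤ 2ℚ * re cos sin t
      re≥½ t t≤ = lin (0≤ι 2 ⊙ power-deviation {cos} {sin} cos-sin-unit t ⊕ 0≤ι 4 ⊙ (ℚP.<⇒≤ 0<D ⊙ sq-mono (0≤ι t) (ι-mono t≤)) ⊕ K²D≤1
          ⊕ ≤-*-nonneg (0≤ι 2) (sq≥0 (ι t)) ⊙ ℚP.≤-reflexive 1-cos)
        (e (re cos sin t) (ι t) (ι (suc m)) D (1ℚ - cos))
        where
        e : ∀ x t M D w → 2ℚ * x + (ι 2 * (1ℚ - x) + (ι 4 * (D * (t * t)) + (((ι 2 * M) * (ι 2 * M)) * D + (ι 2 * (t * t)) * w)))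
            ≡ 1ℚ + (ι 2 * ((t * t) * w) + (ι 4 * (D * (M * M)) + (1ℚ + (ι 2 * (t * t)) * (2ℚ * D))))
        e = solve-∀ ℚring

      -- Im θᵗ⁺¹ = cos · Im θᵗ + sin · Re θᵗ; the first term is nonnegative by induction and Re θᵗ ≥
      -- 1/2.
      im≥ : ∀ t → t ℕ.≤ m → sin ≤ 2ℚ * im cos sin (suc t)
      im≥ zero _ = lin (ℚP.<⇒≤ 0<sin) (e cos sin)
        where
        e : ∀ c s → 2ℚ * (c * 0ℚ + s * 1ℚ) + 0ℚ ≡ s + s
        e = solve-∀ ℚring
      im≥ (suc t) st≤m = lin (0≤sin ⊙ re≥½ (suc t) (ℕP.≤-trans st≤m (ℕP.n≤1+n m)) ⊕ ≤-*-nonneg 0≤cos 0≤im)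
        (e cos sin (im cos sin (suc t)) (re cos sin (suc t)))
        where
        0≤sin = ℚP.<⇒≤ 0<sin
        0≤cos : 0ℚ ≤ cos
        0≤cos = *-cancel-≤ 2ℚ (0<ι 1) (lin (re≥½ 1 (s≤s z≤n) ⊕ 0≤1) (e₁ cos sin))
          where
          e₁ : ∀ c s → 2ℚ * c + (1ℚ + 0ℚ) ≡ 2ℚ * 0ℚ + (2ℚ * (c * 1ℚ - s * 0ℚ) + 1ℚ)
          e₁ = solve-∀ ℚring
        0≤im : 0ℚ ≤ 2ℚ * im cos sin (suc t)
        0≤im = ℚP.≤-trans 0≤sin (im≥ t (ℕP.≤-trans (ℕP.n≤1+n t) st≤m))
        e : ∀ c s b a → 2ℚ * (c * b + s * a) + (s * 1ℚ + 0ℚ) ≡ s + (s * (2ℚ * a) + c * (2ℚ * b))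
        e = solve-∀ ℚring

    sin²≤4im² : ∀ t → t ℕ.≤ m → sin * sin ≤ ι 4 * (im cos sin (suc t) * im cos sin (suc t))
    sin²≤4im² t t≤m = subst (sin * sin ≤_) (e (im cos sin (suc t))) (sq-mono (ℚP.<⇒≤ 0<sin) (im≥ t t≤m))
      where
      e : ∀ b → (2ℚ * b) * (2ℚ * b) ≡ ι 4 * (b * b)
      e = solve-∀ ℚring

  -- Since (θʲ)ᵗ = (θᵗ)ʲ, the sum over `j` is a geometric series with ratio θᵗ. It is bounded
  -- independently of `J` because Im θᵗ is bounded below, so a large `J` brings it under εJ.
  module PowerFrequencies (m : ℕ) (ε cos sin : ℚ) (0≤ε : 0ℚ ≤ ε) (cos-sin-unit : Unit cos sin) (0<sin : 0ℚ < sin)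
    (im-large : ∀ t → t ℕ.≤ m → sin * sin ≤ ι 4 * (im cos sin (suc t) * im cos sin (suc t)))
    (J : ℕ) (J-large : ι 16 ≤ ((ε * ε) * (sin * sin)) * (ι J * ι J)) where

    c s : ℕ → ℚ
    c j = re cos sin j
    s j = im cos sin j
    unit : ∀ j → Unit (c j) (s j)
    unit = unit-power {cos} {sin} cos-sin-unit
    εJ≥0 : 0ℚ ≤ ε * ι J
    εJ≥0 = ≤-*-nonneg 0≤ε (0≤ι J)
    power-swap : ∀ t j → re (c j) (s j) t ≡ re (re cos sin t) (im cos sin t) j
    power-swap t j = trans (sym (proj₁ (power-* cos sin t j)))
      (trans (cong (re cos sin) (ℕP.*-comm t j)) (proj₁ (power-* cos sin j t)))
    small : ∀ t → t ℕ.≤ m →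
      let S = Σ J (re (re cos sin (suc t)) (im cos sin (suc t))) in - (ε * ι J) ≤ S × S ≤ ε * ι J
    small t t≤m = lin (sq-cancel { - S} εJ≥0 (subst (_≤ (ε * ι J) * (ε * ι J)) (neg² S) S²≤)) (e₁ S (ε * ι J)) , sq-cancel εJ≥0 S²≤
      where
      S v : ℚ
      S = Σ J (re (re cos sin (suc t)) (im cos sin (suc t)))
      v = im cos sin (suc t)
      neg² : ∀ S → S * S ≡ (- S) * (- S)
      neg² = solve-∀ ℚring
      e₁ : ∀ S b → S + - S ≡ - b + b
      e₁ = solve-∀ ℚring
      S²≤ : S * S ≤ (ε * ι J) * (ε * ι J)
      S²≤ = *-cancel-≤ (sin * sin) (*-pos 0<sin 0<sin)
        (lin (sq≥0 S ⊙ im-large t t≤m ⊕ 0≤ι 4 ⊙ geometric-bound {re cos sin (suc t)} {v} (unit (suc t)) J ⊕ J-large)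
          (e₂ S v sin ε (ι J)))
        where
        e₂ : ∀ S v s ε J → (s * s) * ((ε * J) * (ε * J)) + ((S * S) * (s * s) + (ι 4 * ((S * S) * (v * v)) + ι 16))
             ≡ (s * s) * (S * S) + ((S * S) * (ι 4 * (v * v)) + (ι 4 * ι 4 + ((ε * ε) * (s * s)) * (J * J)))
        e₂ = solve-∀ ℚring
    sum-dot : ∀ t b → Σ J (λ j → dot (c j) (s j) (suc t ℕ.+ b) b) ≡ Σ J (re (re cos sin (suc t)) (im cos sin (suc t)))
    sum-dot t b = Σ-cong J (λ j → trans (dot-difference {c j} {s j} (unit j) (suc t) b) (power-swap (suc t) j))
    off-diagonal : ∀ a b → a ℕ.< m → b ℕ.< a → let S = Σ J (λ j → dot (c j) (s j) a b) in - (ε * ι J) ≤ S × S ≤ ε * ι J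
    off-diagonal a b a<m b<a = subst (λ S → - (ε * ι J) ≤ S × S ≤ ε * ι J)
      (trans (sym (sum-dot t b)) (Σ-cong J (λ j → cong (λ k → dot (c j) (s j) k b) a≡)))
      (small t (ℕP.≤-trans (ℕP.≤-trans (ℕP.m∸n≤m a (suc b)) (ℕP.<⇒≤ a<m)) ℕP.≤-refl))
      where
      t = a ℕ.∸ suc b
      a≡ : suc t ℕ.+ b ≡ a
      a≡ = trans (sym (ℕP.+-suc t b)) (ℕP.m∸n+n≡m b<a)
    orth : ∀ a b → a ℕ.< m → b ℕ.< m →
        - (ε * ι J) ≤ Σ J (λ j → dot (c j) (s j) a b) - ι J * kronecker a b ×
        Σ J (λ j → dot (c j) (s j) a b) - ι J * kronecker a b ≤ ε * ι J
    orth a b a<m b<m with ℕP.<-cmp a b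
    ... | tri≈ _ refl _ = subst (λ t → - (ε * ι J) ≤ t × t ≤ ε * ι J) (sym diag)
            (lin εJ≥0 (e (ε * ι J)) , εJ≥0)
      where
      e : ∀ x → 0ℚ + 0ℚ ≡ - x + x
      e = solve-∀ ℚring
      e′ : ∀ J → J * 1ℚ - J * 1ℚ ≡ 0ℚ
      e′ = solve-∀ ℚring
      diag : Σ J (λ j → dot (c j) (s j) a a) - ι J * kronecker a a ≡ 0ℚ
      diag = trans (cong₂ (λ p q → p - ι J * q) (trans (Σ-cong J (λ j → unit-power {c j} {s j} (unit j) a)) (Σ-const J 1ℚ)) (kronecker-refl a)) (e′ (ι J))
    ... | tri< a<b a≢b _ = subst (λ t → - (ε * ι J) ≤ t × t ≤ ε * ι J)
            (trans (Σ-cong J (λ j → dot-comm (c j) (s j) b a)) (trans (e _ (ι J)) (cong (λ q → Σ J (λ j → dot (c j) (s j) a b) - ι J * q) (sym (kronecker-≢ a b a≢b)))))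
            (off-diagonal b a b<m a<b)
      where
      e : ∀ S J → S ≡ S - J * 0ℚ
      e = solve-∀ ℚring
    ... | tri> _ a≢b b<a = subst (λ t → - (ε * ι J) ≤ t × t ≤ ε * ι J)
            (trans (e _ (ι J)) (cong (λ q → Σ J (λ j → dot (c j) (s j) a b) - ι J * q) (sym (kronecker-≢ a b a≢b))))
            (off-diagonal a b a<m b<a)
      where
      e : ∀ S J → S ≡ S - J * 0ℚ
      e = solve-∀ ℚring

  frequencies : ∀ m ε → 0ℚ < ε → Frequencies m ε
  frequencies m ε 0<ε = record
    { J = suc J′ ; c = F.c ; s = F.s ; 0<J = 0<ι J′ ; unit = F.unit ; orthogonal = F.orth }
    where
    module S = SmallAngle m
    y-pos : 0ℚ < (ε * ε) * (S.sin * S.sin)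
    y-pos = *-pos (*-pos 0<ε 0<ε) (*-pos S.0<sin S.0<sin)
    choose : ∀ y → 0ℚ < y → Σ[ J′ ∈ ℕ ] ι 16 ≤ y * (ι (suc J′) * ι (suc J′))
    choose y 0<y with inverse y 0<y
    ... | w , _ , yw with archimedean (ι 16 * w)
    ...   | J′ , hJ = J′ , lin (0≤y ⊙ hJ ⊕ 0≤ι 16 ⊙ ℚP.≤-reflexive (sym yw) ⊕ 0≤y ⊙ sq≥0 (ι J′) ⊕ 0≤y ⊙ 0≤ι J′ ⊕ 0≤y)
        (trans (cong (λ t → y * (t * t) + (y * (ι 16 * w) + (ι 16 * 1ℚ + (y * 0ℚ + (y * 0ℚ + 0ℚ))))) (ι-suc J′)) (e y (ι J′) w))
      where
      0≤y = ℚP.<⇒≤ 0<y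
      e : ∀ y j w → y * ((1ℚ + j) * (1ℚ + j)) + (y * (ι 16 * w) + (ι 16 * 1ℚ + (y * 0ℚ + (y * 0ℚ + 0ℚ))))
          ≡ ι 16 + (y * j + (ι 16 * (y * w) + (y * (j * j) + (y * j + y))))
      e = solve-∀ ℚring
    J′ : ℕ
    J′ = proj₁ (choose _ y-pos)
    module F = PowerFrequencies m ε S.cos S.sin (ℚP.<⇒≤ 0<ε) S.cos-sin-unit S.0<sin S.sin²≤4im² (suc J′) (proj₂ (choose _ y-pos))

  -- Fourier analysis: a large convolution form has a large Fourier coefficient.

  Σ-product₃ : ∀ l m n (α β γ : ℕ → ℚ) →
    Σ l (λ x → Σ m (λ z → Σ n (λ y → α x * (β z * γ y)))) ≡ Σ l α * (Σ m β * Σ n γ)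
  Σ-product₃ l m n α β γ = trans
    (Σ-cong l (λ x → trans (Σ-cong m (λ z → Σ-* n (α x) (λ y → β z * γ y)))
      (trans (Σ-* m (α x) (λ z → Σ n (λ y → β z * γ y))) (cong (α x *_) (Σ-product m n β γ)))))
    (Σ-*ʳ l (Σ m β * Σ n γ) α)

  -- Real and imaginary parts of the Fourier coefficient Σ f(x) θˣ at θ = c + i s.
  coefRe coefIm : ℚ → ℚ → ℕ → (ℕ → ℚ) → ℚ
  coefRe c s n f = Σ n (λ x → f x * re c s x)
  coefIm c s n f = Σ n (λ x → f x * im c s x)

  energy : ℚ → ℚ → ℕ → (ℕ → ℚ) → ℚ
  energy c s n f = coefRe c s n f * coefRe c s n f + coefIm c s n f * coefIm c s n f

  -- The convolution theorem at one frequency: the right side is the real part of φ̂ ĝ times the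
  -- conjugate of k̂.
  trilinear : ∀ c s l m n (φ k g : ℕ → ℚ) →
    let a = coefRe c s l φ ; b = coefIm c s l φ ; p = coefRe c s n g ; q = coefIm c s n g
        u = coefRe c s m k ; v = coefIm c s m k in
    Σ l (λ x → Σ m (λ z → Σ n (λ y → (φ x * (g y * k z)) * dot c s (x ℕ.+ y) z)))
      ≡ (a * p - b * q) * u + (a * q + b * p) * v
  trilinear c s l m n φ k g = trans
    (I.∫-cong (λ (x , z , y) → trans
      (cong₂ (λ X Y → (φ x * (g y * k z)) * (X * re c s z + Y * im c s z)) (proj₁ (power-+ c s x y)) (proj₂ (power-+ c s x y)))
      (pt (φ x) (g y) (k z) (re c s x) (im c s x) (re c s y) (im c s y) (re c s z) (im c s z))))
    (trans (I.∫-+ (t φr kr gr) (λ i → t φi′ kr gi i + (t φr ki gi i + t φi ki gr i)))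
    (trans (cong₂ _+_ (Σ-product₃ l m n φr kr gr)
      (trans (I.∫-+ (t φi′ kr gi) (λ i → t φr ki gi i + t φi ki gr i)) (cong₂ _+_ (trans (Σ-product₃ l m n φi′ kr gi) (cong (_* (Σ m kr * Σ n gi)) (Σ-* l (- 1ℚ) φi)))
        (trans (I.∫-+ (t φr ki gi) (t φi ki gr)) (cong₂ _+_ (Σ-product₃ l m n φr ki gi) (Σ-product₃ l m n φi ki gr))))))
      (collect (Σ l φr) (Σ l φi) (Σ n gr) (Σ n gi) (Σ m kr) (Σ m ki))))
    where
    module I = Functional (range l ⊗ range m ⊗ range n)
    φr φi φi′ kr ki gr gi : ℕ → ℚ
    φr x = φ x * re c s x
    φi x = φ x * im c s x
    φi′ x = - 1ℚ * φi x
    kr z = k z * re c s z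
    ki z = k z * im c s z
    gr y = g y * re c s y
    gi y = g y * im c s y
    t : (α β γ : ℕ → ℚ) → ℕ × ℕ × ℕ → ℚ
    t α β γ (x , z , y) = α x * (β z * γ y)
    pt : ∀ f g k X₁ X₂ Y₁ Y₂ Z₁ Z₂ → (f * (g * k)) * ((X₁ * Y₁ - X₂ * Y₂) * Z₁ + (X₁ * Y₂ + X₂ * Y₁) * Z₂)
      ≡ (f * X₁) * ((k * Z₁) * (g * Y₁)) + ((- 1ℚ * (f * X₂)) * ((k * Z₁) * (g * Y₂))
        + ((f * X₁) * ((k * Z₂) * (g * Y₂)) + (f * X₂) * ((k * Z₂) * (g * Y₁))))
    pt = solve-∀ ℚring
    collect : ∀ a b p q u v → a * (u * p) + ((- 1ℚ * b) * (u * q) + (a * (v * q) + b * (v * p)))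
      ≡ (a * p - b * q) * u + (a * q + b * p) * v
    collect = solve-∀ ℚring

  -- From |φ̂ĝ - R k̂|² ≥ 0 and |φ̂ĝ|² ≤ R²|φ̂|², after division by R.
  product-bound : ∀ {a b p q u v R} → 0ℚ < R → p * p + q * q ≤ R * R →
    2ℚ * ((a * p - b * q) * u + (a * q + b * p) * v) ≤ R * ((a * a + b * b) + (u * u + v * v))
  product-bound {a} {b} {p} {q} {u} {v} {R} 0<R h = *-cancel-≤ R 0<R
    (lin (sq≥0 (a * p - b * q - R * u) ⊕ sq≥0 (a * q + b * p - R * v) ⊕ ≤-+-nonneg (sq≥0 a) (sq≥0 b) ⊙ h)
      (solve (a ∷ b ∷ p ∷ q ∷ u ∷ v ∷ R ∷ []) ℚring))

  search : ∀ n (f : ℕ → ℚ) t → (∀ j → j ℕ.< n → f j ≤ t) ⊎ ∃ λ j → t < f j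
  search zero    f t = inj₁ (λ _ ())
  search (suc n) f t with ≤-or-> (f 0) t | search n (f ∘ suc) t
  ... | inj₂ big | _ = inj₂ (0 , big)
  ... | inj₁ _   | inj₂ (j , big) = inj₂ (suc j , big)
  ... | inj₁ f0≤ | inj₁ rest = inj₁ λ { zero _ → f0≤ ; (suc j) (s≤s j<n) → rest j j<n }

  module Fourier (n : ℕ) (r ε : ℚ) (0<n : 0ℚ < ι n) (0<r : 0ℚ < r) (r≤1 : r ≤ 1ℚ) (0<ε : 0ℚ < ε)
    (5εn≤r : ι 5 * ε * ι n ≤ r) (freq : Frequencies (n ℕ.+ n) ε) where

    open Frequencies freq renaming (J to J#)

    private
      m : ℕ
      m = n ℕ.+ n
      J : ℚ
      J = ι J#
      D : ℕ → ℕ → ℚ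
      D a b = Σ J# (λ j → dot (c j) (s j) a b)

      average-≤ : ∀ {w} a b → a ℕ.< m → b ℕ.< m → Bounded w → w * D a b ≤ w * (J * kronecker a b) + ε * J
      average-≤ {w} a b a<m b<m (lw , uw) = lin
        (*-≤-abs {w} {1ℚ} lw uw (proj₁ (orthogonal a b a<m b<m)) (proj₂ (orthogonal a b a<m b<m))) (eq w (D a b) (J * kronecker a b) (ε * J))
        where
        eq : ∀ w d k e → w * k + e + w * (d - k) ≡ w * d + 1ℚ * e
        eq = solve-∀ ℚring

      average-≥ : ∀ {w} a b → a ℕ.< m → b ℕ.< m → Bounded w → J * (kronecker a b * w) ≤ w * D a b + ε * J
      average-≥ {w} a b a<m b<m (lw , uw) = lin
        (*-≤-abs { - w} {1ℚ} (lin uw (eq₁ w)) (lin lw (eq₂ w)) (proj₁ (orthogonal a b a<m b<m)) (proj₂ (orthogonal a b a<m b<m))) (eq w (D a b) (kronecker a b) J (ε * J))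
        where
        eq₁ : ∀ w → - w + w ≡ - 1ℚ + 1ℚ
        eq₁ = solve-∀ ℚring
        eq₂ : ∀ w → 1ℚ + - 1ℚ ≡ - w + w
        eq₂ = solve-∀ ℚring
        eq : ∀ w d k J e → w * d + e + - w * (d - J * k) ≡ J * (k * w) + 1ℚ * e
        eq = solve-∀ ℚring

    -- Averaging over the frequencies leaves the diagonal x = x′, with an error of at most ε for
    -- each of the N² pairs.
    parseval : ∀ N (f : ℕ → ℚ) → N ℕ.≤ m → (∀ x → Bounded (f x)) →
      Σ J# (λ j → energy (c j) (s j) N f) ≤ J * (ι N + ε * (ι N * ι N))
    parseval N f N≤m f≤1 = ℚP.≤-trans (ℚP.≤-reflexive expand)
      (ℚP.≤-trans (Σ-mono< N (λ x x<N → Σ-mono< N (λ x′ x′<N →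
          average-≤ x x′ (ℕP.≤-trans x<N N≤m) (ℕP.≤-trans x′<N N≤m) (bounded-* (f≤1 x) (f≤1 x′)))))
        (ℚP.≤-trans (ℚP.≤-reflexive diagonal)
          (lin (0≤ι J# ⊙ Σ-≤-const N (λ x _ → proj₂ (bounded-* (f≤1 x) (f≤1 x)))) (eq J (ι N) ε (Σ N (λ x → f x * f x))))))
      where
      eq : ∀ J N ε t → J * (N + ε * (N * N)) + J * t ≡ J * t + N * (N * (ε * J)) + J * (N * 1ℚ)
      eq = solve-∀ ℚring
      pt : ∀ a b p q t r → (a * p) * (b * q) + (a * t) * (b * r) ≡ (a * b) * (p * q + t * r)
      pt = solve-∀ ℚring
      expand : Σ J# (λ j → energy (c j) (s j) N f) ≡ Σ N (λ x → Σ N (λ x′ → (f x * f x′) * D x x′))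
      expand = trans (Σ-cong J# (λ j → trans
          (cong₂ _+_ (sym (Σ-product N N (λ x → f x * re (c j) (s j) x) (λ x → f x * re (c j) (s j) x)))
                     (sym (Σ-product N N (λ x → f x * im (c j) (s j) x) (λ x → f x * im (c j) (s j) x))))
          (trans (sym (I.∫-+ (λ (x , x′) → (f x * re (c j) (s j) x) * (f x′ * re (c j) (s j) x′)) (λ (x , x′) → (f x * im (c j) (s j) x) * (f x′ * im (c j) (s j) x′))))
            (I.∫-cong (λ (x , x′) → pt (f x) (f x′) (re (c j) (s j) x) (re (c j) (s j) x′) (im (c j) (s j) x) (im (c j) (s j) x′))))))
        (trans (sym (Σ-rotate N N J# (λ x x′ j → (f x * f x′) * dot (c j) (s j) x x′)))
          (Σ-cong N (λ x → Σ-cong N (λ x′ → Σ-* J# (f x * f x′) (λ j → dot (c j) (s j) x x′)))))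
        where module I = Functional (range N ⊗ range N)
      diagonal : Σ N (λ x → Σ N (λ x′ → (f x * f x′) * (J * kronecker x x′) + ε * J))
               ≡ J * Σ N (λ x → f x * f x) + ι N * (ι N * (ε * J))
      diagonal = trans (Σ-cong< N (λ x x<N → trans (Σ-+ N (λ x′ → (f x * f x′) * (J * kronecker x x′)) (λ _ → ε * J))
          (cong₂ _+_ (trans (Σ-cong N (λ x′ → eq₁ (f x) (f x′) J (kronecker x x′)))
              (trans (Σ-* N (J * f x) (λ x′ → kronecker x x′ * f x′)) (trans (cong (J * f x *_) (Σ-kronecker N x f x<N)) (ℚP.*-assoc J (f x) (f x)))))
            (Σ-const N (ε * J)))))
        (trans (Σ-+ N (λ x → J * (f x * f x)) (λ _ → ι N * (ε * J))) (cong₂ _+_ (Σ-* N J (λ x → f x * f x)) (Σ-const N (ι N * (ε * J)))))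
        where
        eq₁ : ∀ a b J k → (a * b) * (J * k) ≡ (J * a) * (k * b)
        eq₁ = solve-∀ ℚring

    -- If |ĝ| ≤ rn at all frequencies, inversion, `product-bound` and Parseval bound the form by
    -- (rn/2)(n + 2n) plus errors in ε, which `5εn≤r` keeps below rn²; the total stays under 3rn².
    large-coefficient : ∀ (φ g k : ℕ → ℚ) → (∀ x → Bounded (φ x)) → (∀ x → Bounded (g x)) → (∀ x → Bounded (k x)) →
      ι 3 * r * (ι n * ι n) < Σ n (λ x → Σ m (λ z → φ x * (shift n x g z * k z))) →
      ∃ λ c → ∃ λ s → Unit c s × (r * ι n) * (r * ι n) < energy c s n g
    large-coefficient φ g k φ≤1 g≤1 k≤1 large with search J# (λ j → energy (c j) (s j) n g) ((r * ι n) * (r * ι n))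
    ... | inj₂ (j , big) = c j , s j , unit j , big
    ... | inj₁ small = ⊥-elim (<⇒≱ large (final (ι n) J ε r BL S (Σ J# (λ j → energy (c j) (s j) n φ)) (Σ J# (λ j → energy (c j) (s j) m k))
              0<n 0<J (ℚP.<⇒≤ 0<r) (ℚP.<⇒≤ 0<ε) r≤1 5εn≤r step₁ step₂ (parseval n φ (ℕP.m≤m+n n n) φ≤1)
              (subst (λ t → Σ J# (λ j → energy (c j) (s j) m k) ≤ J * (t + ε * (t * t))) (ι-+ n n) (parseval m k ℕP.≤-refl k≤1))))
      where
      BL S : ℚ
      BL = Σ n (λ x → Σ m (λ z → φ x * (shift n x g z * k z)))
      S = Σ J# (λ j → Σ n (λ x → Σ m (λ z → Σ n (λ y → (φ x * (g y * k z)) * dot (c j) (s j) (x ℕ.+ y) z))))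
      w : ℕ → ℕ → ℕ → ℚ
      w x z y = φ x * (g y * k z)
      module I = Functional (range n ⊗ range m ⊗ range n)
      BL-expand : BL ≡ Σ n (λ x → Σ m (λ z → Σ n (λ y → kronecker (x ℕ.+ y) z * w x z y)))
      BL-expand = Σ-cong n (λ x → Σ-cong m (λ z → trans (cong (λ t → φ x * (t * k z)) (shift-as-sum n x g z))
        (trans (eq₁ (φ x) (Σ n (λ y → kronecker (x ℕ.+ y) z * g y)) (k z))
        (trans (sym (Σ-* n (φ x * k z) (λ y → kronecker (x ℕ.+ y) z * g y)))
          (Σ-cong n (λ y → eq₂ (φ x) (k z) (kronecker (x ℕ.+ y) z) (g y)))))))
        where
        eq₁ : ∀ p s q → p * (s * q) ≡ (p * q) * s
        eq₁ = solve-∀ ℚring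
        eq₂ : ∀ p q d g → (p * q) * (d * g) ≡ d * (p * (g * q))
        eq₂ = solve-∀ ℚring
      step₁ : J * BL ≤ S + ι n * ((ι n + ι n) * (ι n * (ε * J)))
      step₁ = ℚP.≤-trans (ℚP.≤-reflexive (trans (cong (J *_) BL-expand) (sym (I.∫-* J (λ (x , z , y) → kronecker (x ℕ.+ y) z * w x z y)))))
        (ℚP.≤-trans (Σ-mono< n (λ x x<n → Σ-mono< m (λ z z<m → Σ-mono< n (λ y y<n →
            average-≥ (x ℕ.+ y) z (ℕP.+-mono-< x<n y<n) z<m (bounded-* (φ≤1 x) (bounded-* (g≤1 y) (k≤1 z)))))))
          (ℚP.≤-reflexive (trans (I.∫-+ (λ (x , z , y) → w x z y * D (x ℕ.+ y) z) (λ _ → ε * J)) (cong₂ _+_ swap consts))))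
        where
        swap : Σ n (λ x → Σ m (λ z → Σ n (λ y → w x z y * D (x ℕ.+ y) z))) ≡ S
        swap = trans (Σ-cong n (λ x → trans (Σ-cong m (λ z → Σ-cong n (λ y → sym (Σ-* J# (w x z y) (λ j → dot (c j) (s j) (x ℕ.+ y) z)))))
            (Σ-rotate m n J# (λ z y j → w x z y * dot (c j) (s j) (x ℕ.+ y) z))))
          (Σ-swap n J# (λ x j → Σ m (λ z → Σ n (λ y → w x z y * dot (c j) (s j) (x ℕ.+ y) z))))
        consts : Σ n (λ x → Σ m (λ z → Σ n (λ y → ε * J))) ≡ ι n * ((ι n + ι n) * (ι n * (ε * J)))
        consts = trans (Σ-cong n (λ x → trans (Σ-cong m (λ z → Σ-const n (ε * J)))
          (trans (Σ-const m (ι n * (ε * J))) (cong (_* (ι n * (ε * J))) (ι-+ n n))))) (Σ-const n _)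
      step₂ : 2ℚ * S ≤ (r * ι n) * (Σ J# (λ j → energy (c j) (s j) n φ) + Σ J# (λ j → energy (c j) (s j) m k))
      step₂ = ℚP.≤-trans (ℚP.≤-reflexive (sym (Σ-* J# 2ℚ _)))
        (ℚP.≤-trans (Σ-mono< J# (λ j j<J → subst (λ t → 2ℚ * t ≤ (r * ι n) * (energy (c j) (s j) n φ + energy (c j) (s j) m k))
            (sym (trilinear (c j) (s j) n m n φ k g))
            (product-bound {coefRe (c j) (s j) n φ} {coefIm (c j) (s j) n φ} {coefRe (c j) (s j) n g} {coefIm (c j) (s j) n g}
               {coefRe (c j) (s j) m k} {coefIm (c j) (s j) m k} {r * ι n} (*-pos 0<r 0<n) (small j j<J))))
          (ℚP.≤-reflexive (trans (Σ-* J# (r * ι n) (λ j → energy (c j) (s j) n φ + energy (c j) (s j) m k))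
            (cong ((r * ι n) *_) (Σ-+ J# (λ j → energy (c j) (s j) n φ) (λ j → energy (c j) (s j) m k))))))
      final : ∀ n J ε r BL S X Y → 0ℚ < n → 0ℚ < J → 0ℚ ≤ r → 0ℚ ≤ ε → r ≤ 1ℚ → ι 5 * ε * n ≤ r →
        J * BL ≤ S + n * ((n + n) * (n * (ε * J))) → 2ℚ * S ≤ (r * n) * (X + Y) →
        X ≤ J * (n + ε * (n * n)) → Y ≤ J * (n + n + ε * ((n + n) * (n + n))) → BL ≤ ι 3 * r * (n * n)
      final n J ε r BL S X Y 0<n 0<J 0≤r 0≤ε r≤1 hε h₁ h₂ hX hY = *-cancel-≤ (ι 2 * J) (*-pos (0<ι 1) 0<J)
        (lin (0≤ι 2 ⊙ h₁ ⊕ h₂ ⊕ ≤-*-nonneg 0≤r 0≤n ⊙ (hX ⊕ hY) ⊕ Jn²r ⊙ hε ⊕ Jn² ⊙ hε ⊕ Jn²r ⊙ r≤1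
              ⊕ ≤-*-nonneg Jn² 0≤εn ⊕ Jn²r)
          (solve (n ∷ J ∷ ε ∷ r ∷ BL ∷ S ∷ X ∷ Y ∷ []) ℚring))
        where
        0≤n : 0ℚ ≤ n
        0≤n = ℚP.<⇒≤ 0<n
        Jn² : 0ℚ ≤ J * (n * n)
        Jn² = ≤-*-nonneg (ℚP.<⇒≤ 0<J) (sq≥0 n)
        Jn²r : 0ℚ ≤ J * (n * n) * r
        Jn²r = ≤-*-nonneg Jn² 0≤r
        0≤εn : 0ℚ ≤ ε * n
        0≤εn = ≤-*-nonneg 0≤ε 0≤n

  -- Dirichlet approximation by the pigeonhole principle.

  bucket : ∀ m x → 0ℚ ≤ x → x < ι m → Σ[ i ∈ Fin m ] (ι (Fin.toℕ i) ≤ x × x ≤ ι (Fin.toℕ i) + 1ℚ)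
  bucket zero x 0≤x x<0 = ⊥-elim (<⇒≱ x<0 0≤x)
  bucket (suc m) x 0≤x x<m+1 = step (≤-or-> x 1ℚ)
    where
    e₁ : ∀ x → x - 1ℚ + 1ℚ ≡ 0ℚ + x
    e₁ = solve-∀ ℚring
    e₂ : ∀ x m → m + x ≡ x - 1ℚ + (1ℚ + m)
    e₂ = solve-∀ ℚring
    e₃ : ∀ x i → x + i ≡ 1ℚ + i + (x - 1ℚ)
    e₃ = solve-∀ ℚring
    e₄ : ∀ x i → 1ℚ + i + 1ℚ + (x - 1ℚ) ≡ x + (i + 1ℚ)
    e₄ = solve-∀ ℚring
    up : Σ[ i ∈ Fin m ] (ι (Fin.toℕ i) ≤ x - 1ℚ × x - 1ℚ ≤ ι (Fin.toℕ i) + 1ℚ) →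
      Σ[ i ∈ Fin (suc m) ] (ι (Fin.toℕ i) ≤ x × x ≤ ι (Fin.toℕ i) + 1ℚ)
    up (i , lo , hi) = Fin.suc i , subst (_≤ x) (sym (ι-suc (Fin.toℕ i))) (lin lo (e₃ x (ι (Fin.toℕ i)))) ,
      subst (λ t → x ≤ t + 1ℚ) (sym (ι-suc (Fin.toℕ i))) (lin hi (e₄ x (ι (Fin.toℕ i))))
    step : x ≤ 1ℚ ⊎ 1ℚ < x → Σ[ i ∈ Fin (suc m) ] (ι (Fin.toℕ i) ≤ x × x ≤ ι (Fin.toℕ i) + 1ℚ)
    step (inj₁ x≤1) = Fin.zero , 0≤x , x≤1
    step (inj₂ 1<x) = up (bucket m (x - 1ℚ) (lin (ℚP.<⇒≤ 1<x) (e₁ x)) (lin< (subst (x <_) (ι-suc m) x<m+1) (e₂ x (ι m))))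

  -- The m² + 1 indices 0, ..., m² share m² cells. The gap is written `suc t` so that it is visibly
  -- positive.
  pigeonhole₂ : ∀ m (row column : ℕ → Fin m) →
    ∃ λ a → ∃ λ t → suc t ℕ.+ a ℕ.≤ m ℕ.* m × row (suc t ℕ.+ a) ≡ row a × column (suc t ℕ.+ a) ≡ column a
  pigeonhole₂ m row column = from (FinP.pigeonhole (ℕP.n<1+n (m ℕ.* m)) cell)
    where
    cell : Fin (suc (m ℕ.* m)) → Fin (m ℕ.* m)
    cell a = Fin.combine (row (Fin.toℕ a)) (column (Fin.toℕ a))
    from : (∃ λ i → ∃ λ j → i Fin.< j × cell i ≡ cell j) →
      ∃ λ a → ∃ λ t → suc t ℕ.+ a ℕ.≤ m ℕ.* m × row (suc t ℕ.+ a) ≡ row a × column (suc t ℕ.+ a) ≡ column a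
    from (i , j , i<j , same) = a , t , subst (ℕ._≤ m ℕ.* m) (sym b≡) (ℕP.≤-pred (FinP.toℕ<n j)) ,
        trans (cong row b≡) (sym (proj₁ both)) , trans (cong column b≡) (sym (proj₂ both))
      where
      a t : ℕ
      a = Fin.toℕ i
      t = Fin.toℕ j ℕ.∸ suc a
      b≡ : suc t ℕ.+ a ≡ Fin.toℕ j
      b≡ = trans (sym (ℕP.+-suc t a)) (ℕP.m∸n+n≡m i<j)
      both = FinP.combine-injective (row a) (column a) (row (Fin.toℕ j)) (column (Fin.toℕ j)) same

  -- Closed at both ends: a shared endpoint is harmless, as only differences of at most 1 within a
  -- bucket matter, and no floor function is needed.
  InBucket : ∀ {m} → Fin m → ℚ → Set
  InBucket i x = ι (Fin.toℕ i) ≤ x × x ≤ ι (Fin.toℕ i) + 1ℚ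

  bucket-difference : ∀ {m x y} (i j : Fin m) → i ≡ j → InBucket i x → InBucket j y → (x - y) * (x - y) ≤ 1ℚ
  bucket-difference {x = x} {y} i .i refl (lx , ux) (ly , uy) =
    lin (≤-*-nonneg {1ℚ - (x - y)} {1ℚ + (x - y)} (lin (ux ⊕ ly) (e₁ x y (ι (Fin.toℕ i)))) (lin (lx ⊕ uy) (e₂ x y (ι (Fin.toℕ i))))) (e₃ x y)
    where
    e₁ : ∀ x y i → 1ℚ - (x - y) + (x + i) ≡ 0ℚ + (i + 1ℚ + y)
    e₁ = solve-∀ ℚring
    e₂ : ∀ x y i → 1ℚ + (x - y) + (i + y) ≡ 0ℚ + (x + (i + 1ℚ))
    e₂ = solve-∀ ℚring
    e₃ : ∀ x y → 1ℚ + 0ℚ ≡ (x - y) * (x - y) + (1ℚ - (x - y)) * (1ℚ + (x - y))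
    e₃ = solve-∀ ℚring

  -- Two powers in one cell satisfy |θᵇ - θᵃ|² ≤ 2/K², and the left side equals 2(1 - Re θᵇ⁻ᵃ).
  module PowerPigeonhole {c s : ℚ} (u : Unit c s) (K : ℚ) (m : ℕ) (row column : ℕ → Fin m)
    (row-spec : ∀ a → InBucket (row a) ((1ℚ + re c s a) * K))
    (column-spec : ∀ a → InBucket (column a) ((1ℚ + im c s a) * K)) where

    private
      arith : ∀ p q p′ q′ K r → p * p + q * q ≡ 1ℚ → p′ * p′ + q′ * q′ ≡ 1ℚ → p * p′ + q * q′ ≡ r →
        ((1ℚ + p) * K - (1ℚ + p′) * K) * ((1ℚ + p) * K - (1ℚ + p′) * K) ≤ 1ℚ →
        ((1ℚ + q) * K - (1ℚ + q′) * K) * ((1ℚ + q) * K - (1ℚ + q′) * K) ≤ 1ℚ →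
        2ℚ * ((K * K) * (1ℚ - r)) ≤ 2ℚ * 1ℚ
      arith p q p′ q′ K r h h′ hr h₁ h₂ = lin (h₁ ⊕ h₂ ⊕ sq≥0 K ⊙ ℚP.≤-reflexive (sym h) ⊕ sq≥0 K ⊙ ℚP.≤-reflexive (sym h′)
          ⊕ ≤-*-nonneg (0≤ι 2) (sq≥0 K) ⊙ ℚP.≤-reflexive hr)
        (eq p q p′ q′ K r)
        where
        eq : ∀ p q p′ q′ K r → 2ℚ * 1ℚ + (((1ℚ + p) * K - (1ℚ + p′) * K) * ((1ℚ + p) * K - (1ℚ + p′) * K)
            + (((1ℚ + q) * K - (1ℚ + q′) * K) * ((1ℚ + q) * K - (1ℚ + q′) * K)
            + ((K * K) * 1ℚ + ((K * K) * 1ℚ + (ι 2 * (K * K)) * (p * p′ + q * q′)))))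
          ≡ 2ℚ * ((K * K) * (1ℚ - r)) + (1ℚ + (1ℚ + ((K * K) * (p * p + q * q) + ((K * K) * (p′ * p′ + q′ * q′) + (ι 2 * (K * K)) * r))))
        eq = solve-∀ ℚring

    conclude : ∀ a t → row (suc t ℕ.+ a) ≡ row a → column (suc t ℕ.+ a) ≡ column a →
      (K * K) * (1ℚ - re c s (suc t)) ≤ 1ℚ
    conclude a t same-row same-column = *-cancel-≤ 2ℚ (0<ι 1)
      (arith (re c s b) (im c s b) (re c s a) (im c s a) K (re c s (suc t))
        (unit-power {c} {s} u b) (unit-power {c} {s} u a) (dot-difference {c} {s} u (suc t) a)
        (bucket-difference (row b) (row a) same-row (row-spec b) (row-spec a))
        (bucket-difference (column b) (column a) same-column (column-spec b) (column-spec a)))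
      where
      b = suc t ℕ.+ a

  -- Dirichlet: by the pigeonhole principle on a grid of mesh 1/k, some power of θ is close to 1.
  dirichlet : ∀ {c s} → Unit c s → ∀ k m → ι 2 * ι k + 1ℚ ≤ ι m →
    ∃ λ d → 1 ℕ.≤ d × d ℕ.≤ m ℕ.* m × (ι k * ι k) * (1ℚ - re c s d) ≤ 1ℚ
  dirichlet {c} {s} u k m m-large = from (pigeonhole₂ m row column)
    where
    scaled : ∀ {p q} → Unit p q → Σ[ i ∈ Fin m ] InBucket i ((1ℚ + p) * ι k)
    scaled {p} {q} h = bucket m ((1ℚ + p) * ι k) (≤-*-nonneg {1ℚ + p} (lin (unit⇒-1≤ {p} {q} h) (e₁ p)) (0≤ι k))
      (ℚP.<-≤-trans (lin< (0<ι 0 ⊕< 0≤ι k ⊙ unit⇒≤1 {p} {q} h) (e₂ p (ι k))) m-large)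
      where
      e₁ : ∀ p → 1ℚ + p + - 1ℚ ≡ 0ℚ + p
      e₁ = solve-∀ ℚring
      e₂ : ∀ p k → ι 2 * k + 1ℚ + (0ℚ + k * p) ≡ (1ℚ + p) * k + (1ℚ + k * 1ℚ)
      e₂ = solve-∀ ℚring
    rows : ∀ a → Σ[ i ∈ Fin m ] InBucket i ((1ℚ + re c s a) * ι k)
    rows a = scaled {re c s a} {im c s a} (unit-power {c} {s} u a)
    columns : ∀ a → Σ[ i ∈ Fin m ] InBucket i ((1ℚ + im c s a) * ι k)
    columns a = scaled {im c s a} {re c s a}
      (trans (ℚP.+-comm (im c s a * im c s a) (re c s a * re c s a)) (unit-power {c} {s} u a))
    row column : ℕ → Fin m
    row a = proj₁ (rows a)
    column a = proj₁ (columns a)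
    open PowerPigeonhole {c} {s} u (ι k) m row column (λ a → proj₂ (rows a)) (λ a → proj₂ (columns a))
    from : (∃ λ a → ∃ λ t → suc t ℕ.+ a ℕ.≤ m ℕ.* m × row (suc t ℕ.+ a) ≡ row a × column (suc t ℕ.+ a) ≡ column a) →
      ∃ λ d → 1 ℕ.≤ d × d ℕ.≤ m ℕ.* m × (ι k * ι k) * (1ℚ - re c s d) ≤ 1ℚ
    from (a , t , b≤ , same-row , same-column) =
      suc t , s≤s z≤n , ℕP.≤-trans (ℕP.m≤m+n (suc t) a) b≤ , conclude a t same-row same-column

  -- Energy increment on arithmetic progressions.

  module Windows (n d l S : ℕ) (fits : ∀ i → i ℕ.< l → i ℕ.* d ℕ.≤ S) where
    M : ℕ
    M = S ℕ.+ n

    -- The sum of φ over x, x - d, ..., x - (l - 1)d. Windows that overhang the interval are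
    -- included (x < S + n), so each point lies in exactly `l` of them and first moments have no
    -- boundary error.
    window : (ℕ → ℚ) → ℕ → ℚ
    window φ x = Σ l (λ i → shift n (i ℕ.* d) φ x)

    Σ-window : ∀ (φ ψ : ℕ → ℚ) → Σ M (λ x → window φ x * ψ x) ≡ Σ l (λ i → Σ n (λ y → φ y * ψ (i ℕ.* d ℕ.+ y)))
    Σ-window φ ψ = trans (Σ-cong M (λ x → sym (Σ-*ʳ l (ψ x) (λ i → shift n (i ℕ.* d) φ x))))
      (trans (Σ-swap M l (λ x i → shift n (i ℕ.* d) φ x * ψ x))
        (Σ-cong< l (λ i i<l → Σ-shift M n (i ℕ.* d) φ ψ (ℕP.+-monoˡ-≤ n (fits i i<l)))))

    Σ-window₁ : ∀ (φ : ℕ → ℚ) → Σ M (window φ) ≡ ι l * Σ n φ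
    Σ-window₁ φ = trans (Σ-cong M (λ x → sym (ℚP.*-identityʳ (window φ x))))
      (trans (Σ-window φ (λ _ → 1ℚ)) (trans (Σ-cong l (λ i → Σ-cong n (λ y → ℚP.*-identityʳ (φ y)))) (Σ-const l (Σ n φ))))

    private
      N L s : ℚ
      N = ι n
      L = ι l
      s = ι S

      full : ℕ → ℚ
      full = window (λ _ → 1ℚ)

      full-idem : ∀ x i → shift n (i ℕ.* d) (λ _ → 1ℚ) x * shift n (i ℕ.* d) (λ _ → 1ℚ) x ≡ shift n (i ℕ.* d) (λ _ → 1ℚ) x
      full-idem x i = idem-shift n (i ℕ.* d) {λ _ → 1ℚ} (λ _ → refl) x

      0≤full : ∀ x → 0ℚ ≤ full x
      0≤full x = Σ-nonneg l (λ i → 0≤idem (full-idem x i))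

      full≤L : ∀ x → full x ≤ L
      full≤L x = subst (full x ≤_) (ℚP.*-identityʳ L) (Σ-≤-const l (λ i _ → idem≤1 (full-idem x i)))

    module WindowEnergy (E : ℕ → ℚ) (α : ℚ) (0≤α : 0ℚ ≤ α) (α≤1 : α ≤ 1ℚ) (αn : α * ι n ≡ Σ n E) where
      private
        w V G : ℕ → ℚ
        w = window E
        V x = w x - α * L
        G = window (λ x → E x - α)

        expand : ∀ w c → w * w ≡ (w - c) * (w - c) + ((c + c) * w - c * c)
        expand = solve-∀ ℚring

        -- Expansion around αL. The loss of `s` comes from spreading the total LαN over S + N
        -- windows instead of N.
        variance : Σ M (λ x → w x * w x) ≡ Σ M (λ x → V x * V x) + (L * L) * ((α * α) * (N - s))
        variance = trans (Σ-cong M (λ x → expand (w x) (α * L)))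
          (trans (Σ-+ M (λ x → V x * V x) (λ x → (α * L + α * L) * w x - (α * L) * (α * L)))
            (cong (λ t → Σ M (λ x → V x * V x) + t)
              (trans (Σ-- M (λ x → (α * L + α * L) * w x) (λ _ → (α * L) * (α * L)))
                (trans (cong₂ _-_ (trans (Σ-* M (α * L + α * L) w) (cong ((α * L + α * L) *_) (trans (Σ-window₁ E) (cong (L *_) (sym αn)))))
                        (trans (Σ-const M ((α * L) * (α * L))) (cong (_* ((α * L) * (α * L))) (ι-+ S n))))
                  (e α L N s)))))
          where
          e : ∀ α L N s → (α * L + α * L) * (L * (α * N)) - (s + N) * ((α * L) * (α * L)) ≡ (L * L) * ((α * α) * (N - s))
          e = solve-∀ ℚring

        α²≤1 : α * α ≤ 1ℚ * 1ℚ
        α²≤1 = *-mono-nonneg 0≤α 0≤1 α≤1 α≤1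

      window-energy : (L * L) * ((α * α) * N - s) ≤ Σ M (λ x → w x * w x)
      window-energy = subst ((L * L) * ((α * α) * N - s) ≤_) (sym variance)
        (lin (Σ-nonneg M (λ x → sq≥0 (V x)) ⊕ ≤-*-nonneg (sq≥0 L) (0≤ι S) ⊙ α²≤1) (e α L N s (Σ M (λ x → V x * V x))))
        where
        e : ∀ α L N s v → v + (L * L) * ((α * α) * (N - s)) + (0ℚ + ((L * L) * s) * (α * α))
            ≡ (L * L) * ((α * α) * N - s) + (v + ((L * L) * s) * (1ℚ * 1ℚ))
        e = solve-∀ ℚring

      private
        G≡ : ∀ x → G x + α * full x ≡ w x
        G≡ x = trans (cong (λ t → G x + t) (sym (Σ-* l α (λ i → shift n (i ℕ.* d) (λ _ → 1ℚ) x))))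
          (trans (sym (Σ-+ l (λ i → shift n (i ℕ.* d) (λ y → E y - α) x) (λ i → α * shift n (i ℕ.* d) (λ _ → 1ℚ) x)))
            (Σ-cong l (λ i → shift-offset n (i ℕ.* d) E α x)))

        -- `G` exceeds w - αL by αt with t = L - u, which is nonzero only for overhanging windows;
        -- and (V + αt)² ≤ 2V² + 2t² with t² ≤ Lt.
        G²-arith : ∀ G α L u → 0ℚ ≤ u → u ≤ L → α * α ≤ 1ℚ * 1ℚ →
          G * G ≤ 2ℚ * ((G + α * u - α * L) * (G + α * u - α * L)) + (ι 2 * L) * (L - u)
        G²-arith G α L u 0≤u u≤L h = lin
          (sq≥0 (G - (1ℚ + 1ℚ) * (α * (L - u))) ⊕ 0≤ι 2 ⊙ ≤-*-nonneg 0≤u 0≤L-u ⊕ ≤-*-nonneg (0≤ι 2) (sq≥0 (L - u)) ⊙ h)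
          (solve (G ∷ α ∷ L ∷ u ∷ []) ℚring)
          where
          0≤L-u : 0ℚ ≤ L - u
          0≤L-u = lin u≤L (solve (L ∷ u ∷ []) ℚring)

        G²≤ : ∀ x → G x * G x ≤ 2ℚ * (V x * V x) + (ι 2 * L) * (L - full x)
        G²≤ x = subst (λ t → G x * G x ≤ 2ℚ * ((t - α * L) * (t - α * L)) + (ι 2 * L) * (L - full x)) (G≡ x)
          (G²-arith (G x) α L (full x) (0≤full x) (full≤L x) α²≤1)

        ΣG²≤ : Σ M (λ x → G x * G x) ≤ 2ℚ * Σ M (λ x → V x * V x) + (ι 2 * L) * (L * s)
        ΣG²≤ = ℚP.≤-trans (Σ-mono M G²≤) (ℚP.≤-reflexive
          (trans (Σ-+ M (λ x → 2ℚ * (V x * V x)) (λ x → (ι 2 * L) * (L - full x)))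
            (cong₂ _+_ (Σ-* M 2ℚ (λ x → V x * V x))
              (trans (Σ-* M (ι 2 * L) (λ x → L - full x)) (cong ((ι 2 * L) *_)
                (trans (Σ-- M (λ _ → L) full) (trans (cong₂ _-_ (trans (Σ-const M L) (cong (_* L) (ι-+ S n)))
                    (trans (Σ-window₁ (λ _ → 1ℚ)) (cong (L *_) (Σ-const n 1ℚ)))) (e s N L))))))))
          where
          e : ∀ s N L → (s + N) * L - L * (N * 1ℚ) ≡ L * s
          e = solve-∀ ℚring

      -- Passing to windows multiplies the coefficient of E - α by Σ θⁱᵈ, whose real part is at
      -- least 3L/4 by `slow`. The windowed function keeps a large coefficient, so by Cauchy-Schwarz
      -- its square sum, and then the variance of the windows, is large.
      module Biased (c t : ℚ) (unit : Unit c t) (slow : ∀ i → i ℕ.< l → ι 3 ≤ ι 4 * re c t (i ℕ.* d)) where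
        private
          g : ℕ → ℚ
          g x = E x - α
          X Y a b p q : ℚ
          X = Σ l (λ i → re c t (i ℕ.* d))
          Y = Σ l (λ i → im c t (i ℕ.* d))
          a = coefRe c t n g
          b = coefIm c t n g
          p = Σ M (λ x → G x * re c t x)
          q = Σ M (λ x → G x * im c t x)
          module I = Functional (range l ⊗ range n)

          p≡ : p ≡ X * a - Y * b
          p≡ = trans (Σ-window g (re c t))
            (trans (I.∫-cong (λ (i , y) → trans (cong (g y *_) (proj₁ (power-+ c t (i ℕ.* d) y))) (e (g y) (re c t (i ℕ.* d)) (im c t (i ℕ.* d)) (re c t y) (im c t y))))
              (trans (I.∫-+ (λ (i , y) → re c t (i ℕ.* d) * (g y * re c t y)) (λ (i , y) → - 1ℚ * (im c t (i ℕ.* d) * (g y * im c t y))))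
                (trans (cong₂ _+_ (Σ-product l n (λ i → re c t (i ℕ.* d)) (λ y → g y * re c t y))
                  (trans (I.∫-* (- 1ℚ) (λ (i , y) → im c t (i ℕ.* d) * (g y * im c t y))) (cong (- 1ℚ *_) (Σ-product l n (λ i → im c t (i ℕ.* d)) (λ y → g y * im c t y)))))
                  (e′ (X * a) (Y * b)))))
            where
            e : ∀ g r i r′ i′ → g * (r * r′ - i * i′) ≡ r * (g * r′) + - 1ℚ * (i * (g * i′))
            e = solve-∀ ℚring
            e′ : ∀ u v → u + - 1ℚ * v ≡ u - v
            e′ = solve-∀ ℚring

          q≡ : q ≡ X * b + Y * a
          q≡ = trans (Σ-window g (im c t))
            (trans (I.∫-cong (λ (i , y) → trans (cong (g y *_) (proj₂ (power-+ c t (i ℕ.* d) y))) (e (g y) (re c t (i ℕ.* d)) (im c t (i ℕ.* d)) (re c t y) (im c t y))))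
              (trans (I.∫-+ (λ (i , y) → re c t (i ℕ.* d) * (g y * im c t y)) (λ (i , y) → im c t (i ℕ.* d) * (g y * re c t y)))
                (cong₂ _+_ (Σ-product l n (λ i → re c t (i ℕ.* d)) (λ y → g y * im c t y)) (Σ-product l n (λ i → im c t (i ℕ.* d)) (λ y → g y * re c t y)))))
            where
            e : ∀ g r i r′ i′ → g * (r * i′ + i * r′) ≡ r * (g * i′) + i * (g * r′)
            e = solve-∀ ℚring

          X≥ : L * ι 3 ≤ ι 4 * X
          X≥ = subst₂ _≤_ (Σ-const l (ι 3)) (Σ-* l (ι 4) (λ i → re c t (i ℕ.* d))) (Σ-mono< l slow)

          p²+q²≤ : p * p + q * q ≤ Σ M (λ x → G x * G x) * (s + N)
          p²+q²≤ = ℚP.≤-trans (cauchy-schwarz (range M) G (re c t) ⊕ cauchy-schwarz (range M) G (im c t))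
            (ℚP.≤-reflexive (trans (sym (ℚP.*-distribˡ-+ (Σ M (λ x → G x * G x)) (Σ M (λ x → re c t x * re c t x)) (Σ M (λ x → im c t x * im c t x))))
              (cong (Σ M (λ x → G x * G x) *_) (trans (sym (Σ-+ M (λ x → re c t x * re c t x) (λ x → im c t x * im c t x)))
                (trans (Σ-cong M (unit-power {c} {t} unit)) (trans (Σ-const M 1ℚ) (trans (ℚP.*-identityʳ (ι M)) (ι-+ S n))))))))

          -- Losses: (3/4)² from `hX`, 1/2 from s + N ≤ 2N, 1/2 from `hg`. The remaining 9/64 is at
          -- least the 1/8 claimed.
          final : ∀ α L N s r v g X Y a b → 0ℚ < N → 0ℚ ≤ s → s ≤ N → 0ℚ ≤ L → L * ι 3 ≤ ι 4 * X →
            (r * N) * (r * N) ≤ a * a + b * b → 0ℚ ≤ g →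
            (X * a - Y * b) * (X * a - Y * b) + (X * b + Y * a) * (X * b + Y * a) ≤ g * (s + N) →
            g ≤ 2ℚ * v + (ι 2 * L) * (L * s) → α * α ≤ 1ℚ * 1ℚ →
            (L * L) * (ι 8 * ((α * α) * N) + (r * r) * N - ι 16 * s) ≤ ι 8 * (v + (L * L) * ((α * α) * (N - s)))
          final α L N s r v g X Y a b 0<N 0≤s s≤N 0≤L hX hE 0≤g hpq hg hα = *-cancel-≤ (ι 8 * N) (*-pos (0<ι 7) 0<N)
            (lin (≤-*-nonneg (0≤ι 32) 0≤N ⊙ hg ⊕ 0≤ι 16 ⊙ hpq ⊕ ≤-*-nonneg (0≤ι 16) 0≤g ⊙ s≤N
                  ⊕ ≤-*-nonneg (0≤ι 16) (≤-*-nonneg (sq≥0 Y) 0≤e) ⊕ 0≤e ⊙ sq-mono (≤-*-nonneg 0≤L (0≤ι 3)) hX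
                  ⊕ sq≥0 (L * ι 3) ⊙ hE
                  ⊕ ≤-*-nonneg (≤-*-nonneg (0≤ι 64) 0≤N) (≤-*-nonneg (sq≥0 L) 0≤s) ⊙ hα
                  ⊕ sq≥0 (L * (r * N)))
              (solve (α ∷ L ∷ N ∷ s ∷ r ∷ v ∷ g ∷ X ∷ Y ∷ a ∷ b ∷ []) ℚring))
            where
            0≤N : 0ℚ ≤ N
            0≤N = ℚP.<⇒≤ 0<N
            0≤e : 0ℚ ≤ a * a + b * b
            0≤e = ≤-+-nonneg (sq≥0 a) (sq≥0 b)

        window-energy-increment : ∀ r → 0ℚ < N → s ≤ N → (r * N) * (r * N) ≤ energy c t n g →
          (L * L) * (ι 8 * ((α * α) * N) + (r * r) * N - ι 16 * s) ≤ ι 8 * Σ M (λ x → w x * w x)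
        window-energy-increment r 0<N s≤N large =
          subst (λ k → (L * L) * (ι 8 * ((α * α) * N) + (r * r) * N - ι 16 * s) ≤ ι 8 * k) (sym variance)
          (final α L N s r (Σ M (λ x → V x * V x)) (Σ M (λ x → G x * G x)) X Y a b 0<N (0≤ι S) s≤N (0≤ι l) X≥ large
            (Σ-nonneg M (λ x → sq≥0 (G x)))
            (subst₂ (λ u v → u * u + v * v ≤ Σ M (λ x → G x * G x) * (s + N)) p≡ q≡ p²+q²≤) ΣG²≤ α²≤1)

  size₂ : ℕ → (ℕ → ℕ → ℚ) → ℚ
  size₂ n A = Σ n (λ x → Σ n (A x))

  shift₂ : ℕ → ℕ → ℕ → (ℕ → ℕ → ℚ) → ℕ → ℕ → ℚ
  shift₂ n a b A x y = shift n a (λ x′ → shift n b (A x′) y) x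

  -- The new coordinates are i ↦ x - id and j ↦ y - jd. They reverse orientation: a corner with
  -- difference e comes from one with difference -ed, which `no-corner` also excludes.
  module WindowState (n d l : ℕ) (0<d : 1 ℕ.≤ d) (A : ℕ → ℕ → ℚ) (E F : ℕ → ℚ) (st : State n A E F) (x y : ℕ) where
    open State st

    A′ : ℕ → ℕ → ℚ
    A′ i j = shift₂ n (i ℕ.* d) (j ℕ.* d) A x y
    E′ F′ : ℕ → ℚ
    E′ i = shift n (i ℕ.* d) E x
    F′ j = shift n (j ℕ.* d) F y

    private
      A′-idem : ∀ i → Idempotent (A′ i)
      A′-idem i j = idem-shift n (i ℕ.* d) {λ x′ → shift n (j ℕ.* d) (A x′) y} (λ x′ → idem-shift n (j ℕ.* d) (A-idem x′) y) x

      A′⊆ : ∀ i j → A′ i j * (E′ i * F′ j) ≡ A′ i j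
      A′⊆ i j with shift-view n (i ℕ.* d) (λ x′ → shift n (j ℕ.* d) (A x′) y) x
      ... | outside eq = trans (cong (_* (E′ i * F′ j)) (eq _)) (trans (ℚP.*-zeroˡ (E′ i * F′ j)) (sym (eq _)))
      ... | inside x′ x′<n refl eq = trans (cong₂ (λ p q → p * (q * F′ j)) eq (shift-inside n (i ℕ.* d) E x′ x′<n)) (trans row (sym eq))
        where
        row : shift n (j ℕ.* d) (A x′) y * (E x′ * F′ j) ≡ shift n (j ℕ.* d) (A x′) y
        row with shift-view n (j ℕ.* d) (A x′) y
        ... | outside eq′ = trans (cong (_* (E x′ * F′ j)) (eq′ (A x′))) (trans (ℚP.*-zeroˡ (E x′ * F′ j)) (sym (eq′ (A x′))))
        ... | inside y′ y′<n refl eq′ = trans (cong₂ (λ p q → p * (E x′ * q)) eq′ (shift-inside n (j ℕ.* d) F y′ y′<n)) (trans (A⊆E×F x′ y′) (sym eq′))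

      cancel : ∀ i i′ j j′ x₁ x₂ y₁ y₂ → i ℕ.* d ℕ.+ x₁ ≡ i′ ℕ.* d ℕ.+ x₂ → j ℕ.* d ℕ.+ y₁ ≡ j′ ℕ.* d ℕ.+ y₂ →
        i′ ℕ.+ j ≡ i ℕ.+ j′ → x₂ ℕ.+ y₁ ≡ x₁ ℕ.+ y₂
      cancel i i′ j j′ x₁ x₂ y₁ y₂ hx hy h = ℕP.+-cancelˡ-≡ (i′ ℕ.* d ℕ.+ j ℕ.* d) (x₂ ℕ.+ y₁) (x₁ ℕ.+ y₂)
        (trans (rearr (i′ ℕ.* d) (j ℕ.* d) x₂ y₁) (trans (cong₂ ℕ._+_ (sym hx) hy) (trans (sym (rearr (i ℕ.* d) (j′ ℕ.* d) x₁ y₂))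
          (cong (ℕ._+ (x₁ ℕ.+ y₂)) (trans (sym (ℕP.*-distribʳ-+ d i j′)) (trans (cong (ℕ._* d) (sym h)) (ℕP.*-distribʳ-+ d i′ j)))))))
        where
        rearr : ∀ a b p q → a ℕ.+ b ℕ.+ (p ℕ.+ q) ≡ (a ℕ.+ p) ℕ.+ (b ℕ.+ q)
        rearr = ℕ-solve-∀

      inner : ∀ {i j x′} → x′ ℕ.< n → x ≡ i ℕ.* d ℕ.+ x′ → A′ i j ≡ shift n (j ℕ.* d) (A x′) y
      inner {i} {j} {x′} x′<n refl = shift-inside n (i ℕ.* d) (λ x″ → shift n (j ℕ.* d) (A x″) y) x′ x′<n

      vanish₁ : ∀ {a} b c → a ≡ 0ℚ → a * (b * c) ≡ 0ℚ
      vanish₁ b c refl = ℚP.*-zeroˡ (b * c)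
      vanish₂ : ∀ a {b} c → b ≡ 0ℚ → a * (b * c) ≡ 0ℚ
      vanish₂ a c refl = trans (cong (a *_) (ℚP.*-zeroˡ c)) (ℚP.*-zeroʳ a)
      vanish₃ : ∀ a b {c} → c ≡ 0ℚ → a * (b * c) ≡ 0ℚ
      vanish₃ a b refl = trans (cong (a *_) (ℚP.*-zeroʳ b)) (ℚP.*-zeroʳ a)

      no-corner′ : ∀ {i j i′ j′} → i ≢ i′ → i′ ℕ.+ j ≡ i ℕ.+ j′ → A′ i j * (A′ i′ j * A′ i j′) ≡ 0ℚ
      no-corner′ {i} {j} {i′} {j′} i≢i′ h
        with shift-view n (i ℕ.* d) (λ x′ → shift n (j ℕ.* d) (A x′) y) x
           | shift-view n (i′ ℕ.* d) (λ x′ → shift n (j ℕ.* d) (A x′) y) x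
      ... | outside eq | _ = vanish₁ (A′ i′ j) (A′ i j′) (eq _)
      ... | inside _ _ _ _ | outside eq = vanish₂ (A′ i j) (A′ i j′) (eq _)
      ... | inside x₁ x₁<n hx₁ _ | inside x₂ x₂<n hx₂ _
        with shift-view n (j ℕ.* d) (A x₁) y | shift-view n (j′ ℕ.* d) (A x₁) y
      ...   | outside eq | _ = vanish₁ (A′ i′ j) (A′ i j′) (trans (inner {i} {j} x₁<n hx₁) (eq (A x₁)))
      ...   | inside _ _ _ _ | outside eq = vanish₃ (A′ i j) (A′ i′ j) (trans (inner {i} {j′} x₁<n hx₁) (eq (A x₁)))
      ...   | inside y₁ y₁<n hy₁ _ | inside y₂ y₂<n hy₂ _ = trans
          (cong₂ _*_ (value {i} {j} x₁<n hx₁ y₁<n hy₁) (cong₂ _*_ (value {i′} {j} x₂<n hx₂ y₁<n hy₁) (value {i} {j′} x₁<n hx₁ y₂<n hy₂)))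
          (no-corner x₁<n y₁<n x₂<n y₂<n x₁≢x₂ (cancel i i′ j j′ x₁ x₂ y₁ y₂ (trans (sym hx₁) hx₂) (trans (sym hy₁) hy₂) h))
        where
        value : ∀ {a b p q} → p ℕ.< n → x ≡ a ℕ.* d ℕ.+ p → q ℕ.< n → y ≡ b ℕ.* d ℕ.+ q → A′ a b ≡ A p q
        value {a} {b} {p} {q} p<n hp q<n hq = trans (inner {a} {b} p<n hp)
          (trans (cong (shift n (b ℕ.* d) (A p)) hq) (shift-inside n (b ℕ.* d) (A p) q q<n))
        x₁≢x₂ : x₁ ≢ x₂
        x₁≢x₂ refl = i≢i′ (ℕP.*-cancelʳ-≡ i i′ d {{ℕ.>-nonZero 0<d}} (ℕP.+-cancelʳ-≡ x₁ (i ℕ.* d) (i′ ℕ.* d) (trans (sym hx₁) hx₂)))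

    state : State l A′ E′ F′
    state = record
      { A-idem = A′-idem
      ; E-idem = λ i → idem-shift n (i ℕ.* d) E-idem x
      ; F-idem = λ j → idem-shift n (j ℕ.* d) F-idem y
      ; A⊆E×F = A′⊆
      ; no-corner = λ {i} {j} {i′} {j′} _ _ _ _ → no-corner′ {i} {j} {i′} {j′}
      }

  -- Potential whose increase under passing to windows drives the uniformisation:
  -- the surplus of A over density δ in E × F plus a small multiple of the energy.
  potential : ℚ → ℚ → ℕ → (ℕ → ℕ → ℚ) → (ℕ → ℚ) → (ℕ → ℚ) → ℚ
  potential δ κ n A E F = size₂ n A - δ * (Σ n E * Σ n F) + κ * (Σ n E * Σ n E + Σ n F * Σ n F)

  -- Over all pairs of windows, |A| and |E||F| average exactly, and only the energy term grows. Its
  -- gain κγ equals 2τ; the boundary eats less than τ of it, so some pair of windows gains τ.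
  module Averaging (n d l S : ℕ) (fits : ∀ i → i ℕ.< l → i ℕ.* d ℕ.≤ S) (0<d : 1 ℕ.≤ d)
    (A : ℕ → ℕ → ℚ) (E F : ℕ → ℚ) (st : State n A E F) (δ κ γ τ φ α β : ℚ)
    (0<N : 0ℚ < ι n) (0<L : 0ℚ < ι l) (0≤κ : 0ℚ ≤ κ) (0<τ : 0ℚ < τ) (τ≤1 : τ ≤ 1ℚ) (κγ≡2τ : κ * γ ≡ ι 2 * τ)
    (16S≤τN : ι 16 * ι S ≤ τ * ι n) (0≤φ : 0ℚ ≤ φ) (φ≤2 : φ ≤ ι 2)
    (αN : α * ι n ≡ Σ n E) (βN : β * ι n ≡ Σ n F) where

    open Windows n d l S fits
    private
      N L s : ℚ
      N = ι n
      L = ι l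
      s = ι S
      wE wF : ℕ → ℚ
      wE = window E
      wF = window F

    module W (x y : ℕ) = WindowState n d l 0<d A E F st x y

    private
      size-sum : Σ M (λ x → Σ M (λ y → size₂ l (W.A′ x y))) ≡ (L * L) * size₂ n A
      size-sum = trans (Σ-swap-pairs M M l l (λ x y i j → shift₂ n (i ℕ.* d) (j ℕ.* d) A x y))
        (trans (Σ-cong< l (λ i i<l → Σ-cong< l (λ j j<l → one i j i<l j<l)))
          (trans (Σ-cong l (λ _ → Σ-const l (size₂ n A))) (trans (Σ-const l (L * size₂ n A)) (sym (ℚP.*-assoc L L (size₂ n A))))))
        where
        one : ∀ i j → i ℕ.< l → j ℕ.< l → Σ M (λ x → Σ M (λ y → shift₂ n (i ℕ.* d) (j ℕ.* d) A x y)) ≡ size₂ n A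
        one i j i<l j<l = trans (Σ-swap M M (λ x y → shift₂ n (i ℕ.* d) (j ℕ.* d) A x y))
          (trans (Σ-cong M (λ y → Σ-shift₁ M n (i ℕ.* d) (λ x′ → shift n (j ℕ.* d) (A x′) y) (ℕP.+-monoˡ-≤ n (fits i i<l))))
            (trans (Σ-swap M n (λ y x′ → shift n (j ℕ.* d) (A x′) y))
              (Σ-cong n (λ x′ → Σ-shift₁ M n (j ℕ.* d) (A x′) (ℕP.+-monoˡ-≤ n (fits j j<l))))))

      module I = Functional (range M ⊗ range M)

      potential-sum : Σ M (λ x → Σ M (λ y → potential δ κ l (W.A′ x y) (W.E′ x y) (W.F′ x y)))
        ≡ (L * L) * size₂ n A - δ * ((L * Σ n E) * (L * Σ n F))
          + κ * ((s + N) * Σ M (λ x → wE x * wE x) + (s + N) * Σ M (λ y → wF y * wF y))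
      potential-sum = trans (I.∫-+ (λ (x , y) → size₂ l (W.A′ x y) - δ * (wE x * wF y)) (λ (x , y) → κ * (wE x * wE x + wF y * wF y)))
        (cong₂ _+_
          (trans (I.∫-cong (λ (x , y) → e (size₂ l (W.A′ x y)) δ (wE x * wF y)))
            (trans (I.∫-+ (λ (x , y) → size₂ l (W.A′ x y)) (λ (x , y) → (- δ) * (wE x * wF y)))
              (trans (cong₂ _+_ size-sum (trans (I.∫-* (- δ) (λ (x , y) → wE x * wF y)) (cong ((- δ) *_)
                  (trans (Σ-product M M wE wF) (cong₂ _*_ (Σ-window₁ E) (Σ-window₁ F))))))
                (sym (e ((L * L) * size₂ n A) δ ((L * Σ n E) * (L * Σ n F)))))))
          (trans (I.∫-* κ (λ (x , y) → wE x * wE x + wF y * wF y)) (cong (κ *_)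
            (trans (I.∫-+ (λ (x , y) → wE x * wE x) (λ (x , y) → wF y * wF y))
              (cong₂ _+_ (trans (Σ-cong M (λ x → trans (Σ-const M (wE x * wE x)) (cong (_* (wE x * wE x)) (ι-+ S n)))) (Σ-* M (s + N) (λ x → wE x * wE x)))
                (trans (Σ-const M (Σ M (λ y → wF y * wF y))) (cong (_* Σ M (λ y → wF y * wF y)) (ι-+ S n))))))))
        where
        e : ∀ a d p → a - d * p ≡ a + (- d) * p
        e = solve-∀ ℚring

      final : ∀ N L s δ κ γ τ φ α β a wE² wF² → 0ℚ < N → 0ℚ < L → 0ℚ ≤ s → 0ℚ ≤ κ → 0ℚ < τ → τ ≤ 1ℚ → κ * γ ≡ ι 2 * τ →
        ι 16 * s ≤ τ * N → 0ℚ ≤ φ → φ ≤ ι 2 →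
        φ * (N * N) ≤ a - δ * ((α * N) * (β * N)) + κ * ((α * N) * (α * N) + (β * N) * (β * N)) →
        (L * L) * ((α * α + β * β + γ) * N) ≤ wE² + wF² →
        (L * L) * a - δ * ((L * (α * N)) * (L * (β * N))) + κ * ((s + N) * wE² + (s + N) * wF²)
          ≤ (s + N) * ((s + N) * ((φ + τ) * (L * L))) →
        0ℚ ≤ wE² + wF² → ⊥
      final N L s δ κ γ τ φ α β a wE² wF² 0<N 0<L 0≤s 0≤κ 0<τ τ≤1 hκ hs 0≤φ φ≤2 hφ hw hsum 0≤w =
        <⇒≱ (*-pos 0<τ (*-pos 0<N 0<N)) (*-cancel-≤ (L * L) (*-pos 0<L 0<L) bound)
        where
        0≤N : 0ℚ ≤ N
        0≤N = ℚP.<⇒≤ 0<N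
        0≤τ : 0ℚ ≤ τ
        0≤τ = ℚP.<⇒≤ 0<τ
        0≤φτ : 0ℚ ≤ φ + τ
        0≤φτ = ≤-+-nonneg 0≤φ 0≤τ
        LL : 0ℚ ≤ L * L
        LL = sq≥0 L
        main : (L * L) * ((φ + ι 2 * τ) * (N * N)) ≤ (s + N) * ((s + N) * ((φ + τ) * (L * L)))
        main = lin (hsum ⊕ LL ⊙ hφ ⊕ ≤-*-nonneg 0≤κ 0≤N ⊙ hw ⊕ ≤-*-nonneg (≤-*-nonneg 0≤κ 0≤s) 0≤w
                    ⊕ ≤-*-nonneg LL (sq≥0 N) ⊙ ℚP.≤-reflexive (sym hκ))
          (solve (N ∷ L ∷ s ∷ δ ∷ κ ∷ γ ∷ τ ∷ φ ∷ α ∷ β ∷ a ∷ wE² ∷ wF² ∷ []) ℚring)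
        s≤N : ι 16 * s ≤ N
        s≤N = lin (hs ⊕ 0≤N ⊙ τ≤1) (solve (N ∷ s ∷ τ ∷ []) ℚring)
        3s : (s + N) * (s + N) ≤ N * N + ι 3 * (N * s)
        3s = lin (0≤s ⊙ s≤N ⊕ ≤-*-nonneg (0≤ι 15) (sq≥0 s)) (solve (N ∷ s ∷ []) ℚring)
        -- `main` leaves τN² ≤ (φ + τ) · 3Ns, while (φ + τ) · 3Ns ≤ 9Ns ≤ (9/16) τN². Hence the
        -- factor 7 = 16 - 9.
        bound : (L * L) * (τ * (N * N)) ≤ (L * L) * 0ℚ
        bound = *-cancel-≤ (ι 7) (0<ι 6) (lin (0≤ι 16 ⊙ main ⊕ 0≤ι 16 ⊙ (≤-*-nonneg 0≤φτ LL ⊙ 3s)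
            ⊕ ≤-*-nonneg (≤-*-nonneg LL (≤-*-nonneg (0≤ι 48) 0≤N)) 0≤s ⊙ (φ≤2 ⊕ τ≤1) ⊕ ≤-*-nonneg LL (≤-*-nonneg (0≤ι 9) 0≤N) ⊙ hs)
          (solve (N ∷ L ∷ s ∷ τ ∷ φ ∷ []) ℚring))

    some-window-gains : φ * (ι n * ι n) ≤ potential δ κ n A E F →
      (L * L) * ((α * α + β * β + γ) * N) ≤ Σ M (λ x → wE x * wE x) + Σ M (λ y → wF y * wF y) →
      (∀ x y → potential δ κ l (W.A′ x y) (W.E′ x y) (W.F′ x y) ≤ (φ + τ) * (L * L)) → ⊥
    some-window-gains hφ hw all = final N L s δ κ γ τ φ α β (size₂ n A) _ _ 0<N 0<L (0≤ι S) 0≤κ 0<τ τ≤1 κγ≡2τ 16S≤τN 0≤φ φ≤2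
      (subst₂ (λ p q → φ * (N * N) ≤ size₂ n A - δ * (p * q) + κ * (p * p + q * q)) (sym αN) (sym βN) hφ) hw
      (subst₂ (λ p q → (L * L) * size₂ n A - δ * ((L * p) * (L * q)) + κ * ((s + N) * Σ M (λ x → wE x * wE x) + (s + N) * Σ M (λ y → wF y * wF y))
          ≤ (s + N) * ((s + N) * ((φ + τ) * (L * L)))) (sym αN) (sym βN)
        (ℚP.≤-trans (ℚP.≤-reflexive (sym potential-sum))
          (subst (λ t → Σ M (λ x → Σ M (λ y → potential δ κ l (W.A′ x y) (W.E′ x y) (W.F′ x y))) ≤ t * (t * ((φ + τ) * (L * L)))) (ι-+ S n)
            (Σ-≤-const M (λ x _ → Σ-≤-const M (λ y _ → all x y))))))
      (≤-+-nonneg (Σ-nonneg M (λ x → sq≥0 (wE x))) (Σ-nonneg M (λ y → sq≥0 (wF y))))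

  frequencies-for : ∀ n r → 0ℚ < ι n → 0ℚ < r → Σ[ ε ∈ ℚ ] (0ℚ < ε × ι 5 * ε * ι n ≤ r × Frequencies (n ℕ.+ n) ε)
  frequencies-for n r 0<N 0<r = choose (inverse (ι 5 * ι n) (*-pos (0<ι 4) 0<N))
    where
    choose : Σ[ w ∈ ℚ ] (0ℚ < w × ι 5 * ι n * w ≡ 1ℚ) →
      Σ[ ε ∈ ℚ ] (0ℚ < ε × ι 5 * ε * ι n ≤ r × Frequencies (n ℕ.+ n) ε)
    choose (w , 0<w , eq) = r * w , *-pos 0<r 0<w ,
      lin (ℚP.<⇒≤ 0<r ⊙ ℚP.≤-reflexive eq) (e r w (ι n)) , frequencies (n ℕ.+ n) (r * w) (*-pos 0<r 0<w)
      where
      e : ∀ r w n → r + r * (ι 5 * n * w) ≡ ι 5 * (r * w) * n + r * 1ℚ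
      e = solve-∀ ℚring

  difference-bounded : ∀ {a α} → a * a ≡ a → 0ℚ ≤ α → α ≤ 1ℚ → Bounded (a - α)
  difference-bounded {a} {α} a² 0≤α α≤1 = lin (0≤idem a² ⊕ α≤1) (e₁ a α) , lin (idem≤1 a² ⊕ 0≤α) (e₂ a α)
    where
    e₁ : ∀ a α → a - α + (0ℚ + α) ≡ - 1ℚ + (a + 1ℚ)
    e₁ = solve-∀ ℚring
    e₂ : ∀ a α → 1ℚ + (a + 0ℚ) ≡ a - α + (1ℚ + α)
    e₂ = solve-∀ ℚring

  -- The energy increment read backwards: if length `l` with potential φ + τ is refuted, then E and
  -- F have no large Fourier coefficient, since one would produce a window of that potential.
  module Descend (n l : ℕ) (A : ℕ → ℕ → ℚ) (E F : ℕ → ℚ) (st : State n A E F) (δ κ r γ τ φ α β : ℚ)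
    (0<L : 0ℚ < ι l) (1≤l : 1ℚ ≤ ι l) (l⁴≤n : fourth (ι l) ≤ ι n) (400≤τl : ι 400 ≤ τ * ι l)
    (0<r : 0ℚ < r) (r≤1 : r ≤ 1ℚ) (r²≡16γ : r * r ≡ ι 16 * γ) (0≤κ : 0ℚ ≤ κ) (κ≤1 : κ ≤ 1ℚ)
    (0<τ : 0ℚ < τ) (τ≤1 : τ ≤ 1ℚ) (κγ≡2τ : κ * γ ≡ ι 2 * τ) (0≤φ : 0ℚ ≤ φ) (φ≤2 : φ ≤ ι 2)
    (0≤α : 0ℚ ≤ α) (α≤1 : α ≤ 1ℚ) (αN : α * ι n ≡ Σ n E)
    (0≤β : 0ℚ ≤ β) (β≤1 : β ≤ 1ℚ) (βN : β * ι n ≡ Σ n F)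
    (hφ : φ * (ι n * ι n) ≤ potential δ κ n A E F)
    (rec : ∀ A′ E′ F′ → State l A′ E′ F′ → (φ + τ) * (ι l * ι l) ≤ potential δ κ l A′ E′ F′ → ⊥) where

    open State st
    private
      N L : ℚ
      N = ι n
      L = ι l

      0<N : 0ℚ < N
      0<N = ℚP.<-≤-trans (*-pos (*-pos 0<L 0<L) (*-pos 0<L 0<L)) l⁴≤n

      -- The mesh is 1/(2l), hence m = 2(2l) + 1 and d ≤ m². A window then spans at most S = lm² ≤
      -- 25l³, and 16S ≤ 400l³ ≤ τl⁴ ≤ τn: the source of the fourth root and of the constant 400.
      m S : ℕ
      m = suc (4 ℕ.* l)
      S = l ℕ.* (m ℕ.* m)

      ιm : ι m ≡ 1ℚ + ι 4 * L
      ιm = trans (ι-suc (4 ℕ.* l)) (cong (λ t → 1ℚ + t) (ι-* 4 l))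

      16S≤τN : ι 16 * ι S ≤ τ * N
      16S≤τN = subst (λ t → ι 16 * t ≤ τ * N)
        (sym (trans (ι-* l (m ℕ.* m)) (cong (L *_) (trans (ι-* m m) (cong₂ _*_ ιm ιm)))))
        (arith L τ N 1≤l (ℚP.<⇒≤ 0<τ) 400≤τl l⁴≤n)
        where
        arith : ∀ L τ N → 1ℚ ≤ L → 0ℚ ≤ τ → ι 400 ≤ τ * L → (L * L) * (L * L) ≤ N →
          ι 16 * (L * ((1ℚ + ι 4 * L) * (1ℚ + ι 4 * L))) ≤ τ * N
        arith L τ N 1≤L 0≤τ h hN = lin (0≤τ ⊙ hN ⊕ ≤-*-nonneg (sq≥0 L) 0≤L ⊙ h
            ⊕ ≤-*-nonneg (0≤ι 16) 0≤L ⊙ 1≤L ⊕ ≤-*-nonneg (0≤ι 144) (sq≥0 L) ⊙ 1≤L)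
          (solve (L ∷ τ ∷ N ∷ []) ℚring)
          where
          0≤L : 0ℚ ≤ L
          0≤L = ℚP.≤-trans 0≤1 1≤L

      S≤N : ι S ≤ N
      S≤N = arith (ι S) τ N (0≤ι S) (0≤ι n) τ≤1 16S≤τN
        where
        arith : ∀ s τ N → 0ℚ ≤ s → 0ℚ ≤ N → τ ≤ 1ℚ → ι 16 * s ≤ τ * N → s ≤ N
        arith s τ N 0≤s 0≤N τ≤1 h = lin (h ⊕ 0≤N ⊙ τ≤1 ⊕ 0≤ι 15 ⊙ 0≤s) (solve (s ∷ τ ∷ N ∷ []) ℚring)

      0≤γ : 0ℚ ≤ γ
      0≤γ = *-cancel-≤ (ι 16) (0<ι 15) (ℚP.≤-trans (sq≥0 r) (ℚP.≤-reflexive r²≡16γ))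

      -- The biased set gains r²/8 = 2γ. Both boundary losses together, 3s ≤ (3/16) τN, cost less
      -- than the second γ because 2τ = κγ ≤ γ.
      two-energies : ∀ L N s α β X Y → 0ℚ ≤ N → ι 16 * s ≤ τ * N →
        (L * L) * (ι 8 * ((α * α) * N) + (r * r) * N - ι 16 * s) ≤ ι 8 * X →
        (L * L) * ((β * β) * N - s) ≤ Y → (L * L) * ((α * α + β * β + γ) * N) ≤ X + Y
      two-energies L N s α β X Y 0≤N hs h₁ h₂ = *-cancel-≤ (ι 32) (0<ι 31)
        (lin (0≤ι 4 ⊙ h₁ ⊕ 0≤ι 32 ⊙ h₂ ⊕ ≤-*-nonneg (sq≥0 L) (0≤ι 6) ⊙ hs
              ⊕ ≤-*-nonneg (≤-*-nonneg (sq≥0 L) (0≤ι 3)) 0≤N ⊙ ℚP.≤-reflexive (sym κγ≡2τ)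
              ⊕ ≤-*-nonneg (≤-*-nonneg (sq≥0 L) (0≤ι 3)) (≤-*-nonneg 0≤γ 0≤N) ⊙ κ≤1
              ⊕ ≤-*-nonneg (≤-*-nonneg (sq≥0 L) (0≤ι 4)) 0≤N ⊙ ℚP.≤-reflexive (sym r²≡16γ)
              ⊕ ≤-*-nonneg (≤-*-nonneg (sq≥0 L) (0≤ι 29)) (≤-*-nonneg 0≤γ 0≤N))
          (eq L N s α β X Y τ r κ γ))
        where
        eq : ∀ L N s α β X Y τ r κ γ →
          ι 32 * (X + Y) + (ι 4 * ((L * L) * (ι 8 * ((α * α) * N) + (r * r) * N - ι 16 * s))
            + (ι 32 * ((L * L) * ((β * β) * N - s)) + (((L * L) * ι 6) * (ι 16 * s)
            + ((((L * L) * ι 3) * N) * (ι 2 * τ) + ((((L * L) * ι 3) * (γ * N)) * κ + ((((L * L) * ι 4) * N) * (ι 16 * γ) + 0ℚ))))))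
          ≡ ι 32 * ((L * L) * ((α * α + β * β + γ) * N)) + (ι 4 * (ι 8 * X) + (ι 32 * Y + (((L * L) * ι 6) * (τ * N)
            + ((((L * L) * ι 3) * N) * (κ * γ) + ((((L * L) * ι 3) * (γ * N)) * 1ℚ + ((((L * L) * ι 4) * N) * (r * r)
            + ((L * L) * ι 29) * (γ * N)))))))
        eq = solve-∀ ℚring

      -- Quadratic growth of the deviation: 1 - Re θⁱᵈ ≤ i²(1 - Re θᵈ) ≤ i²/(4l²) ≤ 1/4.
      close-powers : ∀ {c t d} → Unit c t → (ι (2 ℕ.* l) * ι (2 ℕ.* l)) * (1ℚ - re c t d) ≤ 1ℚ →
        ∀ i → i ℕ.< l → ι 3 ≤ ι 4 * re c t (i ℕ.* d)
      close-powers {c} {t} {d} u h i i<l = subst (λ x → ι 3 ≤ ι 4 * x) (sym (proj₁ (power-* c t i d)))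
        (arith L (ι i) (re c t d) (re (re c t d) (im c t d) i) 0<L (0≤ι i) (ι-mono (ℕP.<⇒≤ i<l))
          (subst (λ k → (k * k) * (1ℚ - re c t d) ≤ 1ℚ) (ι-* 2 l) h)
          (power-deviation {re c t d} {im c t d} (unit-power {c} {t} u d) i))
        where
        arith : ∀ L i x y → 0ℚ < L → 0ℚ ≤ i → i ≤ L → ((ι 2 * L) * (ι 2 * L)) * (1ℚ - x) ≤ 1ℚ →
          1ℚ - y ≤ (i * i) * (1ℚ - x) → ι 3 ≤ ι 4 * y
        arith L i x y 0<L 0≤i i≤L hx hy = *-cancel-≤ (L * L) (*-pos 0<L 0<L)
          (lin (sq≥0 i ⊙ hx ⊕ ≤-*-nonneg (0≤ι 4) (sq≥0 L) ⊙ hy ⊕ sq-mono 0≤i i≤L)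
            (solve (L ∷ i ∷ x ∷ y ∷ []) ℚring))

      run : ∀ c t → Unit c t →
        (r * N) * (r * N) ≤ energy c t n (λ x → E x - α) ⊎ (r * N) * (r * N) ≤ energy c t n (λ y → F y - β) → ⊥
      run c t u biased = go (dirichlet {c} {t} u (2 ℕ.* l) m
          (ℚP.≤-reflexive (trans (cong (λ x → ι 2 * x + 1ℚ) (ι-* 2 l)) (trans (e L) (sym ιm)))))
        where
        e : ∀ L → ι 2 * (ι 2 * L) + 1ℚ ≡ 1ℚ + ι 4 * L
        e = solve-∀ ℚring
        go : (∃ λ d → 1 ℕ.≤ d × d ℕ.≤ m ℕ.* m × (ι (2 ℕ.* l) * ι (2 ℕ.* l)) * (1ℚ - re c t d) ≤ 1ℚ) → ⊥
        go (d , 1≤d , d≤m² , close) = Av.some-window-gains hφ (energies biased)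
            (λ x y → below x y (≤-or-> (potential δ κ l (Av.W.A′ x y) (Av.W.E′ x y) (Av.W.F′ x y)) ((φ + τ) * (L * L))))
          where
          fits : ∀ i → i ℕ.< l → i ℕ.* d ℕ.≤ S
          fits i i<l = ℕP.*-mono-≤ (ℕP.<⇒≤ i<l) d≤m²
          module Win = Windows n d l S fits
          module Av = Averaging n d l S fits 1≤d A E F st δ κ γ τ φ α β 0<N 0<L 0≤κ 0<τ τ≤1 κγ≡2τ 16S≤τN 0≤φ φ≤2 αN βN
          module WE = Win.WindowEnergy E α 0≤α α≤1 αN
          module WF = Win.WindowEnergy F β 0≤β β≤1 βN
          wE² wF² : ℚ
          wE² = Σ Win.M (λ x → Win.window E x * Win.window E x)
          wF² = Σ Win.M (λ y → Win.window F y * Win.window F y)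
          slow = close-powers {c} {t} {d} u close
          energies : (r * N) * (r * N) ≤ energy c t n (λ x → E x - α) ⊎ (r * N) * (r * N) ≤ energy c t n (λ y → F y - β) →
            (L * L) * ((α * α + β * β + γ) * N) ≤ Σ Win.M (λ x → Win.window E x * Win.window E x) + Σ Win.M (λ y → Win.window F y * Win.window F y)
          energies (inj₁ h) = two-energies L N (ι S) α β wE² wF² (0≤ι n) 16S≤τN (WE.Biased.window-energy-increment c t u slow r 0<N S≤N h) WF.window-energy
          energies (inj₂ h) = lin (two-energies L N (ι S) β α wF² wE² (0≤ι n) 16S≤τN (WF.Biased.window-energy-increment c t u slow r 0<N S≤N h) WE.window-energy)
            (swap (L * L) (α * α) (β * β) γ N wE² wF²)
            where
            swap : ∀ L a b g N X Y → X + Y + L * ((b + a + g) * N) ≡ L * ((a + b + g) * N) + (Y + X)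
            swap = solve-∀ ℚring
          below : ∀ x y → (potential δ κ l (Av.W.A′ x y) (Av.W.E′ x y) (Av.W.F′ x y) ≤ (φ + τ) * (L * L)
              ⊎ (φ + τ) * (L * L) < potential δ κ l (Av.W.A′ x y) (Av.W.E′ x y) (Av.W.F′ x y)) →
            potential δ κ l (Av.W.A′ x y) (Av.W.E′ x y) (Av.W.F′ x y) ≤ (φ + τ) * (L * L)
          below x y (inj₁ h) = h
          below x y (inj₂ h) = ⊥-elim (rec (Av.W.A′ x y) (Av.W.E′ x y) (Av.W.F′ x y) (Av.W.state x y) (ℚP.<⇒≤ h))

      uniform : ∀ (g : ℕ → ℚ) → (∀ x → Bounded (g x)) → (∀ c t → Unit c t → (r * N) * (r * N) ≤ energy c t n g → ⊥) →
        FourFold.Small n (n ℕ.+ n) (ι 3 * r * (N * N)) (λ x → shift n x g)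
      uniform g g≤1 absurd ψ k ψ≤1 k≤1 = decide (frequencies-for n r 0<N 0<r)
          (≤-or-> (Σ n (λ x → Σ (n ℕ.+ n) (λ z → ψ x * (shift n x g z * k z)))) (ι 3 * r * (N * N)))
        where
        decide : Σ[ ε ∈ ℚ ] (0ℚ < ε × ι 5 * ε * ι n ≤ r × Frequencies (n ℕ.+ n) ε) →
          Σ n (λ x → Σ (n ℕ.+ n) (λ z → ψ x * (shift n x g z * k z))) ≤ ι 3 * r * (N * N)
            ⊎ ι 3 * r * (N * N) < Σ n (λ x → Σ (n ℕ.+ n) (λ z → ψ x * (shift n x g z * k z))) →
          Σ n (λ x → Σ (n ℕ.+ n) (λ z → ψ x * (shift n x g z * k z))) ≤ ι 3 * r * (N * N)
        decide _ (inj₁ h) = h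
        decide (ε , 0<ε , hε , fr) (inj₂ h) =
          contra (Fourier.large-coefficient n r ε 0<N 0<r r≤1 0<ε hε fr ψ g k ψ≤1 g≤1 k≤1 h)
          where
          contra : (∃ λ c → ∃ λ t → Unit c t × (r * N) * (r * N) < energy c t n g) →
            Σ n (λ x → Σ (n ℕ.+ n) (λ z → ψ x * (shift n x g z * k z))) ≤ ι 3 * r * (N * N)
          contra (c , t , u , big) = ⊥-elim (absurd c t u (ℚP.<⇒≤ big))

    E-uniform : FourFold.Small n (n ℕ.+ n) (ι 3 * r * (N * N)) (λ y → shift n y (λ x → E x - α))
    E-uniform = uniform (λ x → E x - α) (λ x → difference-bounded (E-idem x) 0≤α α≤1) (λ c t u h → run c t u (inj₁ h))

    F-uniform : FourFold.Small n (n ℕ.+ n) (ι 3 * r * (N * N)) (λ x → shift n x (λ y → F y - β))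
    F-uniform = uniform (λ y → F y - β) (λ y → difference-bounded (F-idem y) 0≤β β≤1) (λ c t u h → run c t u (inj₂ h))

  -- The iteration of density increments and descents to progressions.

  scale : ℕ → ℕ → ℕ
  scale B zero    = B
  scale B (suc m) = (scale B m ℕ.* scale B m) ℕ.* (scale B m ℕ.* scale B m)

  1≤scale : ∀ {B} → 1 ℕ.≤ B → ∀ m → 1 ℕ.≤ scale B m
  1≤scale 1≤B zero    = 1≤B
  1≤scale 1≤B (suc m) = ℕP.*-mono-≤ (ℕP.*-mono-≤ h h) (ℕP.*-mono-≤ h h)
    where h = 1≤scale 1≤B m

  scale-mono : ∀ {B} → 1 ℕ.≤ B → ∀ m k → scale B m ℕ.≤ scale B (k ℕ.+ m)
  scale-mono 1≤B m zero    = ℕP.≤-refl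
  scale-mono {B} 1≤B m (suc k) = ℕP.≤-trans (scale-mono 1≤B m k)
    (subst (ℕ._≤ scale B (suc k ℕ.+ m)) (trans (ℕP.*-identityʳ (q ℕ.* 1)) (ℕP.*-identityʳ q)) (ℕP.*-mono-≤ (ℕP.*-mono-≤ (ℕP.≤-refl {q}) h) (ℕP.*-mono-≤ h h)))
    where
    q = scale B (k ℕ.+ m)
    h = 1≤scale 1≤B (k ℕ.+ m)

  -- `scale B m` is B^(4^m), a ladder of lengths of which each descent uses one rung.
  ι-scale : ∀ B m → ι (scale B (suc m)) ≡ fourth (ι (scale B m))
  ι-scale B m = trans (ι-* (q ℕ.* q) (q ℕ.* q)) (cong₂ _*_ (ι-* q q) (ι-* q q))
    where q = scale B m

  -- `δ₀` is the initial density, `h` the step of density, `r` the Fourier threshold, `γ` the energy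
  -- gain and `τ` the potential gain of a descent, `T` the number of descents allowed at one
  -- density, `B` the shortest length. `σ k` is the surplus guaranteed while `k` density increments
  -- remain, and `s` bounds all of them from below.
  record Parameters : Set where
    field
      δ₀ h r κ γ τ s : ℚ
      σ              : ℕ → ℚ
      T B            : ℕ
      0<δ₀   : 0ℚ < δ₀
      0<h    : 0ℚ < h
      0<r    : 0ℚ < r
      r≤1    : r ≤ 1ℚ
      0≤κ    : 0ℚ ≤ κ
      4κ≤1   : ι 4 * κ ≤ 1ℚ
      0<τ    : 0ℚ < τ
      τ≤1    : τ ≤ 1ℚ
      0<s    : 0ℚ < s
      s≤σ    : ∀ k → s ≤ σ k
      r²≡16γ : r * r ≡ ι 16 * γ
      κγ≡2τ  : κ * γ ≡ ι 2 * τ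
      η-small : ι 4096 * (ι 2 * h) ≤ fourth δ₀ * fourth δ₀
      r-small : ι 1024 * (ι 3 * r) < (fourth δ₀ * fourth δ₀) * fourth s
      -- A density increment keeps only a fraction `h` of the surplus; 2κ is room for the energy
      -- term.
      σ-step  : ∀ k → σ k + ι 2 * κ ≤ h * σ (suc k)
      T-large : ι 2 ≤ ι T * τ
      1≤B     : 1 ℕ.≤ B
      400≤τB  : ι 400 ≤ τ * ι B
      4≤δsB   : ι 4 ≤ δ₀ * s * ι B

  module Restrict (n : ℕ) (A : ℕ → ℕ → ℚ) (E F : ℕ → ℚ) (st : State n A E F)
    (u v : ℕ → ℚ) (u² : Idempotent u) (v² : Idempotent v) where
    open State st

    A′ : ℕ → ℕ → ℚ
    A′ x y = A x y * (u x * v y)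
    E′ F′ : ℕ → ℚ
    E′ x = E x * u x
    F′ y = F y * v y

    state : State n A′ E′ F′
    state = record
      { A-idem = λ x y → idem-* (A-idem x y) (idem-* (u² x) (v² y))
      ; E-idem = λ x → idem-* (E-idem x) (u² x)
      ; F-idem = λ y → idem-* (F-idem y) (v² y)
      ; A⊆E×F = λ x y → trans (e (A x y) (E x) (F y) (u x) (v y)) (cong₂ _*_ (A⊆E×F x y) (cong₂ _*_ (u² x) (v² y)))
      ; no-corner = λ {x} {y} {x′} {y′} p q p′ q′ x≢ h →
          trans (e′ (A x y) (u x * v y) (A x′ y) (u x′ * v y) (A x y′) (u x * v y′))
            (trans (cong (_* ((u x * v y) * ((u x′ * v y) * (u x * v y′)))) (no-corner p q p′ q′ x≢ h)) (ℚP.*-zeroˡ ((u x * v y) * ((u x′ * v y) * (u x * v y′)))))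
      }
      where
      e : ∀ a p q u v → (a * (u * v)) * ((p * u) * (q * v)) ≡ (a * (p * q)) * ((u * u) * (v * v))
      e = solve-∀ ℚring
      e′ : ∀ a p b q c r → (a * p) * ((b * q) * (c * r)) ≡ (a * (b * c)) * (p * (q * r))
      e′ = solve-∀ ℚring

    surplus : ∀ δ → Σ n (λ x → Σ n (λ y → (A x y - δ * (E x * F y)) * (u x * v y))) ≡ size₂ n A′ - δ * (Σ n E′ * Σ n F′)
    surplus δ = trans (I.∫-cong (λ (x , y) → e (A x y) δ (E x) (F y) (u x) (v y)))
      (trans (I.∫-+ (λ (x , y) → A′ x y) (λ (x , y) → (- δ) * (E′ x * F′ y)))
        (trans (cong (λ t → size₂ n A′ + t) (trans (I.∫-* (- δ) (λ (x , y) → E′ x * F′ y)) (cong ((- δ) *_) (Σ-product n n E′ F′))))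
          (e′ (size₂ n A′) δ (Σ n E′ * Σ n F′))))
      where
      module I = Functional (range n ⊗ range n)
      e : ∀ a d p q u v → (a - d * (p * q)) * (u * v) ≡ a * (u * v) + (- d) * ((p * u) * (q * v))
      e = solve-∀ ℚring
      e′ : ∀ a d p → a + (- d) * p ≡ a - d * p
      e′ = solve-∀ ℚring

    private
      shrink : ∀ {a b} → a * a ≡ a → b * b ≡ b → a * b ≤ a
      shrink {a} {b} ha hb = subst (a * b ≤_) (ℚP.*-identityʳ a) (0≤idem ha ⊙ idem≤1 hb)

    product≤ : Σ n E′ * Σ n F′ ≤ Σ n E * Σ n F
    product≤ = *-mono-nonneg (Σ-nonneg n (λ x → 0≤idem (idem-* (E-idem x) (u² x)))) (Σ-nonneg n (λ y → 0≤idem (F-idem y)))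
      (Σ-mono n (λ x → shrink (E-idem x) (u² x))) (Σ-mono n (λ y → shrink (F-idem y) (v² y)))

  module Iteration (prm : Parameters) where
    open Parameters prm

    private
      0≤τ : 0ℚ ≤ τ
      0≤τ = ℚP.<⇒≤ 0<τ
      0≤h : 0ℚ ≤ h
      0≤h = ℚP.<⇒≤ 0<h
      0<σ : ∀ k → 0ℚ < σ k
      0<σ k = ℚP.<-≤-trans 0<s (s≤σ k)

    -- The energy term is at most 2κn², so the condition `σ′ + ι 2 * κ ≤ φ` guarantees a true
    -- surplus of σ′n² whatever the energy.
    Refuted : ℕ → ℚ → ℚ → ℚ → Set
    Refuted n δ φ σ′ = ∀ A E F → State n A E F → φ * (ι n * ι n) ≤ potential δ κ n A E F → σ′ + ι 2 * κ ≤ φ → ⊥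

    module Bounds (n : ℕ) (0<N : 0ℚ < ι n) (A : ℕ → ℕ → ℚ) (E F : ℕ → ℚ) (st : State n A E F) (δ φ σ′ : ℚ)
      (hφ : φ * (ι n * ι n) ≤ potential δ κ n A E F) (0≤δ : 0ℚ ≤ δ) (0<σ′ : 0ℚ < σ′) (σ≤φ : σ′ + ι 2 * κ ≤ φ) where
      open State st
      open Balanced n A E F st δ public using (size≤e₁e₂; e₁; e₂)
      N a : ℚ
      N = ι n
      a = size₂ n A

      0≤e₁ : 0ℚ ≤ e₁
      0≤e₁ = Σ-nonneg n (λ x → 0≤idem (E-idem x))
      0≤e₂ : 0ℚ ≤ e₂
      0≤e₂ = Σ-nonneg n (λ x → 0≤idem (F-idem x))
      e₁≤N : e₁ ≤ N
      e₁≤N = subst (e₁ ≤_) (ℚP.*-identityʳ N) (Σ-≤-const n (λ x _ → idem≤1 (E-idem x)))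
      e₂≤N : e₂ ≤ N
      e₂≤N = subst (e₂ ≤_) (ℚP.*-identityʳ N) (Σ-≤-const n (λ x _ → idem≤1 (F-idem x)))
      0≤e₁e₂ : 0ℚ ≤ e₁ * e₂
      0≤e₁e₂ = ≤-*-nonneg 0≤e₁ 0≤e₂
      e₁e₂≤N² : e₁ * e₂ ≤ N * N
      e₁e₂≤N² = *-mono-nonneg 0≤e₁ (0≤ι n) e₁≤N e₂≤N

      surplus : σ′ * (N * N) ≤ a - δ * (e₁ * e₂)
      surplus = arith a δ (e₁ * e₂) e₁ e₂ hφ σ≤φ (sq-mono 0≤e₁ e₁≤N) (sq-mono 0≤e₂ e₂≤N)
        where
        arith : ∀ a δ G e₁ e₂ → φ * (N * N) ≤ a - δ * G + κ * (e₁ * e₁ + e₂ * e₂) → σ′ + ι 2 * κ ≤ φ →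
          e₁ * e₁ ≤ N * N → e₂ * e₂ ≤ N * N → σ′ * (N * N) ≤ a - δ * G
        arith a δ G e₁ e₂ h₁ h₂ h₃ h₄ = lin (h₁ ⊕ sq≥0 N ⊙ h₂ ⊕ 0≤κ ⊙ (h₃ ⊕ h₄)) (eq a δ G e₁ e₂ N φ κ σ′)
          where
          eq : ∀ a δ G e₁ e₂ N φ κ σ → a - δ * G + (φ * (N * N) + ((N * N) * (σ + ι 2 * κ) + κ * (e₁ * e₁ + e₂ * e₂)))
             ≡ σ * (N * N) + (a - δ * G + κ * (e₁ * e₁ + e₂ * e₂) + ((N * N) * φ + κ * (N * N + N * N)))
          eq = solve-∀ ℚring

      0<N² : 0ℚ < N * N
      0<N² = *-pos 0<N 0<N

      -- As |A| ≤ n² and 4κ ≤ 1, the potential is at most (3/2)n². This is what limits the descents.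
      φ<2 : φ < ι 2
      φ<2 with ≤-or-> (ι 2) φ
      ... | inj₂ h = h
      ... | inj₁ h = ⊥-elim (<⇒≱ 0<N² (arith a δ (e₁ * e₂) e₁ e₂ h hφ size≤e₁e₂ e₁e₂≤N² (≤-*-nonneg 0≤δ 0≤e₁e₂) (sq-mono 0≤e₁ e₁≤N) (sq-mono 0≤e₂ e₂≤N)))
        where
        arith : ∀ a δ G e₁ e₂ → ι 2 ≤ φ → φ * (N * N) ≤ a - δ * G + κ * (e₁ * e₁ + e₂ * e₂) → a ≤ G → G ≤ N * N → 0ℚ ≤ δ * G →
          e₁ * e₁ ≤ N * N → e₂ * e₂ ≤ N * N → N * N ≤ 0ℚ
        arith a δ G e₁ e₂ h₀ h₁ h₂ h₃ h₄ h₅ h₆ = lin (0≤ι 2 ⊙ (sq≥0 N ⊙ h₀) ⊕ 0≤ι 2 ⊙ h₁ ⊕ 0≤ι 2 ⊙ h₂ ⊕ 0≤ι 2 ⊙ h₃ ⊕ 0≤ι 2 ⊙ h₄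
            ⊕ ≤-*-nonneg (0≤ι 2) 0≤κ ⊙ (h₅ ⊕ h₆) ⊕ sq≥0 N ⊙ 4κ≤1)
          (eq a (δ * G) G e₁ e₂ N φ κ)
          where
          eq : ∀ a d G e₁ e₂ N φ κ → 0ℚ + (ι 2 * ((N * N) * ι 2) + (ι 2 * (φ * (N * N)) + (ι 2 * a + (ι 2 * G + (ι 2 * 0ℚ
                + ((ι 2 * κ) * (e₁ * e₁ + e₂ * e₂) + (N * N) * (ι 4 * κ)))))))
             ≡ N * N + (ι 2 * ((N * N) * φ) + (ι 2 * (a - d + κ * (e₁ * e₁ + e₂ * e₂)) + (ι 2 * G + (ι 2 * (N * N) + (ι 2 * d
                + ((ι 2 * κ) * (N * N + N * N) + (N * N) * 1ℚ))))))
          eq = solve-∀ ℚring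

      -- For δ ≥ 1 the surplus |A| - δ|E||F| cannot be positive. This is what limits the density
      -- increments.
      δ<1 : δ < 1ℚ
      δ<1 with ≤-or-> 1ℚ δ
      ... | inj₂ h = h
      ... | inj₁ h = ⊥-elim (<⇒≱ (*-pos 0<σ′ 0<N²) (arith a δ (e₁ * e₂) surplus size≤e₁e₂ 0≤e₁e₂ h))
        where
        arith : ∀ a δ G → σ′ * (N * N) ≤ a - δ * G → a ≤ G → 0ℚ ≤ G → 1ℚ ≤ δ → σ′ * (N * N) ≤ 0ℚ
        arith a δ G h₁ h₂ h₃ h₄ = lin (h₁ ⊕ h₂ ⊕ h₃ ⊙ h₄) (eq a δ G (σ′ * (N * N)))
          where
          eq : ∀ a δ G s → 0ℚ + (s + (a + G * 1ℚ)) ≡ s + (a - δ * G + (G + G * δ))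
          eq = solve-∀ ℚring

      σN²≤a : σ′ * (N * N) ≤ a
      σN²≤a = lin (surplus ⊕ ≤-*-nonneg 0≤δ 0≤e₁e₂) (eq a (δ * (e₁ * e₂)) (σ′ * (N * N)))
        where
        eq : ∀ a d s → a + (s + 0ℚ) ≡ s + (a - d + d)
        eq = solve-∀ ℚring

      dense : δ * (e₁ * e₂) ≤ a
      dense = lin (surplus ⊕ ≤-*-nonneg (ℚP.<⇒≤ 0<σ′) (ℚP.<⇒≤ 0<N²)) (eq a (δ * (e₁ * e₂)) (σ′ * (N * N)))
        where
        eq : ∀ a d s → a + (s + 0ℚ) ≡ d + (a - d + s)
        eq = solve-∀ ℚring

    -- `outer` rules out denser rectangles and `inner`, through `Descend`, makes E and F uniform;
    -- the counting inequality then contradicts `r-small`.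
    step : ∀ n l δ φ σ′ → δ₀ ≤ δ → s ≤ σ′ → 1 ℕ.≤ l → B ℕ.≤ l → fourth (ι l) ≤ ι n →
      Refuted l δ (φ + τ) σ′ → Refuted n (δ + h) (h * σ′) (h * σ′ - ι 2 * κ) → Refuted n δ φ σ′
    step n l δ φ σ′ δ₀≤δ s≤σ′ 1≤l B≤l l⁴≤n inner outer A E F st hφ σ≤φ = from (inverse N 0<N)
      where
      N L : ℚ
      N = ι n
      L = ι l
      1≤L : 1ℚ ≤ L
      1≤L = ι-mono 1≤l
      0<L : 0ℚ < L
      0<L = ℚP.<-≤-trans (0<ι 0) 1≤L
      0<N : 0ℚ < N
      0<N = ℚP.<-≤-trans (*-pos (*-pos 0<L 0<L) (*-pos 0<L 0<L)) l⁴≤n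
      L≤N : L ≤ N
      L≤N = ℚP.≤-trans (lin (≤-*-nonneg (≤-*-nonneg 0≤L (≤-+-nonneg (≤-+-nonneg (sq≥0 L) 0≤L) 0≤1)) (lin 1≤L (e₀ L))) (e L)) l⁴≤n
        where
        0≤L = ℚP.<⇒≤ 0<L
        e₀ : ∀ L → L - 1ℚ + 1ℚ ≡ 0ℚ + L
        e₀ = solve-∀ ℚring
        e : ∀ L → (L * L) * (L * L) + 0ℚ ≡ L + (L * (L * L + L + 1ℚ)) * (L - 1ℚ)
        e = solve-∀ ℚring
      0<δ : 0ℚ < δ
      0<δ = ℚP.<-≤-trans 0<δ₀ δ₀≤δ
      0≤δ : 0ℚ ≤ δ
      0≤δ = ℚP.<⇒≤ 0<δ
      open State st
      open Bounds n 0<N A E F st δ φ σ′ hφ 0≤δ (ℚP.<-≤-trans 0<s s≤σ′) σ≤φ hiding (N)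
      0≤φ : 0ℚ ≤ φ
      0≤φ = ℚP.≤-trans (≤-+-nonneg (ℚP.<⇒≤ (ℚP.<-≤-trans 0<s s≤σ′)) (≤-*-nonneg (0≤ι 2) 0≤κ)) σ≤φ
      κ≤1 : κ ≤ 1ℚ
      κ≤1 = lin (4κ≤1 ⊕ 0≤ι 3 ⊙ 0≤κ) (e κ)
        where
        e : ∀ κ → 1ℚ + (ι 4 * κ + ι 3 * 0ℚ) ≡ κ + (1ℚ + ι 3 * κ)
        e = solve-∀ ℚring
      big : ι 4 ≤ δ * s * N
      big = ℚP.≤-trans 4≤δsB (*-mono-nonneg (≤-*-nonneg (ℚP.<⇒≤ 0<δ₀) (ℚP.<⇒≤ 0<s)) (0≤ι n)
        (*-mono-nonneg (ℚP.<⇒≤ 0<δ₀) (ℚP.<⇒≤ 0<s) δ₀≤δ ℚP.≤-refl) (ℚP.≤-trans (ι-mono B≤l) L≤N))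
      δ⁸ : fourth δ₀ * fourth δ₀ ≤ fourth δ * fourth δ
      δ⁸ = sq-mono (sq≥0 (δ₀ * δ₀)) (fourth-mono (ℚP.<⇒≤ 0<δ₀) δ₀≤δ)

      no-increment : ∀ (u v : ℕ → ℚ) → Idempotent u → Idempotent v →
        Σ n (λ x → Σ n (λ y → (A x y - δ * (E x * F y)) * (u x * v y))) ≤ (ι 2 * h) * (e₁ * e₂)
      no-increment u v u² v² = decide (≤-or-> (Σ n (λ x → Σ n (λ y → (A x y - δ * (E x * F y)) * (u x * v y)))) ((ι 2 * h) * (e₁ * e₂)))
        where
        module R = Restrict n A E F st u v u² v²
        decide : Σ n (λ x → Σ n (λ y → (A x y - δ * (E x * F y)) * (u x * v y))) ≤ (ι 2 * h) * (e₁ * e₂)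
            ⊎ (ι 2 * h) * (e₁ * e₂) < Σ n (λ x → Σ n (λ y → (A x y - δ * (E x * F y)) * (u x * v y))) →
          Σ n (λ x → Σ n (λ y → (A x y - δ * (E x * F y)) * (u x * v y))) ≤ (ι 2 * h) * (e₁ * e₂)
        decide (inj₁ p) = p
        -- Half of the excess 2h|E||F| pays for raising δ to δ + h, as the rectangle lies in E × F.
        -- The other half, at least h|A| ≥ hσ′n², is the new surplus.
        decide (inj₂ p) = ⊥-elim (outer R.A′ R.E′ R.F′ R.state
          (arith (e₁ * e₂) (size₂ n R.A′) δ (Σ n R.E′ * Σ n R.F′) (Σ n R.E′) (Σ n R.F′) a
            (ℚP.≤-trans (ℚP.<⇒≤ p) (ℚP.≤-reflexive (R.surplus δ))) R.product≤ size≤e₁e₂ σN²≤a)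
          (ℚP.≤-reflexive (e (h * σ′) κ)))
          where
          e : ∀ x κ → x - ι 2 * κ + ι 2 * κ ≡ x
          e = solve-∀ ℚring
          arith : ∀ G a′ δ G′ e₁ e₂ a → (ι 2 * h) * G ≤ a′ - δ * G′ → G′ ≤ G → a ≤ G → σ′ * (N * N) ≤ a →
            (h * σ′) * (N * N) ≤ a′ - (δ + h) * G′ + κ * (e₁ * e₁ + e₂ * e₂)
          arith G a′ δ G′ e₁ e₂ a h₁ h₂ h₃ h₄ = lin (h₁ ⊕ 0≤h ⊙ (h₂ ⊕ h₃ ⊕ h₄) ⊕ ≤-*-nonneg 0≤κ (≤-+-nonneg (sq≥0 e₁) (sq≥0 e₂)))
            (eq G a′ δ G′ e₁ e₂ a h κ σ′ N)
            where
            eq : ∀ G a′ δ G′ e₁ e₂ a h κ σ N →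
              a′ - (δ + h) * G′ + κ * (e₁ * e₁ + e₂ * e₂) + ((ι 2 * h) * G + (h * (G′ + (a + σ * (N * N))) + 0ℚ))
              ≡ (h * σ) * (N * N) + (a′ - δ * G′ + (h * (G + (G + a)) + κ * (e₁ * e₁ + e₂ * e₂)))
            eq = solve-∀ ℚring

      from : Σ[ w ∈ ℚ ] (0ℚ < w × N * w ≡ 1ℚ) → ⊥
      from (w , 0<w , Nw) = <⇒≱ (ℚP.<-≤-trans r-small (≤-*-nonneg-mono δ⁸))
        (Pseudorandom.parameters n A E F st δ (ι 2 * h) (ι 3 * r) s β α 0<N 0<δ (ℚP.<⇒≤ δ<1) 0<s
          (≤-*-nonneg (0≤ι 3) (ℚP.<⇒≤ 0<r)) βN αN dense
          (ℚP.≤-trans (*-mono-nonneg (ℚP.<⇒≤ 0<s) (sq≥0 N) s≤σ′ ℚP.≤-refl) σN²≤a) big (ℚP.≤-trans η-small δ⁸) no-increment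
          D.F-uniform D.E-uniform)
        where
        α β : ℚ
        α = e₁ * w
        β = e₂ * w
        scaleN : ∀ e → (e * w) * N ≡ e
        scaleN e = trans (eq e w N) (trans (cong (e *_) Nw) (ℚP.*-identityʳ e))
          where
          eq : ∀ e w N → (e * w) * N ≡ e * (N * w)
          eq = solve-∀ ℚring
        αN = scaleN e₁
        βN = scaleN e₂
        ≤1 : ∀ {e} → e ≤ N → e * w ≤ 1ℚ
        ≤1 {e} e≤N = subst₂ _≤_ (ℚP.*-comm w e) (trans (ℚP.*-comm w N) Nw) (ℚP.<⇒≤ 0<w ⊙ e≤N)
        ≤-*-nonneg-mono : ∀ {x y} → x ≤ y → x * fourth s ≤ y * fourth s
        ≤-*-nonneg-mono {x} {y} x≤y = subst₂ _≤_ (ℚP.*-comm (fourth s) x) (ℚP.*-comm (fourth s) y) (sq≥0 (s * s) ⊙ x≤y)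
        e : ∀ φ τ → φ + τ + 0ℚ ≡ φ + τ
        e = solve-∀ ℚring
        module D = Descend n l A E F st δ κ r γ τ φ α β 0<L 1≤L l⁴≤n
          (ℚP.≤-trans 400≤τB (0≤τ ⊙ ι-mono B≤l)) 0<r r≤1 r²≡16γ 0≤κ κ≤1 0<τ τ≤1 κγ≡2τ 0≤φ (ℚP.<⇒≤ φ<2)
          (≤-*-nonneg 0≤e₁ (ℚP.<⇒≤ 0<w)) (≤1 e₁≤N) αN (≤-*-nonneg 0≤e₂ (ℚP.<⇒≤ 0<w)) (≤1 e₂≤N) βN hφ
          (λ A′ E′ F′ st′ hφ′ → inner A′ E′ F′ st′ hφ′ (ℚP.≤-trans σ≤φ (lin 0≤τ (e φ τ))))

    -- Lexicographic induction: `k` density increments and, at the current density, `t` descents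
    -- remain. An increment keeps the length but resets the potential to hσ and the number of
    -- descents to `T`, so each density level has T + 1 rungs of the ladder in reserve.
    impossible : ∀ k t n δ φ → δ₀ ≤ δ → 1ℚ ≤ δ + ι k * h → scale B (k ℕ.* suc T ℕ.+ t) ℕ.≤ n →
      ι 2 ≤ φ + ι t * τ → Refuted n δ φ (σ k)
    impossible zero t n δ φ δ₀≤δ 1≤δ big 2≤φ A E F st hφ σ≤φ =
      <⇒≱ (Bounds.δ<1 n 0<N A E F st δ φ (σ 0) hφ (ℚP.≤-trans (ℚP.<⇒≤ 0<δ₀) δ₀≤δ) (0<σ 0) σ≤φ) (subst (1ℚ ≤_) (e δ h) 1≤δ)
      where
      e : ∀ δ h → δ + 0ℚ * h ≡ δ
      e = solve-∀ ℚring
      0<N : 0ℚ < ι n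
      0<N = ℚP.<-≤-trans (0<ι 0) (ι-mono (ℕP.≤-trans (1≤scale 1≤B t) big))
    impossible (suc k) zero n δ φ δ₀≤δ 1≤δ big 2≤φ A E F st hφ σ≤φ =
      <⇒≱ (Bounds.φ<2 n 0<N A E F st δ φ (σ (suc k)) hφ (ℚP.≤-trans (ℚP.<⇒≤ 0<δ₀) δ₀≤δ) (0<σ (suc k)) σ≤φ) (subst (ι 2 ≤_) (e φ τ) 2≤φ)
      where
      e : ∀ φ τ → φ + 0ℚ * τ ≡ φ
      e = solve-∀ ℚring
      0<N : 0ℚ < ι n
      0<N = ℚP.<-≤-trans (0<ι 0) (ι-mono (ℕP.≤-trans (1≤scale 1≤B (suc k ℕ.* suc T ℕ.+ 0)) big))
    impossible (suc k) (suc t) n δ φ δ₀≤δ 1≤δ big 2≤φ =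
      step n l δ φ (σ (suc k)) δ₀≤δ (s≤σ (suc k)) (1≤scale 1≤B m) (scale-base m) l⁴≤n
        (impossible (suc k) t l δ (φ + τ) δ₀≤δ 1≤δ ℕP.≤-refl (subst (ι 2 ≤_) shift-τ 2≤φ))
        (λ A E F st hφ _ → impossible k T n (δ + h) (h * σ (suc k)) (ℚP.≤-trans δ₀≤δ (lin 0≤h (e₀ δ h)))
          (subst (1ℚ ≤_) shift-h 1≤δ) small (ℚP.≤-trans T-large (lin (≤-*-nonneg 0≤h (ℚP.<⇒≤ (0<σ (suc k)))) (e₁ (ι T * τ) (h * σ (suc k)))))
          A E F st hφ (σ-step k))
      where
      m l : ℕ
      m = suc k ℕ.* suc T ℕ.+ t
      l = scale B m
      e₀ : ∀ δ h → δ + h + 0ℚ ≡ δ + h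
      e₀ = solve-∀ ℚring
      e₁ : ∀ x y → y + x + 0ℚ ≡ x + y
      e₁ = solve-∀ ℚring
      scale-base : ∀ m → B ℕ.≤ scale B m
      scale-base m = subst (λ k → B ℕ.≤ scale B k) (ℕP.+-identityʳ m) (scale-mono 1≤B 0 m)
      big′ : scale B (suc m) ℕ.≤ n
      big′ = subst (λ x → scale B x ℕ.≤ n) (ℕP.+-suc (suc k ℕ.* suc T) t) big
      l⁴≤n : fourth (ι l) ≤ ι n
      l⁴≤n = subst (_≤ ι n) (ι-scale B m) (ι-mono big′)
      shift-τ : φ + ι (suc t) * τ ≡ φ + τ + ι t * τ
      shift-τ = trans (cong (λ x → φ + x * τ) (ι-suc t)) (e φ (ι t) τ)
        where
        e : ∀ φ t τ → φ + (1ℚ + t) * τ ≡ φ + τ + t * τ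
        e = solve-∀ ℚring
      shift-h : δ + ι (suc k) * h ≡ δ + h + ι k * h
      shift-h = trans (cong (λ x → δ + x * h) (ι-suc k)) (e δ (ι k) h)
        where
        e : ∀ φ t τ → φ + (1ℚ + t) * τ ≡ φ + τ + t * τ
        e = solve-∀ ℚring
      small : scale B (k ℕ.* suc T ℕ.+ T) ℕ.≤ n
      small = ℕP.≤-trans (ℕP.≤-trans (scale-mono 1≤B (k ℕ.* suc T ℕ.+ T) (suc (suc t)))
        (ℕP.≤-reflexive (cong (scale B) (e k T t)))) big
        where
        e : ∀ k T t → suc (suc t) ℕ.+ (k ℕ.* suc T ℕ.+ T) ≡ suc k ℕ.* suc T ℕ.+ suc t
        e = ℕ-solve-∀

  -- From Boolean sets to states: symmetrisation, and the very dense case.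

  indicator : Bool → ℚ
  indicator true  = 1ℚ
  indicator false = 0ℚ

  indicator-idem : ∀ b → indicator b * indicator b ≡ indicator b
  indicator-idem true  = refl
  indicator-idem false = refl

  Σ-last : ∀ n (f : ℕ → ℚ) → Σ (suc n) f ≡ Σ n f + f n
  Σ-last zero    f = trans (ℚP.+-identityʳ (f 0)) (sym (ℚP.+-identityˡ (f 0)))
  Σ-last (suc n) f = trans (cong (λ t → f 0 + t) (Σ-last n (f ∘ suc))) (sym (ℚP.+-assoc (f 0) (Σ n (f ∘ suc)) (f (suc n))))

  points : (ℕ → ℕ → Bool) → ℕ → ℕ → ℚ
  points P x y = indicator (P (suc x) (suc y))

  ι-countRow : ∀ P x n → ι (countRow P x n) ≡ Σ n (λ y → indicator (P x (suc y)))
  ι-countRow P x zero    = refl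
  ι-countRow P x (suc n) = trans (head (P x (suc n)) refl) (sym (Σ-last n (λ y → indicator (P x (suc y)))))
    where
    head : ∀ b → P x (suc n) ≡ b → ι (countRow P x (suc n)) ≡ Σ n (λ y → indicator (P x (suc y))) + indicator (P x (suc n))
    head true  eq rewrite eq = trans (ι-suc (countRow P x n)) (trans (ℚP.+-comm 1ℚ (ι (countRow P x n))) (cong (_+ 1ℚ) (ι-countRow P x n)))
    head false eq rewrite eq = trans (ι-countRow P x n) (sym (ℚP.+-identityʳ _))

  ι-card : ∀ P N → ι (card P N) ≡ size₂ N (points P)
  ι-card P N = go N
    where
    go : ∀ n → ι (countRect P N n) ≡ Σ n (λ x → Σ N (points P x))
    go zero    = refl
    go (suc n) = trans (ι-+ (countRow P (suc n) N) (countRect P N n))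
      (trans (cong₂ _+_ (ι-countRow P (suc n) N) (go n))
        (trans (ℚP.+-comm (Σ N (points P n)) (Σ n (λ x → Σ N (points P x)))) (sym (Σ-last n (λ x → Σ N (points P x))))))

  CornerFree : ℕ → (ℕ → ℕ → ℚ) → Set
  CornerFree n A = ∀ x y d → 1 ℕ.≤ d → x ℕ.+ d ℕ.< n → y ℕ.+ d ℕ.< n → A x y * (A (x ℕ.+ d) y * A x (y ℕ.+ d)) ≡ 0ℚ

  -- A ∩ (c - A): corners with negative d become corners with positive d under x ↦ c - x.
  module Symmetrise (n : ℕ) (A : ℕ → ℕ → ℚ) (A-idem : ∀ x → Idempotent (A x)) (free : CornerFree n A) where

    reflected : ℕ → ℕ → ℕ → ℕ → ℚ
    reflected c₁ c₂ x y = shift₂ n x y A c₁ c₂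

    A∩ : ℕ → ℕ → ℕ → ℕ → ℚ
    A∩ c₁ c₂ x y = A x y * reflected c₁ c₂ x y

    private
      reflected-idem : ∀ c₁ c₂ x → Idempotent (reflected c₁ c₂ x)
      reflected-idem c₁ c₂ x y = idem-shift n x {λ x′ → shift n y (A x′) c₂} (λ x′ → idem-shift n y (A-idem x′) c₂) c₁

      free′ : ∀ {x y x′ y′} → x ℕ.< n → x′ ℕ.< n → y ℕ.< n → y′ ℕ.< n → x ℕ.< x′ → x′ ℕ.+ y ≡ x ℕ.+ y′ →
        A x y * (A x′ y * A x y′) ≡ 0ℚ
      free′ {x} {y} {x′} {y′} x<n x′<n y<n y′<n x<x′ h = subst₂ (λ p q → A x y * (A p y * A x q) ≡ 0ℚ) x≡ y≡
        (free x y d (ℕP.m<n⇒0<n∸m x<x′) (subst (ℕ._< n) (sym x≡) x′<n) (subst (ℕ._< n) (sym y≡) y′<n))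
        where
        d : ℕ
        d = x′ ℕ.∸ x
        x≡ : x ℕ.+ d ≡ x′
        x≡ = ℕP.m+[n∸m]≡n (ℕP.<⇒≤ x<x′)
        y≡ : y ℕ.+ d ≡ y′
        y≡ = ℕP.+-cancelˡ-≡ x (y ℕ.+ d) y′ (trans (rearr x y d) (trans (cong (ℕ._+ y) x≡) h))
          where
          rearr : ∀ x y d → x ℕ.+ (y ℕ.+ d) ≡ (x ℕ.+ d) ℕ.+ y
          rearr = ℕ-solve-∀

      reflected-value : ∀ {c₁ c₂ x y} → reflected c₁ c₂ x y ≡ 0ℚ ⊎
        ∃ λ p → ∃ λ q → p ℕ.< n × q ℕ.< n × c₁ ≡ x ℕ.+ p × c₂ ≡ y ℕ.+ q
      reflected-value {c₁} {c₂} {x} {y} with shift-view n x (λ x′ → shift n y (A x′) c₂) c₁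
      ... | outside eq = inj₁ (eq _)
      ... | inside p p<n hp eq with shift-view n y (A p) c₂
      ...   | outside eq′ = inj₁ (trans eq (eq′ (A p)))
      ...   | inside q q<n hq _ = inj₂ (p , q , p<n , q<n , hp , hq)

      reflected-at : ∀ {c₁ c₂ x y p q} → p ℕ.< n → q ℕ.< n → c₁ ≡ x ℕ.+ p → c₂ ≡ y ℕ.+ q → reflected c₁ c₂ x y ≡ A p q
      reflected-at {x = x} {y} {p} {q} p<n q<n refl refl = trans
        (shift-inside n x (λ x′ → shift n y (A x′) (y ℕ.+ q)) p p<n) (shift-inside n y (A p) q q<n)

      zero₃ : ∀ a b c {p q r} → p * (q * r) ≡ 0ℚ → (a * p) * ((b * q) * (c * r)) ≡ 0ℚ
      zero₃ a b c {p} {q} {r} h = trans (e a b c p q r) (trans (cong ((a * (b * c)) *_) h) (ℚP.*-zeroʳ (a * (b * c))))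
        where
        e : ∀ a b c p q r → (a * p) * ((b * q) * (c * r)) ≡ (a * (b * c)) * (p * (q * r))
        e = solve-∀ ℚring

      zero₃′ : ∀ {a b c} p q r → a * (b * c) ≡ 0ℚ → (a * p) * ((b * q) * (c * r)) ≡ 0ℚ
      zero₃′ {a} {b} {c} p q r h = trans (e a b c p q r) (trans (cong (_* (p * (q * r))) h) (ℚP.*-zeroˡ (p * (q * r))))
        where
        e : ∀ a b c p q r → (a * p) * ((b * q) * (c * r)) ≡ (a * (b * c)) * (p * (q * r))
        e = solve-∀ ℚring

      no-corner : ∀ c₁ c₂ {x y x′ y′} → x ℕ.< n → y ℕ.< n → x′ ℕ.< n → y′ ℕ.< n → x ≢ x′ → x′ ℕ.+ y ≡ x ℕ.+ y′ →
        A∩ c₁ c₂ x y * (A∩ c₁ c₂ x′ y * A∩ c₁ c₂ x y′) ≡ 0ℚ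
      no-corner c₁ c₂ {x} {y} {x′} {y′} x<n y<n x′<n y′<n x≢x′ h with ℕP.<-cmp x x′
      ... | tri≈ _ x≡x′ _ = ⊥-elim (x≢x′ x≡x′)
      ... | tri< x<x′ _ _ = zero₃′ {A x y} {A x′ y} {A x y′} (reflected c₁ c₂ x y) (reflected c₁ c₂ x′ y) (reflected c₁ c₂ x y′) (free′ x<n x′<n y<n y′<n x<x′ h)
      ... | tri> _ _ x′<x = zero₃ (A x y) (A x′ y) (A x y′) (corner (reflected-value {c₁} {c₂} {x′} {y}) (reflected-value {c₁} {c₂} {x} {y′}))
        where
        R = reflected c₁ c₂
        corner : R x′ y ≡ 0ℚ ⊎ (∃ λ p → ∃ λ q → p ℕ.< n × q ℕ.< n × c₁ ≡ x′ ℕ.+ p × c₂ ≡ y ℕ.+ q) →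
          R x y′ ≡ 0ℚ ⊎ (∃ λ p → ∃ λ q → p ℕ.< n × q ℕ.< n × c₁ ≡ x ℕ.+ p × c₂ ≡ y′ ℕ.+ q) → R x y * (R x′ y * R x y′) ≡ 0ℚ
        corner (inj₁ eq) _ = trans (cong (λ t → R x y * (t * R x y′)) eq) (trans (cong (R x y *_) (ℚP.*-zeroˡ (R x y′))) (ℚP.*-zeroʳ (R x y)))
        corner (inj₂ _) (inj₁ eq) = trans (cong (λ t → R x y * (R x′ y * t)) eq) (trans (cong (R x y *_) (ℚP.*-zeroʳ (R x′ y))) (ℚP.*-zeroʳ (R x y)))
        corner (inj₂ (p′ , q , p′<n , q<n , hp′ , hq)) (inj₂ (p , q′ , p<n , q′<n , hp , hq′)) = trans
          (cong₂ _*_ (reflected-at p<n q<n hp hq) (cong₂ _*_ (reflected-at p′<n q<n hp′ hq) (reflected-at p<n q′<n hp hq′)))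
          (free′ p<n p′<n q<n q′<n p<p′ sum≡)
          where
          p<p′ : p ℕ.< p′
          p<p′ = ℕP.+-cancelˡ-< x p p′ (subst (ℕ._< x ℕ.+ p′) (trans (sym hp′) hp) (ℕP.+-monoˡ-< p′ x′<x))
          sum≡ : p′ ℕ.+ q ≡ p ℕ.+ q′
          sum≡ = ℕP.+-cancelˡ-≡ (x′ ℕ.+ y) (p′ ℕ.+ q) (p ℕ.+ q′) (trans (rearr x′ y p′ q)
            (trans (cong₂ ℕ._+_ (trans (sym hp′) hp) (trans (sym hq) hq′)) (trans (sym (rearr x y′ p q′)) (cong (ℕ._+ (p ℕ.+ q′)) (sym h)))))
            where
            rearr : ∀ a b p q → a ℕ.+ b ℕ.+ (p ℕ.+ q) ≡ (a ℕ.+ p) ℕ.+ (b ℕ.+ q)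
            rearr = ℕ-solve-∀

    state : ∀ c₁ c₂ → State n (A∩ c₁ c₂) (λ _ → 1ℚ) (λ _ → 1ℚ)
    state c₁ c₂ = record
      { A-idem = λ x y → idem-* (A-idem x y) (reflected-idem c₁ c₂ x y)
      ; E-idem = λ _ → refl
      ; F-idem = λ _ → refl
      ; A⊆E×F = λ x y → ℚP.*-identityʳ (A∩ c₁ c₂ x y)
      ; no-corner = no-corner c₁ c₂
      }

    private
      m : ℕ
      m = n ℕ.+ n
      total : Σ m (λ c₁ → Σ m (λ c₂ → size₂ n (A∩ c₁ c₂))) ≡ size₂ n A * size₂ n A
      total = trans (Σ-swap-pairs m m n n (λ c₁ c₂ x y → A∩ c₁ c₂ x y))
        (trans (Σ-cong< n (λ x x<n → Σ-cong< n (λ y y<n → one x y x<n y<n)))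
          (trans (Σ-cong n (λ x → Σ-*ʳ n (size₂ n A) (A x))) (Σ-*ʳ n (size₂ n A) (λ x → Σ n (A x)))))
        where
        one : ∀ x y → x ℕ.< n → y ℕ.< n → Σ m (λ c₁ → Σ m (λ c₂ → A∩ c₁ c₂ x y)) ≡ A x y * size₂ n A
        one x y x<n y<n = trans (Σ-cong m (λ c₁ → Σ-* m (A x y) (λ c₂ → reflected c₁ c₂ x y)))
          (trans (Σ-* m (A x y) (λ c₁ → Σ m (λ c₂ → reflected c₁ c₂ x y))) (cong (A x y *_)
            (trans (Σ-swap m m (λ c₁ c₂ → reflected c₁ c₂ x y))
              (trans (Σ-cong m (λ c₂ → Σ-shift₁ m n x (λ x′ → shift n y (A x′) c₂) (ℕP.+-monoˡ-≤ n (ℕP.<⇒≤ x<n))))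
                (trans (Σ-swap m n (λ c₂ x′ → shift n y (A x′) c₂))
                  (Σ-cong n (λ x′ → Σ-shift₁ m n y (A x′) (ℕP.+-monoˡ-≤ n (ℕP.<⇒≤ y<n)))))))))

    -- The sets A ∩ (c - A) have total size |A|² ≥ δ²n⁴ over (2n)² centres c, so δ²n²/4 on average;
    -- the 8 in place of 4 gives the contradiction its slack.
    some-symmetrisation : ∀ δ → 0ℚ < ι n → 0ℚ < δ → δ * (ι n * ι n) ≤ size₂ n A →
      (∀ c₁ c₂ → ι 8 * size₂ n (A∩ c₁ c₂) ≤ (δ * δ) * (ι n * ι n)) → ⊥
    some-symmetrisation δ 0<N 0<δ dense small =
      <⇒≱ (*-pos (*-pos 0<δ 0<δ) (*-pos (*-pos 0<N 0<N) (*-pos 0<N 0<N)))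
        (arith (size₂ n A) (ι n) (≤-*-nonneg (ℚP.<⇒≤ 0<δ) (sq≥0 (ι n))) dense
          (subst₂ _≤_ (trans (scaled 8 (λ (c₁ , c₂) → size₂ n (A∩ c₁ c₂))) (cong (ι 8 *_) total)) (cong (λ t → t * (t * ((δ * δ) * (ι n * ι n)))) (ι-+ n n))
            (Σ-≤-const m (λ c₁ _ → Σ-≤-const m (λ c₂ _ → small c₁ c₂)))))
      where
      scaled : ∀ k (f : ℕ × ℕ → ℚ) → Functional.∫ (range m ⊗ range m) (λ c → ι k * f c) ≡ ι k * Functional.∫ (range m ⊗ range m) f
      scaled k = Functional.∫-* (range m ⊗ range m) (ι k)
      arith : ∀ a N → 0ℚ ≤ δ * (N * N) → δ * (N * N) ≤ a → ι 8 * (a * a) ≤ (N + N) * ((N + N) * ((δ * δ) * (N * N))) →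
        (δ * δ) * ((N * N) * (N * N)) ≤ 0ℚ
      arith a N h₀ h₁ h₂ = *-cancel-≤ (ι 4) (0<ι 3) (lin (0≤ι 8 ⊙ sq-mono h₀ h₁ ⊕ h₂) (eq a N δ))
        where
        eq : ∀ a N δ → ι 4 * 0ℚ + (ι 8 * ((δ * (N * N)) * (δ * (N * N))) + ι 8 * (a * a))
           ≡ ι 4 * ((δ * δ) * ((N * N) * (N * N))) + (ι 8 * (a * a) + (N + N) * ((N + N) * ((δ * δ) * (N * N))))
        eq = solve-∀ ℚring

  -- Corners with d = 1 suffice here.
  module VeryDense (n : ℕ) (A : ℕ → ℕ → ℚ) (A-idem : ∀ x → Idempotent (A x)) (free : CornerFree (suc n) A) where

    private
      A≤1 : ∀ x y → A x y ≤ 1ℚ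
      A≤1 x y = idem≤1 (A-idem x y)

      -- By 2 - a - b - c + abc = (1 - a)(1 - b) + (1 - c)(1 - ab).
      at-most-two : ∀ {a b c} → a * a ≡ a → b * b ≡ b → c * c ≡ c → a * (b * c) ≡ 0ℚ → a + (b + c) ≤ ι 2
      at-most-two {a} {b} {c} a² b² c² h = lin
        (≤-*-nonneg {1ℚ - a} {1ℚ - b} (0≤idem (idem-complement a²)) (0≤idem (idem-complement b²))
          ⊕ ≤-*-nonneg {1ℚ - c} {1ℚ - a * b} (0≤idem (idem-complement c²)) (0≤idem (idem-complement (idem-* a² b²))) ⊕ ℚP.≤-reflexive h)
        (eq a b c)
        where
        eq : ∀ a b c → ι 2 + (0ℚ + (0ℚ + a * (b * c))) ≡ a + (b + c) + ((1ℚ - a) * (1ℚ - b) + ((1ℚ - c) * (1ℚ - a * b) + 0ℚ))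
        eq = solve-∀ ℚring

      N S₀ S₁ S₂ : ℚ
      N = ι n
      S₀ = Σ n (λ x → Σ n (λ y → A x y))
      S₁ = Σ n (λ x → Σ n (λ y → A (suc x) y))
      S₂ = Σ n (λ x → Σ n (λ y → A x (suc y)))

      row : ∀ k x → Σ k (A x) ≤ ι k
      row k x = subst (Σ k (A x) ≤_) (ℚP.*-identityʳ (ι k)) (Σ-≤-const k (λ y _ → A≤1 x y))
      column : ∀ (f : ℕ → ℕ) y → Σ n (λ x → A (f x) y) ≤ N
      column f y = subst (Σ n (λ x → A (f x) y) ≤_) (ℚP.*-identityʳ N) (Σ-≤-const n (λ x _ → A≤1 (f x) y))

      drop-last : ∀ f → Σ n (λ x → Σ (suc n) (A (f x))) ≤ Σ n (λ x → Σ n (A (f x))) + N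
      drop-last f = subst (_≤ Σ n (λ x → Σ n (A (f x))) + N)
        (sym (trans (Σ-cong n (λ x → Σ-last n (A (f x)))) (Σ-+ n (λ x → Σ n (A (f x))) (λ x → A (f x) n))))
        (ℚP.≤-refl {Σ n (λ x → Σ n (A (f x)))} ⊕ column f n)
      drop-first : Σ n (λ x → Σ (suc n) (A x)) ≤ N + S₂
      drop-first = subst (_≤ N + S₂) (sym (Σ-+ n (λ x → A x 0) (λ x → Σ n (λ y → A x (suc y))))) (column (λ x → x) 0 ⊕ ℚP.≤-refl {S₂})

      a : ℚ
      a = size₂ (suc n) A
      a≤₀ : a ≤ S₀ + N + ι (suc n)
      a≤₀ = subst (_≤ S₀ + N + ι (suc n)) (sym (Σ-last n (λ x → Σ (suc n) (A x)))) (drop-last (λ x → x) ⊕ row (suc n) n)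
      a≤₁ : a ≤ ι (suc n) + (S₁ + N)
      a≤₁ = row (suc n) 0 ⊕ drop-last suc
      a≤₂ : a ≤ N + S₂ + ι (suc n)
      a≤₂ = subst (_≤ N + S₂ + ι (suc n)) (sym (Σ-last n (λ x → Σ (suc n) (A x)))) (drop-first ⊕ row (suc n) n)

      corners : S₀ + (S₁ + S₂) ≤ N * (N * ι 2)
      corners = subst (_≤ N * (N * ι 2)) (trans (I.∫-+ (λ (x , y) → A x y) (λ (x , y) → A (suc x) y + A x (suc y)))
          (cong (λ t → S₀ + t) (I.∫-+ (λ (x , y) → A (suc x) y) (λ (x , y) → A x (suc y)))))
        (Σ-≤-const n (λ x x<n → Σ-≤-const n (λ y y<n → at-most-two (A-idem x y) (A-idem (suc x) y) (A-idem x (suc y))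
          (subst₂ (λ p q → A x y * (A p y * A x q) ≡ 0ℚ) (ℕP.+-comm x 1) (ℕP.+-comm y 1)
            (free x y 1 ℕP.≤-refl (subst (ℕ._< suc n) (ℕP.+-comm 1 x) (s≤s x<n)) (subst (ℕ._< suc n) (ℕP.+-comm 1 y) (s≤s y<n)))))))
        where module I = Functional (range n ⊗ range n)

    -- Each of the three translates misses at most 2n + 1 points, so 3|A| ≤ 2n² + 3(2n + 1), which
    -- is less than (9/4)(n + 1)² once n ≥ 8.
    dense-impossible : ι 8 ≤ ι n → ι 3 * (ι (suc n) * ι (suc n)) ≤ ι 4 * size₂ (suc n) A → ⊥
    dense-impossible 8≤n dense = <⇒≱ (0<ι 0)
      (arith N a S₀ S₁ S₂ 8≤n (subst (λ t → ι 3 * (t * t) ≤ ι 4 * a) (ι-suc n) dense) (subst (λ t → a ≤ S₀ + N + t) (ι-suc n) a≤₀)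
        (subst (λ t → a ≤ t + (S₁ + N)) (ι-suc n) a≤₁) (subst (λ t → a ≤ N + S₂ + t) (ι-suc n) a≤₂) corners)
      where
      arith : ∀ N a S₀ S₁ S₂ → ι 8 ≤ N → ι 3 * ((1ℚ + N) * (1ℚ + N)) ≤ ι 4 * a → a ≤ S₀ + N + (1ℚ + N) → a ≤ 1ℚ + N + (S₁ + N) →
        a ≤ N + S₂ + (1ℚ + N) → S₀ + (S₁ + S₂) ≤ N * (N * ι 2) → 1ℚ ≤ 0ℚ
      arith N a S₀ S₁ S₂ h₀ h₁ h₂ h₃ h₄ h₅ = *-cancel-≤ (ι 13) (0<ι 12)
        (lin (0≤ι 3 ⊙ h₁ ⊕ 0≤ι 4 ⊙ h₂ ⊕ 0≤ι 4 ⊙ h₃ ⊕ 0≤ι 4 ⊙ h₄ ⊕ 0≤ι 4 ⊙ h₅ ⊕ ℚP.≤-trans (0≤ι 8) h₀ ⊙ h₀ ⊕ 0≤ι 2 ⊙ h₀)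
          (solve (N ∷ a ∷ S₀ ∷ S₁ ∷ S₂ ∷ []) ℚring))

  -- Partial sums of the exponential series and the lower bound for N.

  recip : ℕ → ℚ
  recip k = ℚ.fromℚᵘ (+ 1 ℚᵘ./ suc k)

  ι*recip : ∀ k → ι (suc k) * recip k ≡ 1ℚ
  ι*recip k = ℚP.toℚᵘ-injective (ℚᵘP.≃-trans (ℚP.toℚᵘ-homo-* (ι (suc k)) (recip k))
    (ℚᵘP.≃-trans (ℚᵘP.*-congˡ {ℚ.toℚᵘ (ι (suc k))} (ℚP.toℚᵘ-fromℚᵘ (+ 1 ℚᵘ./ suc k)))
      (ℚᵘP.*-inverseʳ (ℚ.toℚᵘ (ι (suc k))))))

  -- A copy of `expTerm` in normalised rationals, where propositional equality and the ring solver
  -- are available; `term-homo` carries the results back.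
  term : ℚ → ℕ → ℚ
  term x zero    = 1ℚ
  term x (suc k) = (term x k * x) * recip k

  partialSum : ℚ → ℕ → ℚ
  partialSum x zero    = 1ℚ
  partialSum x (suc n) = partialSum x n + term x (suc n)

  term-homo : ∀ x y → ℚ.toℚᵘ x ℚᵘ.≃ y → ∀ k → ℚ.toℚᵘ (term x k) ℚᵘ.≃ expTerm y k
  term-homo x y h zero    = ℚᵘP.≃-refl
  term-homo x y h (suc k) = ℚᵘP.≃-trans (ℚP.toℚᵘ-homo-* (term x k * x) (recip k))
    (ℚᵘP.*-cong (ℚᵘP.≃-trans (ℚP.toℚᵘ-homo-* (term x k) x) (ℚᵘP.*-cong (term-homo x y h k) h)) (ℚP.toℚᵘ-fromℚᵘ (+ 1 ℚᵘ./ suc k)))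

  partialSum-homo : ∀ x y → ℚ.toℚᵘ x ℚᵘ.≃ y → ∀ n → ℚ.toℚᵘ (partialSum x n) ℚᵘ.≃ expPartial y n
  partialSum-homo x y h zero    = ℚᵘP.≃-refl
  partialSum-homo x y h (suc n) = ℚᵘP.≃-trans (ℚP.toℚᵘ-homo-+ (partialSum x n) (term x (suc n)))
    (ℚᵘP.+-cong (partialSum-homo x y h n) (term-homo x y h (suc n)))

  0<recip : ∀ k → 0ℚ < recip k
  0<recip k with ≤-or-> (recip k) 0ℚ
  ... | inj₂ h = h
  ... | inj₁ h = ⊥-elim (<⇒≱ (0<ι 0) (subst₂ _≤_ (ι*recip k) (ℚP.*-zeroʳ (ι (suc k))) (0≤ι (suc k) ⊙ h)))

  0≤term : ∀ {x} → 0ℚ ≤ x → ∀ k → 0ℚ ≤ term x k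
  0≤term 0≤x zero    = 0≤1
  0≤term 0≤x (suc k) = ≤-*-nonneg (≤-*-nonneg (0≤term 0≤x k) 0≤x) (ℚP.<⇒≤ (0<recip k))

  term-mono : ∀ {x y} → 0ℚ ≤ x → x ≤ y → ∀ k → term x k ≤ term y k
  term-mono 0≤x x≤y zero    = ℚP.≤-refl
  term-mono {x} {y} 0≤x x≤y (suc k) = *-mono-nonneg (≤-*-nonneg (0≤term 0≤x k) 0≤x) 0≤v
    (*-mono-nonneg (0≤term 0≤x k) (ℚP.≤-trans 0≤x x≤y) (term-mono 0≤x x≤y k) x≤y) ℚP.≤-refl
    where 0≤v = ℚP.<⇒≤ (0<recip k)

  partialSum-mono : ∀ {x y} → 0ℚ ≤ x → x ≤ y → ∀ n → partialSum x n ≤ partialSum y n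
  partialSum-mono 0≤x x≤y zero    = ℚP.≤-refl
  partialSum-mono 0≤x x≤y (suc n) = partialSum-mono 0≤x x≤y n ⊕ term-mono 0≤x x≤y (suc n)

  -- (x + 1)ᵏ⁺¹ ≥ xᵏ⁺¹ + (k + 1) xᵏ, divided by (k + 1)!
  term-successor : ∀ {x} → 0ℚ ≤ x → ∀ k → term x (suc k) + term x k ≤ term (x + 1ℚ) (suc k)
  term-successor {x} 0≤x zero = lin (ℚP.≤-reflexive (sym (ι*recip 0))) (e x (recip 0))
    where
    e : ∀ x v → (1ℚ * (x + 1ℚ)) * v + 1ℚ ≡ (1ℚ * x) * v + 1ℚ + ι 1 * v
    e = solve-∀ ℚring
  term-successor {x} 0≤x (suc j) = arith (term x (suc j)) (term x j) (term (x + 1ℚ) (suc j)) x (recip (suc j)) (ι j)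
    (0≤term 0≤x (suc j)) (0≤term 0≤x j) 0≤x (ℚP.<⇒≤ (0<recip (suc j))) ratio
    (subst (λ t → t * recip (suc j) ≡ 1ℚ) (trans (ι-suc (suc j)) (cong (λ t → 1ℚ + t) (ι-suc j))) (ι*recip (suc j)))
    (term-successor 0≤x j)
    where
    ratio : (1ℚ + ι j) * term x (suc j) ≡ term x j * x
    ratio = trans (cong (_* ((term x j * x) * recip j)) (sym (ι-suc j))) (trans (e (ι (suc j)) (term x j * x) (recip j))
      (trans (cong ((term x j * x) *_) (ι*recip j)) (ℚP.*-identityʳ (term x j * x))))
      where
      e : ∀ n y v → n * (y * v) ≡ y * (n * v)
      e = solve-∀ ℚring
    arith : ∀ A B C x v j → 0ℚ ≤ A → 0ℚ ≤ B → 0ℚ ≤ x → 0ℚ ≤ v → (1ℚ + j) * A ≡ B * x → (1ℚ + (1ℚ + j)) * v ≡ 1ℚ →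
      A + B ≤ C → (A * x) * v + A ≤ (C * (x + 1ℚ)) * v
    arith A B C x v j 0≤A 0≤B 0≤x 0≤v h₁ h₂ h₃ = lin
      (≤-*-nonneg (≤-+-nonneg 0≤x 0≤1) 0≤v ⊙ h₃ ⊕ 0≤v ⊙ ℚP.≤-reflexive h₁ ⊕ 0≤A ⊙ ℚP.≤-reflexive (sym h₂) ⊕ ≤-*-nonneg 0≤B 0≤v)
      (solve (A ∷ B ∷ C ∷ x ∷ v ∷ j ∷ []) ℚring)

  -- A truncated form of eˣ⁺¹ ≥ 2eˣ, obtained term by term. Iterated, it compares eᵐ with 2ᵐ at the
  -- level of finite sums.
  partialSum-successor : ∀ {x} → 0ℚ ≤ x → ∀ n → partialSum x (suc n) + partialSum x n ≤ partialSum (x + 1ℚ) (suc n)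
  partialSum-successor {x} 0≤x zero = lin (term-successor 0≤x 0) (e (term x 1) (term (x + 1ℚ) 1))
    where
    e : ∀ t u → 1ℚ + u + (t + 1ℚ) ≡ 1ℚ + t + 1ℚ + u
    e = solve-∀ ℚring
  partialSum-successor {x} 0≤x (suc n) = lin (partialSum-successor 0≤x n ⊕ term-successor 0≤x (suc n))
    (e (partialSum x (suc n)) (partialSum x n) (term x (suc (suc n))) (term x (suc n)) (partialSum (x + 1ℚ) (suc n)) (term (x + 1ℚ) (suc (suc n))))
    where
    e : ∀ s s′ t t′ S T → S + T + (s + s′ + (t + t′)) ≡ s + t + (s′ + t′) + (S + T)
    e = solve-∀ ℚring

  1≤partialSum : ∀ {x} → 0ℚ ≤ x → ∀ n → 1ℚ ≤ partialSum x n
  1≤partialSum 0≤x zero    = ℚP.≤-refl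
  1≤partialSum {x} 0≤x (suc n) = lin (1≤partialSum 0≤x n ⊕ 0≤term 0≤x (suc n)) (e (partialSum x n) (term x (suc n)))
    where
    e : ∀ s t → s + t + (1ℚ + 0ℚ) ≡ 1ℚ + (s + t)
    e = solve-∀ ℚring

  2^≤partialSum : ∀ m n → m ℕ.≤ n → ι (2 ℕ.^ m) ≤ partialSum (ι m) n
  2^≤partialSum zero    n       _         = 1≤partialSum (0≤ι 0) n
  2^≤partialSum (suc m) (suc n) (s≤s m≤n) = subst₂ _≤_ (sym double) (cong (λ t → partialSum t (suc n)) (trans (ℚP.+-comm (ι m) 1ℚ) (sym (ι-suc m))))
    (ℚP.≤-trans (2^≤partialSum m (suc n) (ℕP.m≤n⇒m≤1+n m≤n) ⊕ 2^≤partialSum m n m≤n) (partialSum-successor (0≤ι m) n))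
    where
    double : ι (2 ℕ.^ suc m) ≡ ι (2 ℕ.^ m) + ι (2 ℕ.^ m)
    double = trans (cong ι (cong (2 ℕ.^ m ℕ.+_) (ℕP.+-identityʳ (2 ℕ.^ m)))) (ι-+ (2 ℕ.^ m) (2 ℕ.^ m))

  ι-mono-< : ∀ {m n} → m ℕ.< n → ι m < ι n
  ι-mono-< {m} {n} m<n = ℚP.<-≤-trans (lin< {ι m} {1ℚ + ι m} (0<ι 0) (e (ι m))) (subst (_≤ ι n) (ι-suc m) (ι-mono m<n))
    where
    e : ∀ x → 1ℚ + x + 0ℚ ≡ x + 1ℚ
    e = solve-∀ ℚring

  ι-cancel-≤ : ∀ {m n} → ι m ≤ ι n → m ℕ.≤ n
  ι-cancel-≤ h = ℕP.≮⇒≥ (λ n<m → <⇒≱ (ι-mono-< n<m) h)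

  module Tower {x : ℚ} {y} (x≃y : ℚ.toℚᵘ x ℚᵘ.≃ y) {N : ℕ} (tower : Tower3Le y N) where

    private
      LtExp-from : ∀ a {z w} → ℚ.toℚᵘ z ℚᵘ.≃ w → ∀ n → ι a < partialSum z n → LtExp (ℚ.toℚᵘ (ι a)) w
      LtExp-from a {z} {w} h n lt = n , ℚᵘP.<-respʳ-≃ (partialSum-homo z w h n) (ℚP.toℚᵘ-mono-< lt)

      0≤toℚᵘ : ∀ a → ℚᵘ.0ℚᵘ ℚᵘ.≤ ℚ.toℚᵘ (ι a)
      0≤toℚᵘ a = ℚP.toℚᵘ-mono-≤ (0≤ι a)

    exp-bound : ∀ a b n₁ n₂ n₃ → ι a < partialSum x n₁ → ι b < partialSum (ι a) n₂ → partialSum (ι b) n₃ ≤ ι N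
    exp-bound a b n₁ n₂ n₃ h₁ h₂ = ℚP.toℚᵘ-cancel-≤ (ℚᵘP.≤-respˡ-≃ (ℚᵘP.≃-sym (partialSum-homo (ι b) (ℚ.toℚᵘ (ι b)) ℚᵘP.≃-refl n₃))
      (tower (ℚ.toℚᵘ (ι b)) (ℚ.toℚᵘ (ι a)) (0≤toℚᵘ b) (0≤toℚᵘ a) (LtExp-from a x≃y n₁ h₁) (LtExp-from b ℚᵘP.≃-refl n₂ h₂) n₃))

    2^-bound : ∀ a b n₁ n₂ → ι a < partialSum x n₁ → ι b < partialSum (ι a) n₂ → 2 ℕ.^ b ℕ.≤ N
    2^-bound a b n₁ n₂ h₁ h₂ = ι-cancel-≤ (ℚP.≤-trans (2^≤partialSum b b ℕP.≤-refl) (exp-bound a b n₁ n₂ b h₁ h₂))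

    -- With integers at the inner levels: 2 < S₂(1) = 5/2, 6 < S₄(2) = 7 and 2⁶ = 64.
    64≤N : 1ℚ ≤ x → 64 ℕ.≤ N
    64≤N 1≤x = 2^-bound 2 6 2 4 (ℚP.<-≤-trans (toWitness {a? = ι 2 ℚP.<? partialSum 1ℚ 2} _) (partialSum-mono 0≤1 1≤x 2))
      (toWitness {a? = ι 6 ℚP.<? partialSum (ι 2) 4} _)

    -- `LtExp` is strict, so each inner level gives up one: `suc X` at the bottom and `∸ 1` in the
    -- second exponent.
    triple-exponential : ∀ X → ι (suc X) ≤ x → 2 ℕ.^ (2 ℕ.^ (2 ℕ.^ X ℕ.∸ 1)) ℕ.≤ N
    triple-exponential X X<x = 2^-bound a b (suc X) a
        (ℚP.<-≤-trans (ι-mono-< (ℕP.^-monoʳ-< 2 ℕP.≤-refl (ℕP.n<1+n X)))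
          (ℚP.≤-trans (2^≤partialSum (suc X) (suc X) ℕP.≤-refl) (partialSum-mono (0≤ι (suc X)) X<x (suc X))))
        (ℚP.<-≤-trans (ι-mono-< (ℕP.^-monoʳ-< 2 ℕP.≤-refl (ℕP.≤-reflexive (ℕP.m+[n∸m]≡n {1} {a} (ℕP.m^n>0 2 X)))))
          (2^≤partialSum a a ℕP.≤-refl))
      where
      a b : ℕ
      a = 2 ℕ.^ X
      b = 2 ℕ.^ (a ℕ.∸ 1)

  ≤-frac : ∀ X a b → 1 ℕ.≤ b → X ℕ.* b ℕ.≤ a → ι X ≤ ℚ.fromℚᵘ (frac a b)
  ≤-frac X a (suc b) _ h = ℚP.toℚᵘ-cancel-≤ (ℚᵘP.≤-respʳ-≃ (ℚᵘP.≃-sym (ℚP.toℚᵘ-fromℚᵘ (frac a (suc b))))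
    (ℚᵘ.*≤* (subst₂ ℤ._≤_ (ℤP.pos-* X (suc b)) (sym (ℤP.*-identityʳ (+ a))) (ℤ.+≤+ h))))

  -- The constants as powers of two, and the size of the resulting tower.

  half^ : ℕ → ℚ
  half^ zero    = 1ℚ
  half^ (suc n) = ℚ.½ * half^ n

  half^-+ : ∀ m n → half^ (m ℕ.+ n) ≡ half^ m * half^ n
  half^-+ zero    n = sym (ℚP.*-identityˡ (half^ n))
  half^-+ (suc m) n = trans (cong (ℚ.½ *_) (half^-+ m n)) (sym (ℚP.*-assoc ℚ.½ (half^ m) (half^ n)))

  0<half^ : ∀ n → 0ℚ < half^ n
  0<half^ zero    = 0<ι 0
  0<half^ (suc n) = *-pos (ℚP.positive⁻¹ ℚ.½) (0<half^ n)

  half^≤1 : ∀ n → half^ n ≤ 1ℚ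
  half^≤1 zero    = ℚP.≤-refl
  half^≤1 (suc n) = lin (half^≤1 n ⊕ ℚP.<⇒≤ (0<half^ (suc n))) (e (half^ n))
    where
    e : ∀ x → 1ℚ + (x + 0ℚ) ≡ ℚ.½ * x + (1ℚ + ℚ.½ * x)
    e = solve-∀ ℚring

  ι-2^ : ∀ n → ι (2 ℕ.^ suc n) ≡ ι 2 * ι (2 ℕ.^ n)
  ι-2^ n = ι-* 2 (2 ℕ.^ n)

  2^*half^ : ∀ n → ι (2 ℕ.^ n) * half^ n ≡ 1ℚ
  2^*half^ zero    = refl
  2^*half^ (suc n) = trans (cong (_* half^ (suc n)) (ι-2^ n)) (trans (e (ι (2 ℕ.^ n)) (half^ n)) (2^*half^ n))
    where
    e : ∀ x y → (ι 2 * x) * (ℚ.½ * y) ≡ x * y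
    e = solve-∀ ℚring

  ι-2^-+ : ∀ m n → ι (2 ℕ.^ (m ℕ.+ n)) ≡ ι (2 ℕ.^ m) * ι (2 ℕ.^ n)
  ι-2^-+ m n = trans (cong ι (ℕP.^-distribˡ-+-* 2 m n)) (ι-* (2 ℕ.^ m) (2 ℕ.^ n))

  1≤ι-2^ : ∀ n → 1ℚ ≤ ι (2 ℕ.^ n)
  1≤ι-2^ n = ι-mono (ℕP.m^n>0 2 n)

  fourfold : ℕ → ℕ
  fourfold n = (n ℕ.+ n) ℕ.+ (n ℕ.+ n)

  half^-fourfold : ∀ n → half^ (fourfold n) ≡ fourth (half^ n)
  half^-fourfold n = trans (half^-+ (n ℕ.+ n) (n ℕ.+ n)) (cong₂ _*_ (half^-+ n n) (half^-+ n n))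

  -- The exponents of 2 that appear when the density is at least 2⁻ᵏ, as a record so
  -- that powers such as 2 ^ b stay symbolic.
  record Exponents (k : ℕ) : Set where
    field
      a b K e ρ g β : ℕ
      a≡ : a ≡ 4 ℕ.+ (k ℕ.+ k)
      b≡ : b ≡ 13 ℕ.+ (fourfold a ℕ.+ fourfold a)
      K≡ : K ≡ 2 ℕ.^ b
      e≡ : e ≡ suc (a ℕ.+ K ℕ.* suc b)
      ρ≡ : ρ ≡ 12 ℕ.+ ((fourfold a ℕ.+ fourfold a) ℕ.+ fourfold e)
      g≡ : g ≡ 6 ℕ.+ (e ℕ.+ (ρ ℕ.+ ρ))
      β≡ : β ≡ 9 ℕ.+ (g ℕ.+ (a ℕ.+ e))

    X : ℕ
    X = β ℕ.+ (b ℕ.+ g ℕ.+ 5)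

  exponents : ∀ k → Exponents k
  exponents k = from (4 ℕ.+ (k ℕ.+ k)) refl
    where
    from : ∀ a → a ≡ 4 ℕ.+ (k ℕ.+ k) → Exponents k
    from a a≡ = record
      { a = a ; b = b ; K = 2 ℕ.^ b ; e = e ; ρ = ρ ; g = g ; β = 9 ℕ.+ (g ℕ.+ (a ℕ.+ e))
      ; a≡ = a≡ ; b≡ = refl ; K≡ = refl ; e≡ = refl ; ρ≡ = refl ; g≡ = refl ; β≡ = refl }
      where
      b e ρ g : ℕ
      b = 13 ℕ.+ (fourfold a ℕ.+ fourfold a)
      e = suc (a ℕ.+ 2 ℕ.^ b ℕ.* suc b)
      ρ = 12 ℕ.+ ((fourfold a ℕ.+ fourfold a) ℕ.+ fourfold e)
      g = 6 ℕ.+ (e ℕ.+ (ρ ℕ.+ ρ))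

  module Constants {k : ℕ} (exps : Exponents k) where

    open Exponents exps

    private
      x y z : ℚ
      x = half^ a
      y = half^ e
      z = half^ ρ

      a⁸ : half^ (fourfold a ℕ.+ fourfold a) ≡ fourth x * fourth x
      a⁸ = trans (half^-+ (fourfold a) (fourfold a)) (cong₂ _*_ (half^-fourfold a) (half^-fourfold a))

      half^b : half^ b ≡ half^ 13 * (fourth x * fourth x)
      half^b = trans (cong half^ b≡) (trans (half^-+ 13 (fourfold a ℕ.+ fourfold a)) (cong (half^ 13 *_) a⁸))

      half^ρ : z ≡ half^ 12 * ((fourth x * fourth x) * fourth y)
      half^ρ = trans (cong half^ ρ≡) (trans (half^-+ 12 ((fourfold a ℕ.+ fourfold a) ℕ.+ fourfold e)) (cong (half^ 12 *_)
        (trans (half^-+ (fourfold a ℕ.+ fourfold a) (fourfold e)) (cong₂ _*_ a⁸ (half^-fourfold e)))))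

      half^g : half^ g ≡ half^ 6 * (y * (z * z))
      half^g = trans (cong half^ g≡) (trans (half^-+ 6 (e ℕ.+ (ρ ℕ.+ ρ))) (cong (half^ 6 *_)
        (trans (half^-+ e (ρ ℕ.+ ρ)) (cong (y *_) (half^-+ ρ ρ)))))

      ι-β : ι (2 ℕ.^ β) ≡ ι 512 * (ι (2 ℕ.^ g) * (ι (2 ℕ.^ a) * ι (2 ℕ.^ e)))
      ι-β = trans (cong (λ n → ι (2 ℕ.^ n)) β≡) (trans (ι-2^-+ 9 (g ℕ.+ (a ℕ.+ e))) (cong (ι 512 *_)
        (trans (ι-2^-+ g (a ℕ.+ e)) (cong (ι (2 ℕ.^ g) *_) (ι-2^-+ a e)))))

    -- The ratio 2^(b+1) is 2/h: after an increment twice the surplus required at the next level is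
    -- left, and the spare copy, at least s = 2κ, covers the energy.
    surplus : ℕ → ℚ
    surplus zero    = y
    surplus (suc k) = ι (2 ℕ.^ suc b) * surplus k

    private
      1≤surplus-ratio : ∀ k → y ≤ surplus k
      1≤surplus-ratio zero    = ℚP.≤-refl
      1≤surplus-ratio (suc k) = subst (_≤ surplus (suc k)) (ℚP.*-identityˡ y)
        (*-mono-nonneg 0≤1 (ℚP.≤-trans (ℚP.<⇒≤ (0<half^ e)) (1≤surplus-ratio k)) (1≤ι-2^ (suc b)) (1≤surplus-ratio k))

      surplus-closed : ∀ k → surplus k ≡ ι (2 ℕ.^ (k ℕ.* suc b)) * y
      surplus-closed zero    = sym (ℚP.*-identityˡ y)
      surplus-closed (suc k) = trans (cong (ι (2 ℕ.^ suc b) *_) (surplus-closed k))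
        (trans (sym (ℚP.*-assoc (ι (2 ℕ.^ suc b)) (ι (2 ℕ.^ (k ℕ.* suc b))) y)) (cong (_* y) (sym (ι-2^-+ (suc b) (k ℕ.* suc b)))))

    -- `e` is chosen so that K growth steps from 2⁻ᵉ end at exactly half the initial density.
    2surplus-K : ι 2 * surplus K ≡ x
    2surplus-K = trans (cong (ι 2 *_) (trans (surplus-closed K) (cong (ι (2 ℕ.^ w) *_) (trans (cong half^ e≡) (cong (ℚ.½ *_) (half^-+ a w))))))
      (trans (eq (ι (2 ℕ.^ w)) (half^ w) x) (trans (cong (_* x) (2^*half^ w)) (ℚP.*-identityˡ x)))
      where
      w : ℕ
      w = K ℕ.* suc b
      eq : ∀ p q x → ι 2 * (p * (ℚ.½ * (x * q))) ≡ (p * q) * x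
      eq = solve-∀ ℚring

    -- For density 2⁻ᵏ, δ₀ = 2⁻ᵃ = 2⁻²ᵏ/16. Each further exponent is dictated by one requirement:
    -- `b` by `η-small`, `e` by the starting surplus after K = 1/h increments, `ρ` by `r-small`, `g`
    -- by `κγ≡2τ`, and `β` by `400≤τB` and `4≤δsB`.
    parameters : Parameters
    parameters = record
      { δ₀ = x ; h = half^ b ; r = z ; κ = ℚ.½ * y ; γ = (z * z) * half^ 4 ; τ = half^ g ; s = y
      ; σ = surplus ; T = 2 ℕ.^ suc g ; B = 2 ℕ.^ β
      ; 0<δ₀ = 0<half^ a
      ; 0<h = 0<half^ b
      ; 0<r = 0<half^ ρ
      ; r≤1 = half^≤1 ρ
      ; 0≤κ = ℚP.<⇒≤ (0<half^ (suc e))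
      ; 4κ≤1 = subst (λ t → ι 4 * (ℚ.½ * half^ t) ≤ 1ℚ) (sym e≡) (lin (half^≤1 (a ℕ.+ K ℕ.* suc b)) (e₁ (half^ (a ℕ.+ K ℕ.* suc b))))
      ; 0<τ = 0<half^ g
      ; τ≤1 = half^≤1 g
      ; 0<s = 0<half^ e
      ; s≤σ = 1≤surplus-ratio
      ; r²≡16γ = e₂ z
      ; κγ≡2τ = trans (e₃ y z) (cong (ι 2 *_) (sym half^g))
      ; η-small = ℚP.≤-reflexive (trans (cong (λ t → ι 4096 * (ι 2 * t)) half^b) (e₄ (fourth x * fourth x)))
      ; r-small = subst (λ t → ι 1024 * (ι 3 * t) < (fourth x * fourth x) * fourth y) (sym half^ρ)
          (lin< (*-pos (ℚP.positive⁻¹ (half^ 2)) (*-pos (*-pos (fourth>0 (0<half^ a)) (fourth>0 (0<half^ a))) (fourth>0 (0<half^ e)))) (e₅ ((fourth x * fourth x) * fourth y)))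
      ; σ-step = λ k → ℚP.≤-trans (lin (1≤surplus-ratio k) (e₆ (surplus k) y))
          (ℚP.≤-reflexive (sym (trans (cong (λ t → half^ b * (t * surplus k)) (ι-2^ b)) (trans (e₇ (half^ b) (ι (2 ℕ.^ b)) (surplus k))
            (trans (cong (λ t → t * (ι 2 * surplus k)) (2^*half^ b)) (ℚP.*-identityˡ (ι 2 * surplus k)))))))
      ; T-large = ℚP.≤-reflexive (sym (trans (cong (_* half^ g) (ι-2^ g)) (trans (ℚP.*-assoc (ι 2) (ι (2 ℕ.^ g)) (half^ g)) (cong (ι 2 *_) (2^*half^ g)))))
      ; 1≤B = ℕP.m^n>0 2 β
      ; 400≤τB = subst (λ t → ι 400 ≤ half^ g * t) (sym ι-β)
          (arith₁ (half^ g) (ι (2 ℕ.^ g)) (ι (2 ℕ.^ a) * ι (2 ℕ.^ e)) (2^*half^ g) (*-mono-nonneg 0≤1 (0≤ι (2 ℕ.^ e)) (1≤ι-2^ a) (1≤ι-2^ e)))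
      ; 4≤δsB = subst (λ t → ι 4 ≤ x * y * t) (sym ι-β)
          (arith₂ x y (ι (2 ℕ.^ g)) (ι (2 ℕ.^ a)) (ι (2 ℕ.^ e)) (2^*half^ a) (2^*half^ e) (1≤ι-2^ g))
      }
      where
      fourth>0 : ∀ {t} → 0ℚ < t → 0ℚ < fourth t
      fourth>0 p = *-pos (*-pos p p) (*-pos p p)
      e₁ : ∀ t → 1ℚ + t ≡ ι 4 * (ℚ.½ * (ℚ.½ * t)) + 1ℚ
      e₁ = solve-∀ ℚring
      e₂ : ∀ z → z * z ≡ ι 16 * ((z * z) * half^ 4)
      e₂ = solve-∀ ℚring
      e₃ : ∀ y z → (ℚ.½ * y) * ((z * z) * half^ 4) ≡ ι 2 * (half^ 6 * (y * (z * z)))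
      e₃ = solve-∀ ℚring
      e₄ : ∀ t → ι 4096 * (ι 2 * (half^ 13 * t)) ≡ t
      e₄ = solve-∀ ℚring
      e₅ : ∀ t → t + 0ℚ ≡ ι 1024 * (ι 3 * (half^ 12 * t)) + half^ 2 * t
      e₅ = solve-∀ ℚring
      e₆ : ∀ s y → ι 2 * s + y ≡ s + ι 2 * (ℚ.½ * y) + s
      e₆ = solve-∀ ℚring
      e₇ : ∀ h w s → h * ((ι 2 * w) * s) ≡ (w * h) * (ι 2 * s)
      e₇ = solve-∀ ℚring
      arith₁ : ∀ h w u → w * h ≡ 1ℚ → 1ℚ * 1ℚ ≤ u → ι 400 ≤ h * (ι 512 * (w * u))
      arith₁ h w u eq 1≤u = subst (ι 400 ≤_) (sym (trans (r h w u) (cong (_* (ι 512 * u)) eq)))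
        (lin (0≤ι 512 ⊙ 1≤u ⊕ 0≤ι 112) (r′ u))
        where
        r : ∀ h w u → h * (ι 512 * (w * u)) ≡ (w * h) * (ι 512 * u)
        r = solve-∀ ℚring
        r′ : ∀ u → 1ℚ * (ι 512 * u) + (ι 512 * (1ℚ * 1ℚ) + 0ℚ) ≡ ι 400 + (ι 512 * u + ι 112)
        r′ = solve-∀ ℚring
      arith₂ : ∀ x y w p q → p * x ≡ 1ℚ → q * y ≡ 1ℚ → 1ℚ ≤ w → ι 4 ≤ x * y * (ι 512 * (w * (p * q)))
      arith₂ x y w p q hp hq 1≤w = subst (ι 4 ≤_) (sym (trans (r x y w p q) (cong₂ (λ s t → s * t * (ι 512 * w)) hp hq)))
        (lin (0≤ι 512 ⊙ 1≤w ⊕ 0≤ι 508) (r′ w))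
        where
        r : ∀ x y w p q → x * y * (ι 512 * (w * (p * q))) ≡ (p * x) * (q * y) * (ι 512 * w)
        r = solve-∀ ℚring
        r′ : ∀ w → 1ℚ * 1ℚ * (ι 512 * w) + (ι 512 * 1ℚ + 0ℚ) ≡ ι 4 + (ι 512 * w + ι 508)
        r′ = solve-∀ ℚring

  scale-2^ : ∀ β m → scale (2 ℕ.^ β) m ≡ 2 ℕ.^ (β ℕ.* 2 ℕ.^ (m ℕ.+ m))
  scale-2^ β zero    = cong (2 ℕ.^_) (sym (ℕP.*-identityʳ β))
  scale-2^ β (suc m) = trans (cong (λ q → (q ℕ.* q) ℕ.* (q ℕ.* q)) (scale-2^ β m))
    (trans (sym (trans (ℕP.^-distribˡ-+-* 2 (u ℕ.+ u) (u ℕ.+ u)) (cong₂ ℕ._*_ (ℕP.^-distribˡ-+-* 2 u u) (ℕP.^-distribˡ-+-* 2 u u))))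
      (cong (2 ℕ.^_) (trans (four β (2 ℕ.^ (m ℕ.+ m))) (cong (λ t → β ℕ.* 2 ℕ.^ suc t) (sym (ℕP.+-suc m m))))))
    where
    u : ℕ
    u = β ℕ.* 2 ℕ.^ (m ℕ.+ m)
    four : ∀ β w → (β ℕ.* w ℕ.+ β ℕ.* w) ℕ.+ (β ℕ.* w ℕ.+ β ℕ.* w) ≡ β ℕ.* (2 ℕ.* (2 ℕ.* w))
    four = ℕ-solve-∀

  n<2^n : ∀ n → n ℕ.< 2 ℕ.^ n
  n<2^n zero    = s≤s z≤n
  n<2^n (suc n) = subst (suc (suc n) ℕ.≤_) (cong (2 ℕ.^ n ℕ.+_) (sym (ℕP.+-identityʳ (2 ℕ.^ n))))
    (ℕP.≤-trans (s≤s (n<2^n n)) (ℕP.+-monoˡ-≤ (2 ℕ.^ n) (ℕP.m^n>0 2 n)))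

  -- With m rungs the scale is 2^(β 4ᵐ), where β 4ᵐ ≤ 2^(β + 2m) and m ≤ 5 · 2^(b+g). Thus 1 + β +
  -- 2m is at most one exponential of β + b + g + 5; the 5 supplies a factor 32, enough for 1 + 10.
  scale-bound : ∀ β b g → scale (2 ℕ.^ β) (2 ℕ.^ b ℕ.* suc (2 ℕ.^ suc g) ℕ.+ 2 ℕ.^ suc g)
    ℕ.≤ 2 ℕ.^ (2 ℕ.^ (2 ℕ.^ (β ℕ.+ (b ℕ.+ g ℕ.+ 5)) ℕ.∸ 1))
  scale-bound β b g = subst (ℕ._≤ 2 ℕ.^ (2 ℕ.^ (2 ℕ.^ X ℕ.∸ 1))) (sym (scale-2^ β m))
    (2^-mono (ℕP.≤-trans (subst (β ℕ.* 2 ℕ.^ (m ℕ.+ m) ℕ.≤_) (sym (ℕP.^-distribˡ-+-* 2 β (m ℕ.+ m))) (ℕP.*-monoˡ-≤ (2 ℕ.^ (m ℕ.+ m)) (ℕP.<⇒≤ (n<2^n β))))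
      (2^-mono (ℕP.∸-monoˡ-≤ {suc (β ℕ.+ (m ℕ.+ m))} {2 ℕ.^ X} 1 total))))
    where
    m X G W : ℕ
    m = 2 ℕ.^ b ℕ.* suc (2 ℕ.^ suc g) ℕ.+ 2 ℕ.^ suc g
    X = β ℕ.+ (b ℕ.+ g ℕ.+ 5)
    G = 2 ℕ.^ g
    W = 2 ℕ.^ (b ℕ.+ g)
    2^-mono : ∀ {m n} → m ℕ.≤ n → 2 ℕ.^ m ℕ.≤ 2 ℕ.^ n
    2^-mono = ℕP.^-monoʳ-≤ 2
    W≡ : W ≡ 2 ℕ.^ b ℕ.* G
    W≡ = ℕP.^-distribˡ-+-* 2 b g
    b≤W : 2 ℕ.^ b ℕ.≤ W
    b≤W = 2^-mono (ℕP.m≤m+n b g)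
    G≤W : G ℕ.≤ W
    G≤W = 2^-mono (ℕP.m≤n+m g b)
    m≤ : m ℕ.≤ 5 ℕ.* W
    m≤ = subst₂ ℕ._≤_ (e₁ (2 ℕ.^ b) G) (e₂ W)
      (ℕP.+-mono-≤ b≤W (ℕP.+-mono-≤ (ℕP.*-monoʳ-≤ 2 (ℕP.≤-reflexive (sym W≡))) (ℕP.*-monoʳ-≤ 2 G≤W)))
      where
      e₁ : ∀ p G → p ℕ.+ (2 ℕ.* (p ℕ.* G) ℕ.+ 2 ℕ.* G) ≡ p ℕ.* suc (2 ℕ.* G) ℕ.+ 2 ℕ.* G
      e₁ = ℕ-solve-∀
      e₂ : ∀ W → W ℕ.+ (2 ℕ.* W ℕ.+ 2 ℕ.* W) ≡ 5 ℕ.* W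
      e₂ = ℕ-solve-∀
    total : suc (β ℕ.+ (m ℕ.+ m)) ℕ.≤ 2 ℕ.^ X
    total = ℕP.≤-trans (ℕP.+-mono-≤ (n<2^n β) (ℕP.+-mono-≤ m≤ m≤))
      (ℕP.≤-trans (bound (2 ℕ.^ β) W (ℕP.m^n>0 2 β) (ℕP.m^n>0 2 (b ℕ.+ g)))
        (ℕP.≤-reflexive (sym (trans (ℕP.^-distribˡ-+-* 2 β (b ℕ.+ g ℕ.+ 5)) (cong (2 ℕ.^ β ℕ.*_) (ℕP.^-distribˡ-+-* 2 (b ℕ.+ g) 5))))))
      where
      bound : ∀ p W → 1 ℕ.≤ p → 1 ℕ.≤ W → p ℕ.+ (5 ℕ.* W ℕ.+ 5 ℕ.* W) ℕ.≤ p ℕ.* (W ℕ.* 32)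
      bound p W 1≤p 1≤W = ℕP.≤-trans (ℕP.+-mono-≤ (ℕP.≤-trans (ℕP.≤-reflexive (sym (ℕP.*-identityʳ p))) (ℕP.*-monoʳ-≤ p 1≤W))
          (ℕP.≤-trans (ℕP.≤-reflexive (e₁ W)) (ℕP.*-monoˡ-≤ (10 ℕ.* W) 1≤p)))
        (ℕP.≤-trans (ℕP.m≤m+n (p ℕ.* W ℕ.+ p ℕ.* (10 ℕ.* W)) (p ℕ.* (21 ℕ.* W))) (ℕP.≤-reflexive (e₂ p W)))
        where
        e₁ : ∀ W → 5 ℕ.* W ℕ.+ 5 ℕ.* W ≡ 1 ℕ.* (10 ℕ.* W)
        e₁ = ℕ-solve-∀
        e₂ : ∀ p W → p ℕ.* W ℕ.+ p ℕ.* (10 ℕ.* W) ℕ.+ p ℕ.* (21 ℕ.* W) ≡ p ℕ.* (W ℕ.* 32)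
        e₂ = ℕ-solve-∀

  module _ {k : ℕ} (exps : Exponents k) where
    open Exponents exps
    open Constants exps
    private module P = Parameters parameters

    -- The start has E and F equal to the whole interval. Symmetrisation gives more than δ²N²/8 =
    -- 2δ₀N² points, where δ = `half^ k`; half of them are surplus over density δ₀, so the initial
    -- potential is at least δ₀N².
    corner-free-impossible : ∀ N A → (∀ x → Idempotent (A x)) → CornerFree N A → 0ℚ < ι N →
      half^ k * (ι N * ι N) ≤ size₂ N A → 2 ℕ.^ (2 ℕ.^ (2 ℕ.^ X ℕ.∸ 1)) ℕ.≤ N → ⊥
    corner-free-impossible N A A-idem free 0<N dense N-large =
      some-symmetrisation (half^ k) 0<N (0<half^ k) dense (λ c₁ c₂ → decide c₁ c₂ (≤-or-> (ι 8 * size₂ N (A∩ c₁ c₂)) ((half^ k * half^ k) * (ι N * ι N))))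
      where
      open Symmetrise N A A-idem free
      x : ℚ
      x = half^ a
      x≡ : x ≡ half^ 4 * (half^ k * half^ k)
      x≡ = trans (cong half^ a≡) (trans (half^-+ 4 (k ℕ.+ k)) (cong (half^ 4 *_) (half^-+ k k)))
      scale≤N : scale P.B (K ℕ.* suc P.T ℕ.+ P.T) ℕ.≤ N
      scale≤N = ℕP.≤-trans (ℕP.≤-reflexive (cong (λ K → scale P.B (K ℕ.* suc P.T ℕ.+ P.T)) K≡)) (ℕP.≤-trans (scale-bound β b g) N-large)
      enough-steps : 1ℚ ≤ x + ι K * half^ b
      enough-steps = lin (ℚP.<⇒≤ (0<half^ a) ⊕ ℚP.≤-reflexive (sym (trans (cong (λ K → ι K * half^ b) K≡) (2^*half^ b)))) (e′ x (ι K * half^ b))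
        where
        e′ : ∀ x y → x + y + (0ℚ + 1ℚ) ≡ 1ℚ + (x + y)
        e′ = solve-∀ ℚring
      start : P.σ K + ι 2 * P.κ ≤ x
      start = subst (P.σ K + ι 2 * P.κ ≤_) 2surplus-K (lin (P.s≤σ K) (e′ (P.σ K) P.s))
        where
        e′ : ∀ s y → ι 2 * s + y ≡ s + ι 2 * (ℚ.½ * y) + s
        e′ = solve-∀ ℚring
      decide : ∀ c₁ c₂ → ι 8 * size₂ N (A∩ c₁ c₂) ≤ (half^ k * half^ k) * (ι N * ι N)
          ⊎ (half^ k * half^ k) * (ι N * ι N) < ι 8 * size₂ N (A∩ c₁ c₂) →
        ι 8 * size₂ N (A∩ c₁ c₂) ≤ (half^ k * half^ k) * (ι N * ι N)
      decide c₁ c₂ (inj₁ h) = h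
      decide c₁ c₂ (inj₂ h) = ⊥-elim (Iteration.impossible parameters K P.T N x x ℚP.≤-refl enough-steps scale≤N
        (ℚP.≤-trans P.T-large (lin (ℚP.<⇒≤ (0<half^ a)) (e₀ (ι P.T * P.τ) x)))
        (A∩ c₁ c₂) (λ _ → 1ℚ) (λ _ → 1ℚ) (state c₁ c₂)
        (subst (λ n → x * (ι N * ι N) ≤ size₂ N (A∩ c₁ c₂) - x * (n * n) + P.κ * (n * n + n * n)) (sym (trans (Σ-const N 1ℚ) (ℚP.*-identityʳ (ι N))))
          (arith (size₂ N (A∩ c₁ c₂)) (ι N) x P.κ (half^ k * half^ k) P.0≤κ x≡ (ℚP.<⇒≤ h))) start)
        where
        e₀ : ∀ y x → x + y + 0ℚ ≡ y + x
        e₀ = solve-∀ ℚring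
        arith : ∀ s n x κ d → 0ℚ ≤ κ → x ≡ half^ 4 * d → d * (n * n) ≤ ι 8 * s → x * (n * n) ≤ s - x * (n * n) + κ * (n * n + n * n)
        arith s n x κ d 0≤κ refl h = *-cancel-≤ (ι 8) (0<ι 7) (lin (h ⊕ ≤-*-nonneg (0≤ι 8) (≤-*-nonneg 0≤κ (≤-+-nonneg (sq≥0 n) (sq≥0 n)))) (e₁ s n κ d))
          where
          e₁ : ∀ s n κ d → ι 8 * (s - (half^ 4 * d) * (n * n) + κ * (n * n + n * n)) + (d * (n * n) + 0ℚ)
             ≡ ι 8 * ((half^ 4 * d) * (n * n)) + (ι 8 * s + ι 8 * (κ * (n * n + n * n)))
          e₁ = solve-∀ ℚring

    -- `X` is linear in a, b and K(b + 1), all at most K² for K = 2ᵇ; the coefficients sum to 94 +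
    -- 52 + 1 + 19 = 166 ≤ 2⁸.
    X-bound : ∀ m → m ≡ 8 ℕ.+ (b ℕ.+ b) → suc X ℕ.≤ 2 ℕ.^ m
    X-bound m m≡ = ℕP.≤-trans (ℕP.≤-reflexive X≡) (ℕP.≤-trans (poly a b K a≤K b<K) (ℕP.≤-reflexive (sym power≡)))
      where
      a≤b : a ℕ.≤ b
      a≤b = subst (a ℕ.≤_) (sym b≡) (subst (a ℕ.≤_) (e₁ a) (ℕP.m≤m+n a (13 ℕ.+ 7 ℕ.* a)))
        where
        e₁ : ∀ a → a ℕ.+ (13 ℕ.+ 7 ℕ.* a) ≡ 13 ℕ.+ (((a ℕ.+ a) ℕ.+ (a ℕ.+ a)) ℕ.+ ((a ℕ.+ a) ℕ.+ (a ℕ.+ a)))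
        e₁ = ℕ-solve-∀
      b<K : suc b ℕ.≤ K
      b<K = subst (suc b ℕ.≤_) (sym K≡) (n<2^n b)
      a≤K : a ℕ.≤ K
      a≤K = ℕP.≤-trans a≤b (ℕP.≤-trans (ℕP.n≤1+n b) b<K)
      X≡ : suc X ≡ 94 ℕ.+ 52 ℕ.* a ℕ.+ b ℕ.+ 19 ℕ.* (K ℕ.* suc b)
      X≡ = collect a b K e ρ g β e≡ ρ≡ g≡ β≡
        where
        collect : ∀ a b K e ρ g β → e ≡ suc (a ℕ.+ K ℕ.* suc b) → ρ ≡ 12 ℕ.+ ((fourfold a ℕ.+ fourfold a) ℕ.+ fourfold e) →
          g ≡ 6 ℕ.+ (e ℕ.+ (ρ ℕ.+ ρ)) → β ≡ 9 ℕ.+ (g ℕ.+ (a ℕ.+ e)) →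
          suc (β ℕ.+ (b ℕ.+ g ℕ.+ 5)) ≡ 94 ℕ.+ 52 ℕ.* a ℕ.+ b ℕ.+ 19 ℕ.* (K ℕ.* suc b)
        collect a b K e ρ g β refl refl refl refl = e₁ a b (K ℕ.* suc b)
          where
          e₁ : ∀ a b w →
            let e = 1 ℕ.+ (a ℕ.+ w)
                ρ = 12 ℕ.+ ((((a ℕ.+ a) ℕ.+ (a ℕ.+ a)) ℕ.+ ((a ℕ.+ a) ℕ.+ (a ℕ.+ a))) ℕ.+ ((e ℕ.+ e) ℕ.+ (e ℕ.+ e)))
                g = 6 ℕ.+ (e ℕ.+ (ρ ℕ.+ ρ)) in
            1 ℕ.+ ((9 ℕ.+ (g ℕ.+ (a ℕ.+ e))) ℕ.+ (b ℕ.+ g ℕ.+ 5)) ≡ 94 ℕ.+ 52 ℕ.* a ℕ.+ b ℕ.+ 19 ℕ.* w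
          e₁ = ℕ-solve-∀
      poly : ∀ a b K → a ℕ.≤ K → suc b ℕ.≤ K → 94 ℕ.+ 52 ℕ.* a ℕ.+ b ℕ.+ 19 ℕ.* (K ℕ.* suc b) ℕ.≤ 256 ℕ.* (K ℕ.* K)
      poly a b K a≤K b<K = ℕP.≤-trans
        (ℕP.+-mono-≤ (ℕP.+-mono-≤ (ℕP.+-mono-≤ (ℕP.*-monoʳ-≤ 94 1≤K²) (ℕP.*-monoʳ-≤ 52 (ℕP.≤-trans a≤K K≤K²)))
          (ℕP.≤-trans (ℕP.≤-trans (ℕP.n≤1+n b) b<K) K≤K²)) (ℕP.*-monoʳ-≤ 19 (ℕP.*-monoʳ-≤ K b<K)))
        (ℕP.≤-trans (ℕP.m≤m+n _ (90 ℕ.* (K ℕ.* K))) (ℕP.≤-reflexive (e₁ (K ℕ.* K))))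
        where
        1≤K : 1 ℕ.≤ K
        1≤K = ℕP.≤-trans (s≤s z≤n) b<K
        K≤K² : K ℕ.≤ K ℕ.* K
        K≤K² = ℕP.≤-trans (ℕP.≤-reflexive (sym (ℕP.*-identityʳ K))) (ℕP.*-monoʳ-≤ K 1≤K)
        1≤K² : 1 ℕ.≤ K ℕ.* K
        1≤K² = ℕP.≤-trans 1≤K K≤K²
        e₁ : ∀ q → 94 ℕ.* q ℕ.+ 52 ℕ.* q ℕ.+ q ℕ.+ 19 ℕ.* q ℕ.+ 90 ℕ.* q ≡ 256 ℕ.* q
        e₁ = ℕ-solve-∀
      power≡ : 2 ℕ.^ m ≡ 256 ℕ.* (K ℕ.* K)
      power≡ = trans (cong (2 ℕ.^_) m≡) (trans (ℕP.^-distribˡ-+-* 2 8 (b ℕ.+ b))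
        (cong (256 ℕ.*_) (trans (ℕP.^-distribˡ-+-* 2 b b) (cong₂ ℕ._*_ (sym K≡) (sym K≡)))))

    exponent : 98 ℕ.+ 32 ℕ.* k ≡ 8 ℕ.+ (b ℕ.+ b)
    exponent = sym (trans (cong (λ b → 8 ℕ.+ (b ℕ.+ b)) b≡) (trans (e₁ a) (trans (cong (λ a → 34 ℕ.+ 16 ℕ.* a) a≡) (e₂ k))))
      where
      e₁ : ∀ a → 8 ℕ.+ ((13 ℕ.+ (((a ℕ.+ a) ℕ.+ (a ℕ.+ a)) ℕ.+ ((a ℕ.+ a) ℕ.+ (a ℕ.+ a)))) ℕ.+ (13 ℕ.+ (((a ℕ.+ a) ℕ.+ (a ℕ.+ a)) ℕ.+ ((a ℕ.+ a) ℕ.+ (a ℕ.+ a))))) ≡ 34 ℕ.+ 16 ℕ.* a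
      e₁ = ℕ-solve-∀
      e₂ : ∀ k → 34 ℕ.+ 16 ℕ.* (4 ℕ.+ (k ℕ.+ k)) ≡ 98 ℕ.+ 32 ℕ.* k
      e₂ = ℕ-solve-∀

  -- The choice of c and the search for a corner.

  dyadic-range : ∀ n p q → p ℕ.≤ q → q ℕ.< 2 ℕ.^ n ℕ.* p → ∃ λ k → 2 ℕ.^ k ℕ.* p ℕ.≤ q × q ℕ.≤ 2 ℕ.^ suc k ℕ.* p
  dyadic-range zero    p q p≤q q<p = ⊥-elim (ℕP.<⇒≱ q<p (subst (ℕ._≤ q) (sym (ℕP.*-identityˡ p)) p≤q))
  dyadic-range (suc n) p q p≤q q< = step (q ℕ.<? 2 ℕ.^ n ℕ.* p)
    where
    step : Dec (q ℕ.< 2 ℕ.^ n ℕ.* p) → ∃ λ k → 2 ℕ.^ k ℕ.* p ℕ.≤ q × q ℕ.≤ 2 ℕ.^ suc k ℕ.* p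
    step (yes h) = dyadic-range n p q p≤q h
    step (no h)  = n , ℕP.≮⇒≥ h , ℕP.<⇒≤ q<

  ^-distribʳ-* : ∀ n a b → (a ℕ.* b) ℕ.^ n ≡ a ℕ.^ n ℕ.* b ℕ.^ n
  ^-distribʳ-* zero    a b = refl
  ^-distribʳ-* (suc n) a b = trans (cong (a ℕ.* b ℕ.*_) (^-distribʳ-* n a b)) (rearr a b (a ℕ.^ n) (b ℕ.^ n))
    where
    rearr : ∀ a b c d → (a ℕ.* b) ℕ.* (c ℕ.* d) ≡ (a ℕ.* c) ℕ.* (b ℕ.* d)
    rearr = ℕ-solve-∀

  -- From 2ᵏ p ≤ q and 4 p ≤ 3 q: (q/p)ᵘ ≥ 2ᵏᵘ and (q/p)³ᵛ ≥ (64/27)ᵛ ≥ 2ᵛ.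
  ratio-power : ∀ u v k p q → 2 ℕ.^ k ℕ.* p ℕ.≤ q → 4 ℕ.* p ℕ.≤ 3 ℕ.* q →
    2 ℕ.^ (k ℕ.* u ℕ.+ v) ℕ.* p ℕ.^ (u ℕ.+ 3 ℕ.* v) ℕ.≤ q ℕ.^ (u ℕ.+ 3 ℕ.* v)
  ratio-power u v k p q h₁ h₂ = subst₂ ℕ._≤_ left right (ℕP.*-mono-≤ (ℕP.^-monoˡ-≤ u h₁) (ℕP.^-monoˡ-≤ v cubes))
    where
    cubes : 2 ℕ.* p ℕ.^ 3 ℕ.≤ q ℕ.^ 3
    cubes = ℕP.*-cancelˡ-≤ 27 (ℕP.≤-trans (ℕP.≤-trans (ℕP.m≤m+n (27 ℕ.* (2 ℕ.* p ℕ.^ 3)) (10 ℕ.* p ℕ.^ 3)) (ℕP.≤-reflexive (e₁ p)))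
      (ℕP.≤-trans (ℕP.*-mono-≤ h₂ (ℕP.*-mono-≤ h₂ h₂)) (ℕP.≤-reflexive (e₂ q))))
      where
      e₁ : ∀ p → 27 ℕ.* (2 ℕ.* (p ℕ.* (p ℕ.* (p ℕ.* 1)))) ℕ.+ 10 ℕ.* (p ℕ.* (p ℕ.* (p ℕ.* 1))) ≡ 4 ℕ.* p ℕ.* (4 ℕ.* p ℕ.* (4 ℕ.* p))
      e₁ = ℕ-solve-∀
      e₂ : ∀ q → 3 ℕ.* q ℕ.* (3 ℕ.* q ℕ.* (3 ℕ.* q)) ≡ 27 ℕ.* (q ℕ.* (q ℕ.* (q ℕ.* 1)))
      e₂ = ℕ-solve-∀
    rearr : ∀ a b c d → (a ℕ.* b) ℕ.* (c ℕ.* d) ≡ (a ℕ.* c) ℕ.* (b ℕ.* d)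
    rearr = ℕ-solve-∀
    left : (2 ℕ.^ k ℕ.* p) ℕ.^ u ℕ.* (2 ℕ.* p ℕ.^ 3) ℕ.^ v ≡ 2 ℕ.^ (k ℕ.* u ℕ.+ v) ℕ.* p ℕ.^ (u ℕ.+ 3 ℕ.* v)
    left = trans (cong₂ ℕ._*_
        (trans (^-distribʳ-* u (2 ℕ.^ k) p) (cong (ℕ._* p ℕ.^ u) (ℕP.^-*-assoc 2 k u)))
        (trans (^-distribʳ-* v 2 (p ℕ.^ 3)) (cong (2 ℕ.^ v ℕ.*_) (ℕP.^-*-assoc p 3 v))))
      (trans (rearr (2 ℕ.^ (k ℕ.* u)) (p ℕ.^ u) (2 ℕ.^ v) (p ℕ.^ (3 ℕ.* v)))
        (cong₂ ℕ._*_ (sym (ℕP.^-distribˡ-+-* 2 (k ℕ.* u) v)) (sym (ℕP.^-distribˡ-+-* p u (3 ℕ.* v)))))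
    right : q ℕ.^ u ℕ.* (q ℕ.^ 3) ℕ.^ v ≡ q ℕ.^ (u ℕ.+ 3 ℕ.* v)
    right = trans (cong (q ℕ.^ u ℕ.*_) (ℕP.^-*-assoc q 3 v)) (sym (ℕP.^-distribˡ-+-* q u (3 ℕ.* v)))

  CornerAt : (ℕ → ℕ → Bool) → ℕ → ℕ → ℕ → ℕ → Set
  CornerAt P N k m d = 0 ℕ.< d × InA P N k m × InA P N (k ℕ.+ d) m × InA P N k (m ℕ.+ d)

  corner? : ∀ P N k m d → Dec (CornerAt P N k m d)
  corner? P N k m d = (0 ℕ.<? d) ×-dec inA? k m ×-dec inA? (k ℕ.+ d) m ×-dec inA? k (m ℕ.+ d)
    where
    inA? : ∀ x y → Dec (InA P N x y)
    inA? x y = (1 ℕ.≤? x) ×-dec (x ℕ.≤? N) ×-dec (1 ℕ.≤? y) ×-dec (y ℕ.≤? N) ×-dec (P x y Bool.≟ true)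

  -- A bounded search decides whether a corner exists, so refuting corner-freeness yields an actual
  -- one. `points` starts its coordinates at 0, whence the successors.
  find-corner : ∀ P N → (∃ λ k → ∃ λ m → ∃ λ d → CornerAt P N k m d) ⊎ CornerFree N (points P)
  find-corner P N = from (ℕP.anyUpTo? (λ k → ℕP.anyUpTo? (λ m → ℕP.anyUpTo? (λ d → corner? P N k m d) (suc N)) (suc N)) (suc N))
    where
    Found : Set
    Found = ∃ λ k → k ℕ.< suc N × (∃ λ m → m ℕ.< suc N × (∃ λ d → d ℕ.< suc N × CornerAt P N k m d))
    from : Dec Found → (∃ λ k → ∃ λ m → ∃ λ d → CornerAt P N k m d) ⊎ CornerFree N (points P)
    from (yes (k , _ , m , _ , d , _ , c)) = inj₁ (k , m , d , c)
    from (no none) = inj₂ free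
      where
      free : CornerFree N (points P)
      free x y d 1≤d x+d<N y+d<N = value (P (suc x) (suc y)) (P (suc (x ℕ.+ d)) (suc y)) (P (suc x) (suc (y ℕ.+ d))) refl refl refl
        where
        x<N : suc x ℕ.≤ N
        x<N = ℕP.≤-trans (s≤s (ℕP.m≤m+n x d)) x+d<N
        y<N : suc y ℕ.≤ N
        y<N = ℕP.≤-trans (s≤s (ℕP.m≤m+n y d)) y+d<N
        d≤N : d ℕ.≤ N
        d≤N = ℕP.≤-trans (ℕP.m≤n+m d x) (ℕP.<⇒≤ x+d<N)
        1≤ : ∀ {n} → 1 ℕ.≤ suc n
        1≤ = s≤s z≤n
        value : ∀ a b c → P (suc x) (suc y) ≡ a → P (suc (x ℕ.+ d)) (suc y) ≡ b → P (suc x) (suc (y ℕ.+ d)) ≡ c →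
          points P x y * (points P (x ℕ.+ d) y * points P x (y ℕ.+ d)) ≡ 0ℚ
        value true true true ha hb hc = ⊥-elim (none (suc x , s≤s x<N , suc y , s≤s y<N , d , s≤s d≤N ,
          1≤d , (1≤ , x<N , 1≤ , y<N , ha) , (1≤ , x+d<N , 1≤ , y<N , hb) , (1≤ , x<N , 1≤ , y+d<N , hc)))
        value false b c ha hb hc = trans (cong (λ t → indicator t * (points P (x ℕ.+ d) y * points P x (y ℕ.+ d))) ha) (ℚP.*-zeroˡ (points P (x ℕ.+ d) y * points P x (y ℕ.+ d)))
        value true false c ha hb hc = trans (cong (λ t → points P x y * (indicator t * points P x (y ℕ.+ d))) hb)
          (trans (cong (points P x y *_) (ℚP.*-zeroˡ (points P x (y ℕ.+ d)))) (ℚP.*-zeroʳ (points P x y)))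
        value true true false ha hb hc = trans (cong (λ t → points P x y * (points P (x ℕ.+ d) y * indicator t)) hc)
          (trans (cong (points P x y *_) (ℚP.*-zeroʳ (points P (x ℕ.+ d) y))) (ℚP.*-zeroʳ (points P x y)))

  points-idem : ∀ P x → Idempotent (points P x)
  points-idem P x y = indicator-idem (P (suc x) (suc y))

  module _ (p q N : ℕ) (P : ℕ → ℕ → Bool) (1≤p : 1 ℕ.≤ p) (p≤q : p ℕ.≤ q) (dense : p ℕ.* (N ℕ.* N) ℕ.≤ q ℕ.* card P N)
    (free : CornerFree N (points P)) where

    private
      dense′ : ι p * (ι N * ι N) ≤ ι q * size₂ N (points P)
      dense′ = subst₂ _≤_ (trans (ι-* p (N ℕ.* N)) (cong (ι p *_) (ι-* N N))) (trans (ι-* q (card P N)) (cong (ι q *_) (ι-card P N))) (ι-mono dense)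

    -- When q/p is near 1, so is any fixed power of it, and the tower yields only a constant lower
    -- bound for N; for density at least 3/4 that suffices.
    very-dense-impossible : 64 ℕ.≤ N → 3 ℕ.* q ℕ.≤ 4 ℕ.* p → ⊥
    very-dense-impossible 64≤N h = go N 64≤N refl
      where
      bound : ι 3 * (ι N * ι N) ≤ ι 4 * size₂ N (points P)
      bound = *-cancel-≤ (ι q) (ℚP.<-≤-trans (0<ι 0) (ι-mono (ℕP.≤-trans 1≤p p≤q)))
        (lin (0≤ι 4 ⊙ dense′ ⊕ sq≥0 (ι N) ⊙ subst₂ _≤_ (ι-* 3 q) (ι-* 4 p) (ι-mono h)) (eq (ι p) (ι q) (ι N) (size₂ N (points P))))
        where
        eq : ∀ p q n s → q * (ι 4 * s) + (ι 4 * (p * (n * n)) + (n * n) * (ι 3 * q)) ≡ q * (ι 3 * (n * n)) + (ι 4 * (q * s) + (n * n) * (ι 4 * p))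
        eq = solve-∀ ℚring
      go : ∀ n → 64 ℕ.≤ n → n ≡ N → ⊥
      go (suc n) (s≤s 63≤n) refl = VeryDense.dense-impossible n (points P) (points-idem P) free
        (ι-mono {8} {n} (ℕP.≤-trans (ℕP.m≤m+n 8 55) 63≤n)) bound

    sparse-impossible : ∀ {k} (exps : Exponents k) w (x : ℚ) y → ℚ.toℚᵘ x ℚᵘ.≃ y → q ℕ.≤ 2 ℕ.^ k ℕ.* p → 1 ℕ.≤ N →
      w ≡ 98 ℕ.+ 32 ℕ.* k → ι (2 ℕ.^ w) ≤ x → Tower3Le y N → ⊥
    sparse-impossible {k} exps w x y x≃y q≤ 1≤N w≡ x-large tower = corner-free-impossible exps N (points P) (points-idem P) free
        (ℚP.<-≤-trans (0<ι 0) (ι-mono 1≤N)) bound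
        (Tower.triple-exponential {x} {y} x≃y tower (Exponents.X exps)
          (ℚP.≤-trans (ι-mono (X-bound exps w (trans w≡ (exponent exps)))) x-large))
      where
      0<p : 0ℚ < ι p
      0<p = ℚP.<-≤-trans (0<ι 0) (ι-mono 1≤p)
      bound : half^ k * (ι N * ι N) ≤ size₂ N (points P)
      bound = *-cancel-≤ (ι p) 0<p (arith (ι p) (ι q) (ι N) (size₂ N (points P)) (ι (2 ℕ.^ k)) (half^ k) (ℚP.<⇒≤ (0<half^ k)) dense′
          (subst (ι q ≤_) (ι-* (2 ℕ.^ k) p) (ι-mono q≤)) (2^*half^ k)
          (Σ-nonneg N (λ x → Σ-nonneg N (λ y → 0≤idem (points-idem P x y)))))
        where
        arith : ∀ p q n s w h → 0ℚ ≤ h → p * (n * n) ≤ q * s → q ≤ w * p → w * h ≡ 1ℚ → 0ℚ ≤ s → p * (h * (n * n)) ≤ p * s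
        arith p q n s w h 0≤h h₁ h₂ h₃ 0≤s = subst (p * (h * (n * n)) ≤_) (trans (r p w h s) (trans (cong (_* (p * s)) h₃) (ℚP.*-identityˡ (p * s))))
          (lin (0≤h ⊙ h₁ ⊕ ≤-*-nonneg 0≤h 0≤s ⊙ h₂) (eq p q n s w h))
          where
          r : ∀ p w h s → (h * s) * (w * p) ≡ (w * h) * (p * s)
          r = solve-∀ ℚring
          eq : ∀ p q n s w h → (h * s) * (w * p) + (h * (p * (n * n)) + (h * s) * q) ≡ p * (h * (n * n)) + (h * (q * s) + (h * s) * (w * p))
          eq = solve-∀ ℚring

  -- If 2ᵏ ≤ q/p ≤ 2ᵏ⁺¹, the density is at least 2^-(k+1) and the sparse case asks for (q/p)ᶜ ≥
  -- 2^(98 + 32(k+1)). Variables `u` and `v` keep the large powers symbolic.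
  corners-from : ∀ u v → (∀ k → k ℕ.* u ℕ.+ v ≡ 98 ℕ.+ 32 ℕ.* suc k) → let c = u ℕ.+ 3 ℕ.* v in
    ∀ p q → 1 ℕ.≤ p → p ℕ.≤ q → ∀ N → 1 ℕ.≤ N → Tower3Le (frac (q ℕ.^ c) (p ℕ.^ c)) N →
    ∀ P → p ℕ.* (N ℕ.* N) ℕ.≤ q ℕ.* card P N → ∃ λ k → ∃ λ m → ∃ λ d → CornerAt P N k m d
  corners-from u v exponents≡ p q 1≤p p≤q N 1≤N tower P dense = conclude (find-corner P N)
      where
      c : ℕ
      c = u ℕ.+ 3 ℕ.* v
      y = frac (q ℕ.^ c) (p ℕ.^ c)
      x : ℚ
      x = ℚ.fromℚᵘ y
      x≃y : ℚ.toℚᵘ x ℚᵘ.≃ y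
      x≃y = ℚP.toℚᵘ-fromℚᵘ y
      1≤p^c : 1 ℕ.≤ p ℕ.^ c
      1≤p^c = ℕP.m^n>0 p {{ℕ.>-nonZero 1≤p}} c
      1≤x : 1ℚ ≤ x
      1≤x = ≤-frac 1 (q ℕ.^ c) (p ℕ.^ c) 1≤p^c (subst (ℕ._≤ q ℕ.^ c) (sym (ℕP.*-identityˡ (p ℕ.^ c))) (ℕP.^-monoˡ-≤ c p≤q))
      q<2^q*p : q ℕ.< 2 ℕ.^ q ℕ.* p
      q<2^q*p = ℕP.≤-trans (n<2^n q) (ℕP.≤-trans (ℕP.≤-reflexive (sym (ℕP.*-identityʳ (2 ℕ.^ q)))) (ℕP.*-monoʳ-≤ (2 ℕ.^ q) 1≤p))
      absurd : CornerFree N (points P) → Dec (3 ℕ.* q ℕ.≤ 4 ℕ.* p) → ⊥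
      absurd free (yes h) = very-dense-impossible p q N P 1≤p p≤q dense free (Tower.64≤N {x} {y} x≃y tower 1≤x) h
      absurd free (no h) = below (dyadic-range q p q p≤q q<2^q*p)
        where
        below : (∃ λ k → 2 ℕ.^ k ℕ.* p ℕ.≤ q × q ℕ.≤ 2 ℕ.^ suc k ℕ.* p) → ⊥
        below (k , lower , upper) = sparse-impossible p q N P 1≤p p≤q dense free (exponents (suc k)) (k ℕ.* u ℕ.+ v) x y x≃y upper 1≤N (exponents≡ k)
          (≤-frac (2 ℕ.^ (k ℕ.* u ℕ.+ v)) (q ℕ.^ c) (p ℕ.^ c) 1≤p^c (ratio-power u v k p q lower (ℕP.<⇒≤ (ℕP.≰⇒> h)))) tower
      conclude : (∃ λ k → ∃ λ m → ∃ λ d → CornerAt P N k m d) ⊎ CornerFree N (points P) →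
        ∃ λ k → ∃ λ m → ∃ λ d → CornerAt P N k m d
      conclude (inj₁ c) = c
      conclude (inj₂ free) = ⊥-elim (absurd free (3 ℕ.* q ℕ.≤? 4 ℕ.* p))

  corners : ∃ λ c → 1 ℕ.≤ c × (∀ p q → 1 ℕ.≤ p → p ℕ.≤ q → ∀ N → 1 ℕ.≤ N → Tower3Le (frac (q ℕ.^ c) (p ℕ.^ c)) N →
    ∀ P → p ℕ.* (N ℕ.* N) ℕ.≤ q ℕ.* card P N → ∃ λ k → ∃ λ m → ∃ λ d → CornerAt P N k m d)
  -- 98 + 32(k + 1) = 32k + 130, so u = 32 and v = 130. The factor 3 on v comes from (4/3)³ ≥ 2,
  -- which supplies the constant part even when k = 0; altogether c = 422.
  corners = 32 ℕ.+ 3 ℕ.* 130 , s≤s z≤n , corners-from 32 130 exponents≡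
    where
    exponents≡ : ∀ k → k ℕ.* 32 ℕ.+ 130 ≡ 98 ℕ.+ 32 ℕ.* suc k
    exponents≡ = ℕ-solve-∀

open import Data.Nat using (ℕ; _+_; _*_; _^_; _≤_; _<_)
open import Data.Bool using (Bool)
open import Data.Product using (∃; ∃-syntax; _×_)

theorem1p4 : ∃[ c ] (1 ≤ c ×
    (∀ (p q : ℕ) → 1 ≤ p → p ≤ q →
    ∀ (N : ℕ) → 1 ≤ N → Tower3Le (frac (q ^ c) (p ^ c)) N →
    ∀ (P : ℕ → ℕ → Bool) → p * (N * N) ≤ q * card P N →
    ∃[ k ] ∃[ m ] ∃[ d ] (0 < d × InA P N k m × InA P N (k + d) m × InA P N k (m + d))))
theorem1p4 = Development.corners
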